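{- Let $\zeta\in(0,1)$ be a constant. For any integers $k,d,s$ satisfying $s=\zeta k$ and $k \ge C\log d + o(k) + O_\zeta(1)$, where $$C = \begin{cases} \frac{1}{1-\sqrt{2\zeta}}, & \zeta\in(0,3-2\sqrt2),\\ \frac{2}{1-\zeta}, & \zeta\in[3-2\sqrt2,1),\end{cases}$$ Valiant's algorithm exactly learns any $(k,d,s)$-CNF formula $\Phi$ on $n$ variables from i.i.d. uniform random solutions of $\Phi$ with probability at least $1-\delta$, using sample complexity $T=O_{k,\zeta}(\log\frac n\delta)$ and computational complexity $O_{k,\zeta}(n^k\log\frac n\delta)$.
   Context: $\log$ denotes $\log_2$. A $(k,d,s)$-CNF formula is a CNF formula in which every clause contains exactly $k$ distinct variables, every variable appears in at most $d$ clauses, and any two distinct clauses share at most $s$ variables. $\mu_\Phi$ is the uniform distribution over satisfying assignments of $\Phi$. Valiant's algorithm: given $n$, $k$ and samples $X_1,\dots,X_T$, start with all $2^k\binom nk$ possible clauses on $k$ distinct variables; remove every clause violated by some sample; output the remaining formula $\widehat\Phi$. Exact learning with probability at least $1-\delta$ means that, given $T$ i.i.d. samples from $\mu_\Phi$, with probability at least $1-\delta$ the output satisfies $\mu_{\widehat\Phi}=\mu_\Phi$. -}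

module Defs where

import Algebra.Definitions.RawSemiring
open import Data.Bool using (Bool; true; false; if_then_else_)
import Data.Bool.Properties as Bool
open import Data.Fin using (Fin)
import Data.Fin as Fin
import Data.Fin.Properties as Fin
open import Data.Integer using (ℤ; +_; -[1+_])
open import Data.List using (List; []; _∷_; map; filter; foldr; length; cartesianProductWith)
open import Data.List.Membership.Propositional using (_∈_)
open import Data.List.Membership.Propositional.Properties using (∈-cartesianProductWith⁺)
open import Data.List.Relation.Unary.All using (All; all?; lookup; tabulate)
open import Data.List.Relation.Unary.Any using (Any; any?; here; there)
open import Data.List.Relation.Unary.Linked using (Linked)
open import Data.List.Relation.Unary.Unique.Propositional using (Unique)
open import Data.Nat using (ℕ; zero; suc; _≤_)
import Data.Nat as ℕ
import Data.Nat.Properties as ℕ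
open import Data.Product using (_×_; _,_; proj₁; ∃-syntax)
open import Data.Rational using (ℚ; 0ℚ; 1ℚ; ½; _/_; ↥_; ↧ₙ_)
import Data.Rational as ℚ
import Data.Rational.Properties as ℚ
open import Data.Sum using (_⊎_)
open import Data.Vec using (Vec; []; _∷_)
import Data.Vec as Vec
open import Relation.Binary.PropositionalEquality using (_≡_; _≢_; _≗_; refl)
open import Relation.Nullary using (¬_; Dec; does)
open import Relation.Nullary.Decidable using (map′)
open import Relation.Unary using (Decidable)

open Algebra.Definitions.RawSemiring ℚ.+-*-rawSemiring using (_^_)

fromℕ : ℕ → ℚ
fromℕ n = + n / 1

------------------------------------------------------------------------
-- Real numbers as two-sided Dedekind cuts in ℚ

-- L q means "q < x" and U q means "x < q".  The operations below are the
-- usual formulas on cuts; IsReal carries the axioms and is required of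
-- real numbers that are quantified over.
record Cut : Set₁ where
  field
    L U : ℚ → Set

open Cut public

record IsReal (x : Cut) : Set where
  field
    L-inhabited : ∃[ q ] L x q
    U-inhabited : ∃[ q ] U x q
    L-lower     : ∀ {p q} → p ℚ.< q → L x q → L x p
    U-upper     : ∀ {p q} → p ℚ.< q → U x p → U x q
    L-rounded   : ∀ {p} → L x p → ∃[ q ] p ℚ.< q × L x q
    U-rounded   : ∀ {q} → U x q → ∃[ p ] p ℚ.< q × U x p
    disjoint    : ∀ {q} → L x q → ¬ U x q
    located     : ∀ {p q} → p ℚ.< q → L x p ⊎ U x q

infix  4 _≤ᴿ_ _<ᴿ_
infixl 6 _+ᴿ_ _-ᴿ_
infixl 7 _*ᴿ_ _÷ᴿ_

_≤ᴿ_ : Cut → Cut → Set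
x ≤ᴿ y = ∀ q → L x q → L y q

_<ᴿ_ : Cut → Cut → Set
x <ᴿ y = ∃[ q ] U x q × L y q

fromℚ : ℚ → Cut
fromℚ r .L q = q ℚ.< r
fromℚ r .U q = r ℚ.< q

⟦_⟧ : ℕ → Cut
⟦ n ⟧ = fromℚ (fromℕ n)

_+ᴿ_ : Cut → Cut → Cut
(x +ᴿ y) .L q = ∃[ a ] ∃[ b ] L x a × L y b × q ℚ.≤ a ℚ.+ b
(x +ᴿ y) .U q = ∃[ a ] ∃[ b ] U x a × U y b × a ℚ.+ b ℚ.≤ q

_-ᴿ_ : Cut → Cut → Cut
(x -ᴿ y) .L q = ∃[ a ] ∃[ b ] L x a × U y b × q ℚ.≤ a ℚ.- b
(x -ᴿ y) .U q = ∃[ a ] ∃[ b ] U x a × L y b × a ℚ.- b ℚ.≤ q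

-- Product of nonnegative reals.
_*ᴿ_ : Cut → Cut → Cut
(x *ᴿ y) .L q = q ℚ.< 0ℚ ⊎
  (∃[ a ] ∃[ b ] 0ℚ ℚ.≤ a × 0ℚ ℚ.≤ b × L x a × L y b × q ℚ.≤ a ℚ.* b)
(x *ᴿ y) .U q = ∃[ a ] ∃[ b ] U x a × U y b × a ℚ.* b ℚ.≤ q

-- Quotient of a nonnegative real by a positive real:
-- q < x / y iff q · b ≤ a for some a < x and b > y.
_÷ᴿ_ : Cut → Cut → Cut
(x ÷ᴿ y) .L q = ∃[ a ] ∃[ b ] L x a × U y b × q ℚ.* b ℚ.≤ a
(x ÷ᴿ y) .U q = ∃[ a ] ∃[ b ] U x a × 0ℚ ℚ.< b × L y b × a ℚ.≤ q ℚ.* b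

-- Square root of a nonnegative real.
√ : Cut → Cut
√ x .L q = q ℚ.< 0ℚ ⊎ L x (q ℚ.* q)
√ x .U q = 0ℚ ℚ.< q × U x (q ℚ.* q)

2^_ : ℤ → ℚ
2^ (+ n)    = fromℕ 2 ^ n
2^ -[1+ n ] = ½ ^ suc n

-- Binary logarithm of a positive real: with q = m / e in lowest terms,
-- q < log₂ x iff 2 ^ m < x ^ e.
log₂ : Cut → Cut
log₂ x .L q = ∃[ a ] 0ℚ ℚ.< a × L x a × 2^ (↥ q) ℚ.≤ a ^ ↧ₙ q
log₂ x .U q = ∃[ a ] U x a × a ^ ↧ₙ q ℚ.≤ 2^ (↥ q)

-- "x if P, and y otherwise", for a proposition P.
infix 0 when_then_otherwise_

when_then_otherwise_ : Set → Cut → Cut → Cut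
(when P then x otherwise y) .L q = (P × L x q) ⊎ (¬ P × L y q)
(when P then x otherwise y) .U q = (P × U x q) ⊎ (¬ P × U y q)

-- ζ is rational because s = ζ k for integers s and k ≥ 1.
C : ℚ → Cut
C ζ = when fromℚ ζ <ᴿ ⟦ 3 ⟧ -ᴿ ⟦ 2 ⟧ *ᴿ √ ⟦ 2 ⟧
      then      ⟦ 1 ⟧ ÷ᴿ (⟦ 1 ⟧ -ᴿ √ (⟦ 2 ⟧ *ᴿ fromℚ ζ))
      otherwise ⟦ 2 ⟧ ÷ᴿ (⟦ 1 ⟧ -ᴿ fromℚ ζ)

-- f(k) = o(k); an error term with values in ℕ loses nothing, since it is
-- only ever used as an upper bound on the true error.
LittleO : (ℕ → ℕ) → Set
LittleO f = ∀ m → ∃[ k₀ ] (∀ k → k₀ ≤ k → m ℕ.* f k ≤ k)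

------------------------------------------------------------------------
-- CNF formulas

-- (v , true) is the literal v and (v , false) its negation.
Literal : ℕ → Set
Literal n = Fin n × Bool

Clause : ℕ → Set
Clause n = List (Literal n)

CNF : ℕ → Set
CNF n = List (Clause n)

Assignment : ℕ → Set
Assignment n = Vec Bool n

vars : ∀ {n} → Clause n → List (Fin n)
vars = map proj₁

infix 4 _⊨ᶜ_ _⊨_ _⊨ᶜ?_ _⊨?_

_⊨ᶜ_ : ∀ {n} → Assignment n → Clause n → Set
σ ⊨ᶜ c = Any (λ (v , b) → Vec.lookup σ v ≡ b) c

_⊨_ : ∀ {n} → Assignment n → CNF n → Set
σ ⊨ Φ = All (σ ⊨ᶜ_) Φ

_⊨ᶜ?_ : ∀ {n} (σ : Assignment n) → Decidable (σ ⊨ᶜ_)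
σ ⊨ᶜ? c = any? (λ (v , b) → Vec.lookup σ v Bool.≟ b) c

_⊨?_ : ∀ {n} (σ : Assignment n) → Decidable (σ ⊨_)
σ ⊨? Φ = all? (σ ⊨ᶜ?_) Φ

_∈vars?_ : ∀ {n} (v : Fin n) (c : Clause n) → Dec (v ∈ vars c)
v ∈vars? c = any? (v Fin.≟_) (vars c)

degree : ∀ {n} → CNF n → Fin n → ℕ
degree Φ v = length (filter (v ∈vars?_) Φ)

shared : ∀ {n} → Clause n → Clause n → ℕ
shared c c′ = length (filter (_∈vars? c′) (vars c))

-- A formula is a set of clauses and a clause is a set of literals.
-- Listing the literals of a clause by strictly increasing variable makes
-- its variables distinct and identifies equality of clauses with _≡_.
record IsKDS (k d s : ℕ) {n : ℕ} (Φ : CNF n) : Set where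
  field
    unique  : Unique Φ
    ordered : All (λ c → Linked Fin._<_ (vars c)) Φ
    width   : All (λ c → length c ≡ k) Φ
    degree≤ : ∀ v → degree Φ v ≤ d
    shared≤ : ∀ {c c′} → c ∈ Φ → c′ ∈ Φ → c ≢ c′ → shared c c′ ≤ s

------------------------------------------------------------------------
-- Random solutions

tuples : ∀ {A : Set} → List A → (m : ℕ) → List (Vec A m)
tuples xs zero    = [] ∷ []
tuples xs (suc m) = cartesianProductWith _∷_ xs (tuples xs m)

assignments : (n : ℕ) → List (Assignment n)
assignments = tuples (true ∷ false ∷ [])

solutions : ∀ {n} → CNF n → List (Assignment n)
solutions {n} Φ = filter (_⊨? Φ) (assignments n)

-- The value 1/0 is read as 0: for an unsatisfiable formula μ is the zero
-- function, and no event on T ≥ 1 samples has positive probability.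
reciprocal : ℕ → ℚ
reciprocal zero    = 0ℚ
reciprocal (suc m) = + 1 / suc m

μ : ∀ {n} → CNF n → Assignment n → ℚ
μ Φ σ = if does (σ ⊨? Φ) then reciprocal (length (solutions Φ)) else 0ℚ

Samples : ℕ → ℕ → Set
Samples n T = Vec (Assignment n) T

sumℚ : List ℚ → ℚ
sumℚ = foldr ℚ._+_ 0ℚ

-- Probability of an event under T independent samples from μ Φ.
Pr : ∀ {n} → CNF n → (T : ℕ) {E : Samples n T → Set} → Decidable E → ℚ
Pr {n} Φ T E? =
  sumℚ (map (Vec.foldr′ (λ σ p → μ Φ σ ℚ.* p) 1ℚ)
            (filter E? (tuples (assignments n) T)))

∈-assignments : ∀ {n} (σ : Assignment n) → σ ∈ assignments n
∈-assignments []      = here refl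
∈-assignments (b ∷ σ) = ∈-cartesianProductWith⁺ _∷_ (∈-bools b) (∈-assignments σ)
  where
  ∈-bools : ∀ b → b ∈ true ∷ false ∷ []
  ∈-bools true  = here refl
  ∈-bools false = there (here refl)

_≗μ?_ : ∀ {n} (Φ Ψ : CNF n) → Dec (μ Φ ≗ μ Ψ)
_≗μ?_ {n} Φ Ψ =
  map′ (λ h σ → lookup h (∈-assignments σ)) (λ h → tabulate (λ {σ} _ → h σ))
       (all? (λ σ → μ Φ σ ℚ.≟ μ Ψ σ) (assignments n))

------------------------------------------------------------------------
-- Valiant's algorithm, with its running time

-- Unit-cost random access machine: every call of every procedure below is
-- charged one step (✓), and its body performs a bounded number of
-- operations besides further calls.  Clauses are linked lists, and an
-- assignment is an array, so Vec.lookup is a single operation.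
record Timed (A : Set) : Set where
  constructor timed
  field
    steps  : ℕ
    result : A

open Timed public

return : ∀ {A} → A → Timed A
return x = timed 0 x

_>>=_ : ∀ {A B} → Timed A → (A → Timed B) → Timed B
timed m x >>= f = timed (m ℕ.+ steps (f x)) (result (f x))

✓ : ∀ {A} → Timed A → Timed A
✓ (timed m x) = timed (suc m) x

-- The variables below j, in decreasing order.
variables : ∀ {n} (j : ℕ) → .(j ≤ n) → Timed (List (Fin n))
variables zero    _   = ✓ (return [])
variables (suc j) j<n = ✓ do
  vs ← variables j (ℕ.<⇒≤ j<n)
  return (Fin.fromℕ< j<n ∷ vs)

-- candidates j vs c acc puts in front of acc all clauses obtained from c
-- by prepending literals on j distinct variables from vs.
candidates : ∀ {n} → ℕ → List (Fin n) → Clause n → CNF n → Timed (CNF n)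
candidates zero    vs       c acc = ✓ (return (c ∷ acc))
candidates (suc j) []       c acc = ✓ (return acc)
candidates (suc j) (v ∷ vs) c acc = ✓ do
  acc₁ ← candidates (suc j) vs c acc
  acc₂ ← candidates j vs ((v , false) ∷ c) acc₁
  candidates j vs ((v , true) ∷ c) acc₂

satisfied : ∀ {n} → Assignment n → Clause n → Timed Bool
satisfied σ []            = ✓ (return false)
satisfied σ ((v , b) ∷ c) = ✓
  (if does (Vec.lookup σ v Bool.≟ b) then return true else satisfied σ c)

survives : ∀ {n T} → Samples n T → Clause n → Timed Bool
survives []      c = ✓ (return true)
survives (σ ∷ X) c = ✓ do
  true ← satisfied σ c
    where false → return false
  survives X c

prune : ∀ {n T} → Samples n T → CNF n → Timed (CNF n)
prune X []      = ✓ (return [])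
prune X (c ∷ Φ) = ✓ do
  Φ′ ← prune X Φ
  b  ← survives X c
  return (if b then c ∷ Φ′ else Φ′)

valiant : (n k : ℕ) {T : ℕ} → Samples n T → Timed (CNF n)
valiant n k X = ✓ do
  vs ← variables n ℕ.≤-refl
  Φ₀ ← candidates k vs [] []
  prune X Φ₀

{-# OPTIONS --safe #-}

-- It suffices that every clause c with k variables that is violated by some
-- solution τ of Φ is violated by a random solution with probability at least
-- 1/M, where M depends on k and ζ only: then a union bound over the at most
-- (4n)^k clauses shows that O(M log (n/δ)) samples refute all such c.
--
-- To bound this probability, start with the variables S of c and repeatedly add
-- the variables of a clause of Φ that is not yet satisfied by τ on the current
-- set W but has more than θ k variables in it.  As two clauses share at most ζ k
-- variables, the (j + 1)-st clause added has at least (θ - j ζ) k variables in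
-- the part of S not covered by the preceding ones.  Hence fewer than m clauses
-- are added as soon as m θ ≥ 1 + m(m - 1)ζ/2, which holds for m = 2 and
-- θ = (1 + ζ)/2, and for m ≈ √(2/ζ) and some θ < √(2ζ).  Pinning W to τ
-- leaves at least (1 - θ) k free variables in every unsatisfied clause, and
-- (1 - θ) k ≥ log d + log k + O(1), so the local lemma shows that the pinned
-- formula has a constant fraction of the solutions of Φ, because only the
-- boundedly many clauses that meet W change.
--
-- √k serves as the o(k) term since it exceeds every multiple of log k up to a
-- constant, whatever ζ is.
module Submission where

open import Defs
import Algebra.Definitions.RawSemiring
open import Data.Bool using (Bool; true; false; not; if_then_else_)
import Data.Bool.Properties as Bool
open import Data.Fin using (Fin; toℕ)
import Data.Fin as Fin
import Data.Fin.Properties as Fin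
import Data.Integer as ℤ
import Data.Integer.Properties as ℤ
open import Data.List using (List; []; _∷_; _++_; map; filter; length; reverse; _ʳ++_; cartesianProductWith)
import Data.List.Properties as List
import Data.List.Membership.DecPropositional
open import Data.List.Membership.Propositional using (_∈_; _∉_; lose; find)
open import Data.List.Membership.Propositional.Properties
  using (∈-filter⁻; ∈-filter⁺; ∈-length; ∈-++⁻; ∈-++⁺ˡ; ∈-++⁺ʳ; ∈-map⁺)
open import Data.List.Relation.Unary.All using (All; []; _∷_; all?)
import Data.List.Relation.Unary.All as All
import Data.List.Relation.Unary.All.Properties as All
open import Data.List.Relation.Unary.AllPairs using (AllPairs; []; _∷_)
import Data.List.Relation.Unary.AllPairs as AllPairs
import Data.List.Relation.Unary.AllPairs.Properties as AllPairs
open import Data.List.Relation.Unary.Any using (Any; here; there; any?)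
import Data.List.Relation.Unary.Any as Any
import Data.List.Relation.Unary.Any.Properties as Any
open import Data.List.Relation.Unary.Linked using (Linked)
open import Data.List.Relation.Unary.Linked.Properties using (Linked⇒AllPairs)
open import Data.List.Relation.Unary.Unique.Propositional using (Unique)
open import Data.Nat
  using (ℕ; zero; suc; _+_; _*_; _^_; _∸_; _≤_; _<_; z≤n; s≤s; NonZero; >-nonZero; _≤?_; _<?_)
open import Data.Nat.Coprimality using (1-coprimeTo) renaming (sym to coprime-sym)
import Data.Nat.DivMod as ℕ
open import Data.Nat.Properties
open import Data.Nat.Tactic.RingSolver using (solve-∀)
open import Data.Product using (_×_; _,_; proj₁; proj₂; ∃-syntax)
open import Data.Rational using (ℚ; 0ℚ; 1ℚ; ½; mkℚ; _/_; ↧ₙ_) renaming (_<_ to _<ℚ_; _*_ to _*ℚ_)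
import Data.Rational as ℚ
import Data.Rational.Properties as ℚ
open import Data.Rational.Solver using (module +-*-Solver)
open import Data.Sum using (_⊎_; inj₁; inj₂; [_,_]′)
import Data.Sum as Sum
open import Data.Vec using (Vec; []; _∷_; lookup; _[_]≔_)
import Data.Vec as Vec
open import Data.Vec.Properties using (lookup∘update; lookup∘update′)
import Data.Vec.Relation.Unary.All as VecAll
open import Function using (_∘_)
open import Relation.Binary.PropositionalEquality
open import Relation.Nullary using (¬_; Dec; yes; no; ¬?; contradiction; _×-dec_; does)
open import Relation.Nullary.Decidable using (decidable-stable)
open import Relation.Unary using (Decidable)

open +-*-Solver using (solve; con; _:=_; _:+_; _:*_; _:-_)
open Algebra.Definitions.RawSemiring ℚ.+-*-rawSemiring using () renaming (_^_ to _^ℚ_)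

-- Counting assignments

-- The probabilistic part counts assignments in ℕ: a bound β / α on a probability is kept as
-- `α * count ≤ β`. The real numbers pose three obstacles. The case distinction in `C` is never
-- decided. With θ below both bounds, 1/(1 - θ) is a lower bound for `C ζ` in either case, and the
-- only fact drawn from the hypothesis on k is `4 * (suc k * d) ≤ 2 ^ r`, which is decidable; so the
-- two cases may be used under a double negation. The same inequality yields d ≤ 2 ^ k, which
-- removes d from the constants. A cut δ can be located among the powers of 1/2 only up to a factor
-- 4, which the constant in front of log (n/δ) absorbs. For n = 1 that logarithm can be arbitrarily
-- small, leaving no room for even one sample; but then there is no clause on k ≥ 2 distinct
-- variables.

module _ {A : Set} where

  count : {P : A → Set} → Decidable P → List A → ℕ
  count P? xs = length (filter P? xs)

  count-mono : ∀ {P Q : A → Set} (P? : Decidable P) (Q? : Decidable Q) xs →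
               (∀ {x} → P x → Q x) → count P? xs ≤ count Q? xs
  count-mono P? Q? [] h = z≤n
  count-mono P? Q? (x ∷ xs) h with P? x | Q? x
  ... | yes p | yes q = s≤s (count-mono P? Q? xs h)
  ... | yes p | no ¬q = contradiction (h p) ¬q
  ... | no ¬p | yes q = m≤n⇒m≤1+n (count-mono P? Q? xs h)
  ... | no ¬p | no ¬q = count-mono P? Q? xs h

  count-⊎ : ∀ {P Q R : A → Set} (P? : Decidable P) (Q? : Decidable Q) (R? : Decidable R) xs →
            (∀ {x} → P x → Q x ⊎ R x) → count P? xs ≤ count Q? xs + count R? xs
  count-⊎ P? Q? R? [] h = z≤n
  count-⊎ P? Q? R? (x ∷ xs) h with count-⊎ P? Q? R? xs h | P? x | Q? x | R? x
  ... | ih | no _  | no _  | no _  = ih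
  ... | ih | no _  | no _  | yes _ = ≤-trans ih (+-monoʳ-≤ _ (n≤1+n _))
  ... | ih | no _  | yes _ | no _  = m≤n⇒m≤1+n ih
  ... | ih | no _  | yes _ | yes _ = m≤n⇒m≤1+n (≤-trans ih (+-monoʳ-≤ _ (n≤1+n _)))
  ... | ih | yes p | yes _ | no _  = s≤s ih
  ... | ih | yes p | yes _ | yes _ = s≤s (≤-trans ih (+-monoʳ-≤ _ (n≤1+n _)))
  ... | ih | yes p | no _  | yes _ = ≤-trans (s≤s ih) (≤-reflexive (sym (+-suc _ _)))
  ... | ih | yes p | no ¬q | no ¬r with h p
  ... | inj₁ q = contradiction q ¬q
  ... | inj₂ r = contradiction r ¬r

  count-disjoint : ∀ {P Q R : A → Set} (P? : Decidable P) (Q? : Decidable Q) (R? : Decidable R) xs →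
                   (∀ {x} → P x → R x) → (∀ {x} → Q x → R x) → (∀ {x} → P x → ¬ Q x) →
                   count P? xs + count Q? xs ≤ count R? xs
  count-disjoint P? Q? R? [] p⇒r q⇒r p⇒¬q = z≤n
  count-disjoint P? Q? R? (x ∷ xs) p⇒r q⇒r p⇒¬q
    with count-disjoint P? Q? R? xs p⇒r q⇒r p⇒¬q | P? x | Q? x | R? x
  ... | ih | no _  | no _  | no _  = ih
  ... | ih | no _  | no _  | yes _ = m≤n⇒m≤1+n ih
  ... | ih | no _  | yes q | no ¬r = contradiction (q⇒r q) ¬r
  ... | ih | no _  | yes _ | yes _ = ≤-trans (≤-reflexive (+-suc _ _)) (s≤s ih)
  ... | ih | yes p | no _  | no ¬r = contradiction (p⇒r p) ¬r
  ... | ih | yes _ | no _  | yes _ = s≤s ih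
  ... | ih | yes p | yes q | _     = contradiction q (p⇒¬q p)

  count-++ : ∀ {P : A → Set} (P? : Decidable P) xs ys → count P? (xs ++ ys) ≡ count P? xs + count P? ys
  count-++ P? xs ys = trans (cong length (List.filter-++ P? xs ys)) (List.length-++ (filter P? xs))

  count-∅ : ∀ {P : A → Set} (P? : Decidable P) xs → (∀ {x} → ¬ P x) → count P? xs ≡ 0
  count-∅ P? []       ¬p = refl
  count-∅ P? (x ∷ xs) ¬p with P? x
  ... | yes p = contradiction p ¬p
  ... | no _  = count-∅ P? xs ¬p

count-map : ∀ {A B : Set} {P : B → Set} (P? : Decidable P) (f : A → B) xs →
            count P? (map f xs) ≡ count (P? ∘ f) xs
count-map P? f []       = refl
count-map P? f (x ∷ xs) with P? (f x)
... | yes _ = cong suc (count-map P? f xs)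
... | no _  = count-map P? f xs

N : ∀ {n} {P : Assignment n → Set} → Decidable P → ℕ
N {n} P? = count P? (assignments n)

N-suc : ∀ {n} {P : Assignment (suc n) → Set} (P? : Decidable P) →
        N P? ≡ N (P? ∘ (true ∷_)) + N (P? ∘ (false ∷_))
N-suc {n} P? = begin
  N P?
    ≡⟨ count-++ P? (map (true ∷_) as) _ ⟩
  count P? (map (true ∷_) as) + count P? (map (false ∷_) as ++ [])
    ≡⟨ cong₂ _+_ (count-map P? _ as) (trans (cong (count P?) (List.++-identityʳ (map (false ∷_) as))) (count-map P? _ as)) ⟩
  N (P? ∘ (true ∷_)) + N (P? ∘ (false ∷_)) ∎
  where
  open ≡-Reasoning
  as = assignments n

-- Flipping v is an injection from P into Q.
N-flip : ∀ {n} {P Q : Assignment n → Set} (P? : Decidable P) (Q? : Decidable Q) v b →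
         (∀ {σ} → P σ → lookup σ v ≡ b) → (∀ {σ} → P σ → Q (σ [ v ]≔ not b)) →
         N P? ≤ N Q?
N-flip {suc n} P? Q? Fin.zero true p⇒v p⇒q rewrite N-suc P? | N-suc Q? = begin
  N (P? ∘ (true ∷_)) + N (P? ∘ (false ∷_))
    ≡⟨ cong (N (P? ∘ (true ∷_)) +_) (count-∅ (P? ∘ (false ∷_)) (assignments n) λ p → contradiction (p⇒v p) λ ()) ⟩
  N (P? ∘ (true ∷_)) + 0                   ≡⟨ +-identityʳ _ ⟩
  N (P? ∘ (true ∷_))                       ≤⟨ count-mono _ (Q? ∘ (false ∷_)) (assignments n) p⇒q ⟩
  N (Q? ∘ (false ∷_))                      ≤⟨ m≤n+m _ _ ⟩
  N (Q? ∘ (true ∷_)) + N (Q? ∘ (false ∷_)) ∎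
  where open ≤-Reasoning
N-flip {suc n} P? Q? Fin.zero false p⇒v p⇒q rewrite N-suc P? | N-suc Q? = begin
  N (P? ∘ (true ∷_)) + N (P? ∘ (false ∷_))
    ≡⟨ cong (_+ N (P? ∘ (false ∷_))) (count-∅ (P? ∘ (true ∷_)) (assignments n) λ p → contradiction (p⇒v p) λ ()) ⟩
  N (P? ∘ (false ∷_))                      ≤⟨ count-mono _ (Q? ∘ (true ∷_)) (assignments n) p⇒q ⟩
  N (Q? ∘ (true ∷_))                       ≤⟨ m≤m+n _ _ ⟩
  N (Q? ∘ (true ∷_)) + N (Q? ∘ (false ∷_)) ∎
  where open ≤-Reasoning
N-flip {suc n} P? Q? (Fin.suc v) b p⇒v p⇒q rewrite N-suc P? | N-suc Q? =
  +-mono-≤ (N-flip (P? ∘ (true ∷_))  (Q? ∘ (true ∷_))  v b p⇒v p⇒q)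
           (N-flip (P? ∘ (false ∷_)) (Q? ∘ (false ∷_)) v b p⇒v p⇒q)

_Ignores_ : ∀ {n} → (Assignment n → Set) → Fin n → Set
P Ignores v = ∀ σ b → P σ → P (σ [ v ]≔ b)

flip-bool : ∀ {a b} → a ≢ b → a ≡ not b
flip-bool {true}  {true}  a≢b = contradiction refl a≢b
flip-bool {true}  {false} a≢b = refl
flip-bool {false} {true}  a≢b = refl
flip-bool {false} {false} a≢b = contradiction refl a≢b

⊨ᶜ-ignores : ∀ {n} {c : Clause n} {v} → v ∉ vars c → ∀ σ b → σ ⊨ᶜ c → (σ [ v ]≔ b) ⊨ᶜ c
⊨ᶜ-ignores v∉c σ b (here {x = w , _} eq) =
  here (trans (lookup∘update′ (λ w≡v → v∉c (here (sym w≡v))) σ b) eq)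
⊨ᶜ-ignores v∉c σ b (there sat) = there (⊨ᶜ-ignores (v∉c ∘ there) σ b sat)

⊭ᶜ-ignores : ∀ {n} {c : Clause n} {v} → v ∉ vars c → ∀ σ b → ¬ σ ⊨ᶜ c → ¬ (σ [ v ]≔ b) ⊨ᶜ c
⊭ᶜ-ignores {c = (w , _) ∷ c} v∉c σ b ¬sat (here eq) =
  ¬sat (here (trans (sym (lookup∘update′ (λ w≡v → v∉c (here (sym w≡v))) σ b)) eq))
⊭ᶜ-ignores v∉c σ b ¬sat (there sat) = ⊭ᶜ-ignores (v∉c ∘ there) σ b (¬sat ∘ there) sat

⊨-ignores : ∀ {n} {Φ : CNF n} {v} → All (λ c → v ∉ vars c) Φ → (_⊨ Φ) Ignores v
⊨-ignores []           σ b []           = []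
⊨-ignores (v∉c ∷ v∉Φ) σ b (sat ∷ sats) = ⊨ᶜ-ignores v∉c σ b sat ∷ ⊨-ignores v∉Φ σ b sats

module _ {n} {P : Assignment n → Set} (P? : Decidable P) where

  violated? : (c : Clause n) → Decidable (λ σ → P σ × ¬ σ ⊨ᶜ c)
  violated? c σ = P? σ ×-dec ¬? (σ ⊨ᶜ? c)

  -- Every literal halves the count: flipping its variable turns an assignment that violates the
  -- whole clause into one that satisfies this literal and still violates the others. Distinct
  -- variables keep the flip from disturbing those others.
  N-violated : ∀ c → Unique (vars c) → (∀ {v} → v ∈ vars c → P Ignores v) →
               2 ^ length c * N (violated? c) ≤ N P?
  N-violated [] _ ign = begin
    N (violated? []) + 0 ≡⟨ +-identityʳ _ ⟩
    N (violated? [])     ≤⟨ count-mono _ P? (assignments n) proj₁ ⟩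
    N P?                 ∎
    where open ≤-Reasoning
  N-violated ((v , b) ∷ c) (v∉c ∷ uniq) ign = begin
    2 * 2 ^ length c * N bad?        ≡⟨ cong (_* N bad?) (*-comm 2 (2 ^ length c)) ⟩
    2 ^ length c * 2 * N bad?        ≡⟨ *-assoc (2 ^ length c) 2 _ ⟩
    2 ^ length c * (N bad? + (N bad? + 0)) ≤⟨ *-monoʳ-≤ (2 ^ length c) step ⟩
    2 ^ length c * N (violated? c)   ≤⟨ N-violated c uniq (ign ∘ there) ⟩
    N P?                             ∎
    where
    open ≤-Reasoning
    bad?  = violated? ((v , b) ∷ c)
    good? : Decidable (λ σ → (P σ × ¬ σ ⊨ᶜ c) × lookup σ v ≡ b)
    good? σ = violated? c σ ×-dec (lookup σ v Bool.≟ b)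
    v∉ : v ∉ vars c
    v∉ v∈c = All.lookup v∉c v∈c refl
    step : N bad? + (N bad? + 0) ≤ N (violated? c)
    step rewrite +-identityʳ (N bad?) = begin
      N bad? + N bad?   ≤⟨ +-monoʳ-≤ (N bad?) (N-flip bad? good? v (not b)
                             (λ (p , ¬sat) → flip-bool (¬sat ∘ here))
                             λ {σ} (p , ¬sat) →
                               (ign (here refl) σ (not (not b)) p , ⊭ᶜ-ignores v∉ σ _ (¬sat ∘ there)) ,
                               trans (lookup∘update v σ _) (Bool.not-involutive b)) ⟩
      N bad? + N good?  ≤⟨ count-disjoint bad? good? (violated? c) (assignments n)
                             (λ (p , ¬sat) → p , ¬sat ∘ there) proj₁
                             (λ (p , ¬sat) (_ , eq) → ¬sat (here eq)) ⟩
      N (violated? c)   ∎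

Agrees : ∀ {n} → Assignment n → List (Fin n) → Assignment n → Set
Agrees τ vs σ = All (λ v → lookup σ v ≡ lookup τ v) vs

module _ {n} {P : Assignment n → Set} (P? : Decidable P) (τ : Assignment n) where

  agrees? : ∀ vs → Decidable (λ σ → P σ × Agrees τ vs σ)
  agrees? vs σ = P? σ ×-dec all? (λ v → lookup σ v Bool.≟ lookup τ v) vs

  agrees-update : ∀ v vs σ → Agrees τ vs σ → Agrees τ vs (σ [ v ]≔ lookup τ v)
  agrees-update v []       σ []         = []
  agrees-update v (w ∷ vs) σ (eq ∷ eqs) with w Fin.≟ v
  ... | yes refl = lookup∘update v σ _ ∷ agrees-update v vs σ eqs
  ... | no w≢v   = trans (lookup∘update′ w≢v σ _) eq ∷ agrees-update v vs σ eqs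

  -- Pinning one variable keeps at least half of the assignments, because flipping a wrong value
  -- repairs it. `vs` may repeat variables, as the concatenations made by `cover` do; a repetition
  -- merely wastes a factor 2.
  N-agrees : ∀ vs → (∀ {v} → v ∈ vs → P Ignores v) →
             N P? ≤ 2 ^ length vs * N (agrees? vs)
  N-agrees [] ign = begin
    N P?             ≤⟨ count-mono P? (agrees? []) (assignments n) (_, []) ⟩
    N (agrees? [])   ≡⟨ +-identityʳ _ ⟨
    N (agrees? []) + 0 ∎
    where open ≤-Reasoning
  N-agrees (v ∷ vs) ign = begin
    N P?                               ≤⟨ N-agrees vs (ign ∘ there) ⟩
    2 ^ length vs * N (agrees? vs)     ≤⟨ *-monoʳ-≤ (2 ^ length vs) step ⟩
    2 ^ length vs * (2 * N (agrees? (v ∷ vs))) ≡⟨ *-assoc (2 ^ length vs) 2 _ ⟨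
    2 ^ length vs * 2 * N (agrees? (v ∷ vs))   ≡⟨ cong (_* N (agrees? (v ∷ vs))) (*-comm (2 ^ length vs) 2) ⟩
    2 * 2 ^ length vs * N (agrees? (v ∷ vs))   ∎
    where
    open ≤-Reasoning
    b = lookup τ v
    good? = agrees? (v ∷ vs)
    bad? : Decidable (λ σ → (P σ × Agrees τ vs σ) × lookup σ v ≡ not b)
    bad? σ = agrees? vs σ ×-dec (lookup σ v Bool.≟ not b)
    split : ∀ {σ} → P σ × Agrees τ vs σ → (P σ × Agrees τ (v ∷ vs) σ) ⊎ ((P σ × Agrees τ vs σ) × lookup σ v ≡ not b)
    split {σ} (p , eqs) with lookup σ v Bool.≟ b
    ... | yes eq = inj₁ (p , eq ∷ eqs)
    ... | no neq = inj₂ ((p , eqs) , flip-bool neq)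
    step : N (agrees? vs) ≤ N good? + (N good? + 0)
    step rewrite +-identityʳ (N good?) = begin
      N (agrees? vs)   ≤⟨ count-⊎ (agrees? vs) good? bad? (assignments n) split ⟩
      N good? + N bad? ≤⟨ +-monoʳ-≤ (N good?) (N-flip bad? good? v (not b) proj₂ λ {σ} ((p , eqs) , _) →
                            subst (λ b′ → P (σ [ v ]≔ b′) × Agrees τ (v ∷ vs) (σ [ v ]≔ b′))
                              (sym (Bool.not-involutive b))
                              (ign (here refl) σ b p , lookup∘update v σ b ∷ agrees-update v vs σ eqs)) ⟩
      N good? + N good? ∎

-- The local lemma

Touches : ∀ {n} → List (Fin n) → Clause n → Set
Touches vs c = Any (_∈ vars c) vs

touches? : ∀ {n} (vs : List (Fin n)) → Decidable (Touches vs)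
touches? vs c = any? (_∈vars? c) vs

count-touches : ∀ {n d} (Φ : CNF n) → (∀ v → degree Φ v ≤ d) → ∀ vs →
                count (touches? vs) Φ ≤ length vs * d
count-touches Φ deg []       = ≤-reflexive (count-∅ (touches? []) Φ λ ())
count-touches Φ deg (v ∷ vs) = ≤-trans
  (count-⊎ (touches? (v ∷ vs)) (v ∈vars?_) (touches? vs) Φ λ { (here v∈) → inj₁ v∈ ; (there t) → inj₂ t })
  (+-mono-≤ (deg v) (count-touches Φ deg vs))

untouched-ignores : ∀ {n} vs (Φ : CNF n) {v} → v ∈ vs → (_⊨ filter (¬? ∘ touches? vs) Φ) Ignores v
untouched-ignores vs Φ v∈vs =
  ⊨-ignores (All.map (λ ¬touch v∈c → ¬touch (lose v∈vs v∈c)) (All.all-filter (¬? ∘ touches? vs) Φ))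

length-filter-split : ∀ {A : Set} {P : A → Set} (P? : Decidable P) xs →
                      length (filter P? xs) + length (filter (¬? ∘ P?) xs) ≡ length xs
length-filter-split P? [] = refl
length-filter-split P? (x ∷ xs) with P? x
... | yes _ = cong suc (length-filter-split P? xs)
... | no _  = trans (+-suc _ _) (cong suc (length-filter-split P? xs))

⊨-split : ∀ {n} {P : Clause n → Set} (P? : Decidable P) {Φ : CNF n} σ →
          σ ⊨ filter P? Φ → σ ⊨ filter (¬? ∘ P?) Φ → σ ⊨ Φ
⊨-split P? σ = All.filter⁻ P?

-- The union bound cleared of denominators. It serves twice: over the neighbours of a clause in the
-- local lemma, and over the refuted candidate clauses.
count-union : ∀ {A B : Set} {P : A → Set} {R : A → B → Set} (P? : Decidable P) (R? : ∀ x → Decidable (R x)) xs α {β} ys →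
              (∀ {y} → y ∈ ys → α * count (λ x → P? x ×-dec ¬? (R? x y)) xs ≤ β) →
              α * count P? xs ≤ α * count (λ x → P? x ×-dec all? (R? x) ys) xs + length ys * β
count-union P? R? xs α [] h = begin
  α * count P? xs                                     ≤⟨ *-monoʳ-≤ α (count-mono P? (λ x → P? x ×-dec all? (R? x) []) xs (_, [])) ⟩
  α * count (λ x → P? x ×-dec all? (R? x) []) xs      ≤⟨ m≤m+n _ _ ⟩
  α * count (λ x → P? x ×-dec all? (R? x) []) xs + 0  ∎
  where open ≤-Reasoning
count-union {P = P} {R} P? R? xs α {β} (y ∷ ys) h = begin
  α * count P? xs                               ≤⟨ count-union P? R? xs α ys (h ∘ there) ⟩
  α * count tail? xs + length ys * β            ≤⟨ +-monoˡ-≤ _ (*-monoʳ-≤ α (count-⊎ tail? all∷? bad? xs split)) ⟩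
  α * (count all∷? xs + count bad? xs) + length ys * β      ≡⟨ cong (_+ length ys * β) (*-distribˡ-+ α _ _) ⟩
  α * count all∷? xs + α * count bad? xs + length ys * β    ≤⟨ +-monoˡ-≤ _ (+-monoʳ-≤ (α * count all∷? xs) (h (here refl))) ⟩
  α * count all∷? xs + β + length ys * β        ≡⟨ +-assoc (α * count all∷? xs) β _ ⟩
  α * count all∷? xs + (β + length ys * β)      ∎
  where
  open ≤-Reasoning
  tail? : Decidable (λ x → P x × All (R x) ys)
  tail? x = P? x ×-dec all? (R? x) ys
  all∷? : Decidable (λ x → P x × All (R x) (y ∷ ys))
  all∷? x = P? x ×-dec all? (R? x) (y ∷ ys)
  bad? : Decidable (λ x → P x × ¬ R x y)
  bad? x = P? x ×-dec ¬? (R? x y)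
  split : ∀ {x} → P x × All (R x) ys → (P x × All (R x) (y ∷ ys)) ⊎ (P x × ¬ R x y)
  split {x} (p , rs) with R? x y
  ... | yes r = inj₁ (p , r ∷ rs)
  ... | no ¬r = inj₂ (p , ¬r)

-- Pinning deletes literals, so widths vary: the lower bound r controls the probability of
-- violation, the upper bound k the number of neighbours.
record GoodClause (r k : ℕ) {n} (c : Clause n) : Set where
  constructor good
  field
    distinct : Unique (vars c)
    r≤width  : r ≤ length c
    width≤k  : length c ≤ k

open GoodClause public

record GoodCNF (r k d : ℕ) {n} (Ψ : CNF n) : Set where
  constructor good
  field
    clauses : All (GoodClause r k) Ψ
    degree≤ : ∀ v → degree Ψ v ≤ d

open GoodCNF public

degree-filter : ∀ {n} {P : Clause n → Set} (P? : Decidable P) Φ v → degree (filter P? Φ) v ≤ degree Φ v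
degree-filter P? [] v = z≤n
degree-filter P? (c ∷ Φ) v with P? c
... | no _ with v ∈vars? c
...   | yes _ = m≤n⇒m≤1+n (degree-filter P? Φ v)
...   | no _  = degree-filter P? Φ v
degree-filter P? (c ∷ Φ) v | yes _ with v ∈vars? c
...   | yes _ = s≤s (degree-filter P? Φ v)
...   | no _  = degree-filter P? Φ v

degree-tail : ∀ {n} (c : Clause n) Φ v → degree Φ v ≤ degree (c ∷ Φ) v
degree-tail c Φ v with v ∈vars? c
... | yes _ = n≤1+n _
... | no _  = ≤-refl

module LocalLemma {r k d : ℕ} (1≤d : 1 ≤ d) (4kd≤2^r : 4 * (suc k * d) ≤ 2 ^ r) where

  -- Here `suc k` instead of k matters: it gives the bound for k = 0 as well.
  4≤2^r : 4 ≤ 2 ^ r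
  4≤2^r = ≤-trans (*-monoʳ-≤ 4 {1} (*-mono-≤ (s≤s (z≤n {k})) 1≤d)) 4kd≤2^r

  instance
    2^r≢0 : NonZero (2 ^ r)
    2^r≢0 = m^n≢0 2 r

  -- Union bound over the clauses that share a variable with A; the other ones
  -- are independent of A.
  local-lemma : ∀ {n} ℓ (Ψ : CNF n) A → length Ψ ≤ ℓ → GoodCNF r k d Ψ → GoodClause r k A →
                2 ^ r * N (violated? (_⊨? Ψ) A) ≤ 2 * N (_⊨? Ψ)
  local-lemma {n} ℓ Ψ A |Ψ|≤ℓ gΨ gA = begin
    2 ^ r * N (violated? (_⊨? Ψ) A)         ≤⟨ *-mono-≤ (^-monoʳ-≤ 2 (r≤width gA))
      (count-mono (violated? (_⊨? Ψ) A) (violated? (_⊨? Ψ₂) A) (assignments n) λ (sat , ¬a) → All.filter⁺ _ sat , ¬a) ⟩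
    2 ^ length A * N (violated? (_⊨? Ψ₂) A) ≤⟨ N-violated (_⊨? Ψ₂) A (distinct gA) (untouched-ignores (vars A) Ψ) ⟩
    N₂                                      ≤⟨ *-cancelˡ-≤ (2 ^ r) (+-cancelʳ-≤ (2 ^ r * N₂) _ _ N₂-bound) ⟩
    2 * N (_⊨? Ψ)                           ∎
    where
    open ≤-Reasoning
    near? = touches? (vars A)
    Ψ₁ = filter near? Ψ
    Ψ₂ = filter (¬? ∘ near?) Ψ
    N₂ = N (_⊨? Ψ₂)

    -- `Ψ₁` contains `B`, so `Ψ₂` is strictly shorter than `Ψ`; the bound ℓ on the length makes the
    -- recursion structural. The lemma speaks of a clause beside the formula so that it applies to
    -- `B` and `Ψ₂`.
    ih : ∀ ℓ → length Ψ ≤ ℓ → ∀ {B} → B ∈ Ψ₁ → 2 ^ r * N (violated? (_⊨? Ψ₂) B) ≤ 2 * N₂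
    ih ℓ |Ψ|≤ℓ B∈Ψ₁ with ≤-trans (+-monoˡ-≤ (length Ψ₂) (∈-length B∈Ψ₁)) (≤-trans (≤-reflexive (length-filter-split near? Ψ)) |Ψ|≤ℓ)
    ih (suc ℓ) |Ψ|≤ℓ {B} B∈Ψ₁ | s≤s |Ψ₂|≤ℓ =
      local-lemma ℓ Ψ₂ B |Ψ₂|≤ℓ
        (good (All.filter⁺ _ (clauses gΨ)) λ v → ≤-trans (degree-filter (¬? ∘ near?) Ψ v) (degree≤ gΨ v))
        (All.lookup (clauses gΨ) (proj₁ (∈-filter⁻ near? B∈Ψ₁)))

    |Ψ₁|≤ : 4 * length Ψ₁ ≤ 2 ^ r
    |Ψ₁|≤ = begin
      4 * length Ψ₁            ≤⟨ *-monoʳ-≤ 4 (count-touches Ψ (degree≤ gΨ) (vars A)) ⟩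
      4 * (length (vars A) * d) ≡⟨ cong (λ w → 4 * (w * d)) (List.length-map proj₁ A) ⟩
      4 * (length A * d)       ≤⟨ *-monoʳ-≤ 4 (*-monoˡ-≤ d (m≤n⇒m≤1+n (width≤k gA))) ⟩
      4 * (suc k * d)          ≤⟨ 4kd≤2^r ⟩
      2 ^ r                    ∎

    -- At most 2 ^ r / 4 neighbours each exclude at most a fraction 2 / 2 ^ r of the solutions of
    -- `Ψ₂`, so at least half of them satisfy `Ψ`.
    N₂-bound : 2 ^ r * N₂ + 2 ^ r * N₂ ≤ 2 ^ r * (2 * N (_⊨? Ψ)) + 2 ^ r * N₂
    N₂-bound = begin
      2 ^ r * N₂ + 2 ^ r * N₂                      ≡⟨ cong (2 ^ r * N₂ +_) (sym (+-identityʳ (2 ^ r * N₂))) ⟩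
      2 * (2 ^ r * N₂)                             ≤⟨ *-monoʳ-≤ 2 (count-union (_⊨? Ψ₂) _⊨ᶜ?_ (assignments n) (2 ^ r) Ψ₁ (ih ℓ |Ψ|≤ℓ)) ⟩
      2 * (2 ^ r * N (λ σ → σ ⊨? Ψ₂ ×-dec σ ⊨? Ψ₁) + length Ψ₁ * (2 * N₂)) ≤⟨ *-monoʳ-≤ 2 (+-monoˡ-≤ _ (*-monoʳ-≤ (2 ^ r)
        (count-mono (λ σ → σ ⊨? Ψ₂ ×-dec σ ⊨? Ψ₁) (_⊨? Ψ) (assignments n) λ {σ} (s₂ , s₁) → ⊨-split near? σ s₁ s₂))) ⟩
      2 * (2 ^ r * N (_⊨? Ψ) + length Ψ₁ * (2 * N₂)) ≡⟨ arith (2 ^ r) (N (_⊨? Ψ)) (length Ψ₁) N₂ ⟩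
      2 ^ r * (2 * N (_⊨? Ψ)) + 4 * length Ψ₁ * N₂  ≤⟨ +-monoʳ-≤ (2 ^ r * (2 * N (_⊨? Ψ))) (*-monoˡ-≤ N₂ |Ψ₁|≤) ⟩
      2 ^ r * (2 * N (_⊨? Ψ)) + 2 ^ r * N₂         ∎
      where
      arith : ∀ x a l b → 2 * (x * a + l * (2 * b)) ≡ x * (2 * a) + 4 * l * b
      arith = solve-∀

  -- By `local-lemma` at most a fraction 2 / 2 ^ r ≤ 1/2 of the solutions of `Ψ` violate `A`.
  N-cons : ∀ {n} (Ψ : CNF n) A → GoodCNF r k d Ψ → GoodClause r k A →
           N (_⊨? Ψ) ≤ 2 * N (_⊨? (A ∷ Ψ))
  N-cons {n} Ψ A gΨ gA = +-cancelʳ-≤ a a (2 * b) (begin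
    a + a                     ≤⟨ +-mono-≤ split split ⟩
    (b + c) + (b + c)         ≡⟨ arith b c ⟩
    2 * b + 2 * c             ≤⟨ +-monoʳ-≤ (2 * b) (*-cancelˡ-≤ 2 (begin
      2 * (2 * c)             ≡⟨ *-assoc 2 2 c ⟨
      4 * c                   ≤⟨ *-monoˡ-≤ c 4≤2^r ⟩
      2 ^ r * c               ≤⟨ local-lemma (length Ψ) Ψ A ≤-refl gΨ gA ⟩
      2 * a                   ∎)) ⟩
    2 * b + a                 ∎)
    where
    open ≤-Reasoning
    a = N (_⊨? Ψ)
    b = N (_⊨? (A ∷ Ψ))
    c = N (violated? (_⊨? Ψ) A)
    arith : ∀ b c → (b + c) + (b + c) ≡ 2 * b + 2 * c
    arith = solve-∀
    split : a ≤ b + c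
    split = count-⊎ (_⊨? Ψ) (_⊨? (A ∷ Ψ)) (violated? (_⊨? Ψ) A) (assignments n) (λ {σ} → cases σ)
      where
      cases : ∀ σ → σ ⊨ Ψ → σ ⊨ (A ∷ Ψ) ⊎ (σ ⊨ Ψ × ¬ σ ⊨ᶜ A)
      cases σ sat with σ ⊨ᶜ? A
      ... | yes s = inj₁ (s ∷ sat)
      ... | no ¬s = inj₂ (sat , ¬s)

  good-tail : ∀ {n} {A : Clause n} {Ψ} → GoodCNF r k d (A ∷ Ψ) → GoodCNF r k d Ψ
  good-tail {A = A} {Ψ} (good (_ ∷ gs) deg) = good gs λ v → ≤-trans (degree-tail A Ψ v) (deg v)

  -- The loss depends on the number of added clauses alone, however large `Ω` is; this keeps n out
  -- of the final constants.
  N-++ : ∀ {n} (Ψ Ω : CNF n) → GoodCNF r k d (Ψ ++ Ω) →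
         N (_⊨? Ω) ≤ 2 ^ length Ψ * N (_⊨? (Ψ ++ Ω))
  N-++ []      Ω g = ≤-reflexive (sym (+-identityʳ _))
  N-++ (A ∷ Ψ) Ω g = begin
    N (_⊨? Ω)                                    ≤⟨ N-++ Ψ Ω (good-tail g) ⟩
    2 ^ length Ψ * N (_⊨? (Ψ ++ Ω))              ≤⟨ *-monoʳ-≤ (2 ^ length Ψ) (N-cons (Ψ ++ Ω) A (good-tail g) (All.head (clauses g))) ⟩
    2 ^ length Ψ * (2 * N (_⊨? (A ∷ Ψ ++ Ω)))    ≡⟨ arith (2 ^ length Ψ) _ ⟩
    2 * 2 ^ length Ψ * N (_⊨? (A ∷ Ψ ++ Ω))      ∎
    where
    open ≤-Reasoning
    arith : ∀ a b → a * (2 * b) ≡ 2 * a * b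
    arith = solve-∀

-- Pinning a set of variables

open module FinMembership {n} = Data.List.Membership.DecPropositional (Fin._≟_ {n}) using (_∈?_; _∉?_)

Linked-<⇒Unique : ∀ {n} {vs : List (Fin n)} → Linked Fin._<_ vs → Unique vs
Linked-<⇒Unique = AllPairs.map Fin.<⇒≢ ∘ Linked⇒AllPairs Fin.<-trans

-- Only `xs` has to be free of repetitions. This matters because `ys` will be a part of the
-- variables of a candidate clause, about which only its length is recorded.
count-∈-swap : ∀ {n} {xs : List (Fin n)} (ys : List (Fin n)) → Unique xs →
               count (_∈? ys) xs ≤ count (_∈? xs) ys
count-∈-swap ys [] = z≤n
count-∈-swap {xs = x ∷ xs} ys (x∉xs ∷ uniq) with x ∈? ys
... | no _ = ≤-trans (count-∈-swap ys uniq) (count-mono (_∈? xs) (_∈? (x ∷ xs)) ys there)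
... | yes x∈ys = begin
  suc (count (_∈? ys) xs)                   ≤⟨ +-mono-≤ (List.filter-some (x Fin.≟_) x∈ys) (count-∈-swap ys uniq) ⟩
  count (x Fin.≟_) ys + count (_∈? xs) ys   ≤⟨ count-disjoint (x Fin.≟_) (_∈? xs) (_∈? (x ∷ xs)) ys
                                                 (here ∘ sym) there (λ { refl x∈xs → All.lookup x∉xs x∈xs refl }) ⟩
  count (_∈? (x ∷ xs)) ys                   ∎
  where open ≤-Reasoning

count-filter-split : ∀ {A : Set} {P Q : A → Set} (P? : Decidable P) (Q? : Decidable Q) xs →
                     count P? (filter Q? xs) + count P? (filter (¬? ∘ Q?) xs) ≡ count P? xs
count-filter-split P? Q? [] = refl
count-filter-split P? Q? (x ∷ xs) with Q? x
... | yes _ with P? x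
...   | yes _ = cong suc (count-filter-split P? Q? xs)
...   | no _  = count-filter-split P? Q? xs
count-filter-split P? Q? (x ∷ xs) | no _ with P? x
...   | yes _ = trans (+-suc _ _) (cong suc (count-filter-split P? Q? xs))
...   | no _  = count-filter-split P? Q? xs

-- This is j (j - 1) / 2, the sum of 0, ..., j - 1: the clause added after j others can share j s
-- variables with them.
triangle : ℕ → ℕ
triangle zero    = 0
triangle (suc j) = j + triangle j

cover : ∀ {n} → List (Fin n) → CNF n → List (Fin n)
cover S []       = S
cover S (C ∷ Cs) = vars C ++ cover S Cs

∈-cover : ∀ {n S} (Cs : CNF n) {C v} → C ∈ Cs → v ∈ vars C → v ∈ cover S Cs
∈-cover (C ∷ Cs) (here refl) v∈C = ∈-++⁺ˡ v∈C
∈-cover (C ∷ Cs) (there C∈)  v∈C = ∈-++⁺ʳ (vars C) (∈-cover Cs C∈ v∈C)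

⊆-cover : ∀ {n S} (Cs : CNF n) {v} → v ∈ S → v ∈ cover S Cs
⊆-cover []       v∈S = v∈S
⊆-cover (C ∷ Cs) v∈S = ∈-++⁺ʳ (vars C) (⊆-cover Cs v∈S)

length-cover : ∀ {n k} S {Cs : CNF n} → All (λ C → length C ≡ k) Cs → length (cover S Cs) ≡ length Cs * k + length S
length-cover S [] = refl
length-cover {k = k} S {C ∷ Cs} (refl ∷ widths) = begin
  length (vars C ++ cover S Cs)            ≡⟨ List.length-++ (vars C) ⟩
  length (vars C) + length (cover S Cs)    ≡⟨ cong₂ _+_ (List.length-map proj₁ C) (length-cover S widths) ⟩
  k + (length Cs * k + length S)           ≡⟨ +-assoc k _ _ ⟨
  k + length Cs * k + length S             ∎
  where open ≡-Reasoning

common : ∀ {n} → List (Fin n) → Clause n → ℕ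
common W C = count (_∈? W) (vars C)

module Closure {k d s n} {Φ : CNF n} (kds : IsKDS k d s Φ)
  {τ : Assignment n} (τ⊨Φ : τ ⊨ Φ) (S : List (Fin n)) (|S|≡k : length S ≡ k)
  {t m : ℕ} (k<mt : k + triangle m * s < m * t) where

  open IsKDS kds

  SatisfiedOn : List (Fin n) → Clause n → Set
  SatisfiedOn W C = Any (λ (v , b) → v ∈ W × Vec.lookup τ v ≡ b) C

  satisfiedOn? : ∀ W → Decidable (SatisfiedOn W)
  satisfiedOn? W C = any? (λ (v , b) → (v ∈? W) ×-dec (_ Bool.≟ b)) C

  Heavy : List (Fin n) → Clause n → Set
  Heavy W C = ¬ SatisfiedOn W C × t ≤ common W C

  heavy? : ∀ W → Decidable (Heavy W)
  heavy? W C = ¬? (satisfiedOn? W C) ×-dec (t ≤? common W C)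

  -- Once its variables have been added, a clause is satisfied by τ there and is never heavy again.
  -- So a heavy clause differs from all earlier ones, and the bound s on shared variables applies.
  satisfiedOn-cover : ∀ {Cs C} → C ∈ Cs → C ∈ Φ → SatisfiedOn (cover S Cs) C
  satisfiedOn-cover {Cs} {C} C∈Cs C∈Φ with find (All.lookup τ⊨Φ C∈Φ)
  ... | l , l∈C , eq = lose l∈C (∈-cover Cs C∈Cs (∈-map⁺ proj₁ l∈C) , eq)

  count-shared : ∀ {C} → C ∈ Φ → ∀ {Cs} → All (λ C′ → C′ ∈ Φ × C ≢ C′) Cs →
                 count (λ v → any? (λ C′ → v ∈? vars C′) Cs) (vars C) ≤ length Cs * s
  count-shared {C} C∈Φ [] = ≤-reflexive (count-∅ (λ v → any? (λ C′ → v ∈? vars C′) []) (vars C) λ ())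
  count-shared {C} C∈Φ {C′ ∷ Cs} ((C′∈Φ , C≢C′) ∷ rest) = ≤-trans
    (count-⊎ (λ v → any? (λ C′ → v ∈? vars C′) (C′ ∷ Cs)) (_∈vars? C′) (λ v → any? (λ C′ → v ∈? vars C′) Cs) (vars C)
      λ { (here v∈) → inj₁ v∈ ; (there v∈) → inj₂ v∈ })
    (+-mono-≤ (shared≤ C∈Φ C′∈Φ C≢C′) (count-shared C∈Φ rest))

  -- R is the part of S outside the clauses Cs.  A heavy clause shares at most
  -- |Cs| s variables with Cs, so it removes at least t - |Cs| s variables from R.
  grow : ∀ fuel Cs R → length Cs + fuel ≡ m → All (_∈ Φ) Cs →
         (∀ {v} → v ∈ cover S Cs → v ∈ R ⊎ Any (λ C → v ∈ vars C) Cs) →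
         length R + length Cs * t ≤ k + triangle (length Cs) * s →
         ∃[ Ds ] length Ds < m × All (_∈ Φ) Ds × All (¬_ ∘ Heavy (cover S Ds)) Φ
  -- Fuel is m minus the number of clauses added. With m clauses the invariant contradicts `k<mt`,
  -- so this case cannot be reached.
  grow zero Cs R |Cs|≡m Cs⊆Φ R-covers bound rewrite trans (sym (+-identityʳ (length Cs))) |Cs|≡m =
    contradiction (≤-trans (m≤n+m _ (length R)) bound) (<⇒≱ k<mt)
  grow (suc fuel) Cs R |Cs|≡m Cs⊆Φ R-covers bound with any? (heavy? (cover S Cs)) Φ
  ... | no ¬heavy = Cs , ≤-trans (≤-trans (s≤s (m≤m+n _ fuel)) (≤-reflexive (sym (+-suc _ fuel)))) (≤-reflexive |Cs|≡m) ,
                    Cs⊆Φ , All.¬Any⇒All¬ Φ ¬heavy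
  ... | yes heavy with find heavy
  ...   | C , C∈Φ , ¬sat , t≤common =
    grow fuel (C ∷ Cs) (filter (¬? ∘ (_∈? vars C)) R) (trans (sym (+-suc _ fuel)) |Cs|≡m) (C∈Φ ∷ Cs⊆Φ) covers bound′
    where
    j = length Cs
    R∖C = filter (¬? ∘ (_∈? vars C)) R
    covers : ∀ {v} → v ∈ cover S (C ∷ Cs) → v ∈ R∖C ⊎ Any (λ C → v ∈ vars C) (C ∷ Cs)
    covers {v} v∈ with v ∈? vars C
    ... | yes v∈C = inj₂ (here v∈C)
    ... | no v∉C with ∈-++⁻ (vars C) v∈
    ...   | inj₁ v∈C = contradiction v∈C v∉C
    ...   | inj₂ v∈W = Sum.map (λ v∈R → ∈-filter⁺ (¬? ∘ (_∈? vars C)) v∈R v∉C) there (R-covers v∈W)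
    new : All (λ C′ → C′ ∈ Φ × C ≢ C′) Cs
    new = All.tabulate λ C′∈Cs → All.lookup Cs⊆Φ C′∈Cs ,
                                 λ { refl → ¬sat (satisfiedOn-cover C′∈Cs C∈Φ) }
    t≤ : t ≤ count (_∈? vars C) R + j * s
    t≤ = begin
      t                                          ≤⟨ t≤common ⟩
      common (cover S Cs) C                     ≤⟨ count-⊎ (_∈? cover S Cs) (_∈? R)
                                                      (λ v → any? (λ C′ → v ∈? vars C′) Cs) (vars C) R-covers ⟩
      count (_∈? R) (vars C) + _                 ≤⟨ +-mono-≤ (count-∈-swap R (Linked-<⇒Unique (All.lookup ordered C∈Φ)))
                                                      (count-shared C∈Φ new) ⟩
      count (_∈? vars C) R + j * s               ∎
      where open ≤-Reasoning
    bound′ : length R∖C + suc j * t ≤ k + (j + triangle j) * s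
    bound′ = begin
      length R∖C + (t + j * t)                              ≤⟨ +-monoʳ-≤ (length R∖C) (+-monoˡ-≤ (j * t) t≤) ⟩
      length R∖C + (count (_∈? vars C) R + j * s + j * t)   ≡⟨ arith₁ (length R∖C) (count (_∈? vars C) R) (j * s) (j * t) ⟩
      (count (_∈? vars C) R + length R∖C) + j * t + j * s   ≡⟨ cong (λ w → w + j * t + j * s) (length-filter-split (_∈? vars C) R) ⟩
      length R + j * t + j * s                              ≤⟨ +-monoˡ-≤ (j * s) bound ⟩
      k + triangle j * s + j * s                            ≡⟨ arith₂ k (triangle j) s j ⟩
      k + (j + triangle j) * s                              ∎
      where
      open ≤-Reasoning
      arith₁ : ∀ a b c d → a + (b + c + d) ≡ b + a + d + c
      arith₁ = solve-∀
      arith₂ : ∀ a b c d → a + b * c + d * c ≡ a + (d + b) * c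
      arith₂ = solve-∀

  closure : ∃[ W ] length W ≤ m * k × (∀ {v} → v ∈ S → v ∈ W) × All (¬_ ∘ Heavy W) Φ
  closure with grow m [] S refl [] inj₁ (≤-reflexive (cong (_+ 0) |S|≡k))
  ... | Ds , |Ds|<m , Ds⊆Φ , ¬heavy = cover S Ds , |W|≤ , ⊆-cover Ds , ¬heavy
    where
    open ≤-Reasoning
    |W|≤ : length (cover S Ds) ≤ m * k
    |W|≤ = begin
      length (cover S Ds)      ≡⟨ length-cover S (All.map (All.lookup width) Ds⊆Φ) ⟩
      length Ds * k + length S ≡⟨ cong (length Ds * k +_) |S|≡k ⟩
      length Ds * k + k        ≡⟨ +-comm _ k ⟩
      suc (length Ds) * k      ≤⟨ *-monoˡ-≤ k |Ds|<m ⟩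
      m * k                    ∎

-- Pinning W to τ leaves every clause either satisfied or with at least r free
-- variables, so the local lemma still applies to the pinned formula.
module Pinned {r k d s n t m} {Φ : CNF n} (kds : IsKDS k d s Φ)
  (1≤d : 1 ≤ d) (4kd≤2^r : 4 * (suc k * d) ≤ 2 ^ r) (t+r≡1+k : t + r ≡ suc k) (1≤t : 1 ≤ t)
  (k<mt : k + triangle m * s < m * t)
  {τ : Assignment n} (τ⊨Φ : τ ⊨ Φ) (c : Clause n) (|c|≡k : length c ≡ k) (τ⊭c : ¬ τ ⊨ᶜ c) where

  open LocalLemma {r} {k} {d} 1≤d 4kd≤2^r
  open IsKDS kds hiding (degree≤)
  open Closure kds {τ} τ⊨Φ (vars c) (trans (List.length-map proj₁ c) |c|≡k) {t} {m} k<mt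

  W : List (Fin n)
  W = proj₁ closure

  free : Clause n → Clause n
  free = filter (λ (v , b) → v ∉? W)

  touched untouched pinned : CNF n
  touched   = filter (touches? W) Φ
  untouched = filter (¬? ∘ touches? W) Φ
  pinned    = map free (filter (¬? ∘ satisfiedOn? W) touched)

  vars-free⊆ : ∀ C {v} → v ∈ vars (free C) → v ∈ vars C
  vars-free⊆ C v∈ = Any.map⁺ (Any.filter⁻ (λ (v , b) → v ∉? W) (Any.map⁻ v∈))

  vars-free∉ : ∀ C {v} → v ∈ W → v ∉ vars (free C)
  vars-free∉ C v∈W v∈ with find (Any.map⁻ {f = proj₁} {xs = free C} v∈)
  ... | l , l∈ , refl = proj₂ (∈-filter⁻ (λ (v , b) → v ∉? W) {xs = C} l∈) v∈W

  r≤k : r ≤ k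
  r≤k = +-cancelˡ-≤ 1 _ _ (≤-trans (+-monoˡ-≤ r 1≤t) (≤-reflexive t+r≡1+k))

  good-clause : ∀ {C} → C ∈ Φ → GoodClause r k C
  good-clause C∈Φ = good (Linked-<⇒Unique (All.lookup ordered C∈Φ))
    (≤-trans r≤k (≤-reflexive (sym (All.lookup width C∈Φ)))) (≤-reflexive (All.lookup width C∈Φ))

  -- An unsatisfied clause that is not heavy has at most t - 1 variables in `W`, which leaves k - (t
  -- - 1) = r of them free.
  good-free : ∀ {C} → C ∈ Φ → ¬ SatisfiedOn W C → GoodClause r k (free C)
  good-free {C} C∈Φ ¬sat = good
    (AllPairs.map⁺ (AllPairs.filter⁺ _ (AllPairs.map⁻ (Linked-<⇒Unique (All.lookup ordered C∈Φ)))))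
    (+-cancelˡ-≤ t r _ (begin
      t + r                                       ≡⟨ t+r≡1+k ⟩
      suc k                                       ≡⟨ cong suc (All.lookup width C∈Φ) ⟨
      suc (length C)                              ≡⟨ cong suc (List.length-map proj₁ C) ⟨
      suc (length (vars C))                       ≡⟨ cong suc (length-filter-split (_∈? W) (vars C)) ⟨
      suc (common W C) + count (_∉? W) (vars C)  ≡⟨ cong (suc (common W C) +_) (count-map (_∉? W) proj₁ C) ⟩
      suc (common W C) + length (free C)         ≤⟨ +-monoˡ-≤ (length (free C)) common<t ⟩
      t + length (free C)                         ∎))
    (≤-trans (List.length-filter (λ (v , b) → v ∉? W) C) (≤-reflexive (All.lookup width C∈Φ)))
    where
    open ≤-Reasoning
    common<t : common W C < t
    common<t = ≰⇒> λ t≤ → All.lookup (proj₂ (proj₂ (proj₂ closure))) C∈Φ (¬sat , t≤)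

  good-pinned : GoodCNF r k d (pinned ++ untouched)
  good-pinned = good
    (All.++⁺ (All.map⁺ (All.tabulate λ C∈ →
               let C∈touched , ¬sat = ∈-filter⁻ (¬? ∘ satisfiedOn? W) C∈
               in good-free (proj₁ (∈-filter⁻ (touches? W) C∈touched)) ¬sat))
             (All.tabulate λ C∈ → good-clause (proj₁ (∈-filter⁻ (¬? ∘ touches? W) C∈))))
    λ v → begin
      degree (pinned ++ untouched) v        ≡⟨ count-++ (v ∈vars?_) pinned untouched ⟩
      degree pinned v + degree untouched v  ≤⟨ +-monoˡ-≤ (degree untouched v) (degree-pinned v) ⟩
      degree touched v + degree untouched v ≡⟨ count-filter-split (v ∈vars?_) (touches? W) Φ ⟩
      degree Φ v                            ≤⟨ IsKDS.degree≤ kds v ⟩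
      d                                     ∎
    where
    open ≤-Reasoning
    degree-pinned : ∀ v → degree pinned v ≤ degree touched v
    degree-pinned v = begin
      degree pinned v          ≡⟨ count-map (v ∈vars?_) free unsat ⟩
      count ((v ∈vars?_) ∘ free) unsat ≤⟨ count-mono ((v ∈vars?_) ∘ free) (v ∈vars?_) unsat (λ {C} → vars-free⊆ C) ⟩
      degree unsat v           ≤⟨ degree-filter (¬? ∘ satisfiedOn? W) touched v ⟩
      degree touched v         ∎
      where unsat = filter (¬? ∘ satisfiedOn? W) touched

  ignores-W : ∀ {v} → v ∈ W → (_⊨ (pinned ++ untouched)) Ignores v
  ignores-W v∈W = ⊨-ignores (All.++⁺
    (All.map⁺ (All.universal (λ C → vars-free∉ C v∈W) _))
    (All.map (λ ¬touch v∈C → ¬touch (lose v∈W v∈C)) (All.all-filter (¬? ∘ touches? W) Φ)))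

  -- A clause of Φ is untouched, or satisfied by τ inside `W` and hence by σ, or contains a clause
  -- of `pinned`. The clause c stays violated because all its variables lie in `W`.
  agreeing-solutions : ∀ σ → σ ⊨ (pinned ++ untouched) × Agrees τ W σ → σ ⊨ Φ × ¬ σ ⊨ᶜ c
  agreeing-solutions σ (sat , agree) = All.tabulate (λ {C} → sat-clause C) , σ⊭c
    where
    σ⊭c : ¬ σ ⊨ᶜ c
    σ⊭c σ⊨c with find σ⊨c
    ... | l , l∈c , eq = τ⊭c (lose l∈c (trans (sym (All.lookup agree (proj₁ (proj₂ (proj₂ closure)) (∈-map⁺ proj₁ l∈c)))) eq))
    sat-clause : ∀ C → C ∈ Φ → σ ⊨ᶜ C
    sat-clause C C∈Φ with touches? W C
    ... | no ¬touch = All.lookup (All.++⁻ʳ pinned sat) (∈-filter⁺ (¬? ∘ touches? W) C∈Φ ¬touch)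
    ... | yes touch with satisfiedOn? W C
    ...   | yes on-W = Any.map (λ (v∈W , eq) → trans (All.lookup agree v∈W) eq) on-W
    ...   | no ¬on-W = Any.filter⁻ (λ (v , b) → v ∉? W) (All.lookup (All.++⁻ˡ pinned sat)
              (∈-map⁺ free (∈-filter⁺ (¬? ∘ satisfiedOn? W) (∈-filter⁺ (touches? W) C∈Φ touch) ¬on-W)))

  -- Dropping the touched clauses only gains solutions. Adding back at most |W| d pinned clauses
  -- costs a factor 2 each, and fixing the variables of `W` costs another 2 each; |W| ≤ m k gives
  -- the exponent.
  N-violated-lower : N (_⊨? Φ) ≤ 2 ^ (suc d * (m * k)) * N (violated? (_⊨? Φ) c)
  N-violated-lower = begin
    N (_⊨? Φ)                ≤⟨ count-mono (_⊨? Φ) (_⊨? untouched) (assignments n) (λ sat → All.filter⁺ _ sat) ⟩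
    N (_⊨? untouched)        ≤⟨ N-++ pinned untouched good-pinned ⟩
    2 ^ length pinned * N P? ≤⟨ *-mono-≤ (^-monoʳ-≤ 2 |pinned|≤) (N-agrees P? τ W ignores-W) ⟩
    2 ^ (length W * d) * (2 ^ length W * N (agrees? P? τ W))
      ≤⟨ *-monoʳ-≤ (2 ^ (length W * d)) (*-monoʳ-≤ (2 ^ length W) (count-mono (agrees? P? τ W) (violated? (_⊨? Φ) c) (assignments n) λ {σ} → agreeing-solutions σ)) ⟩
    2 ^ (length W * d) * (2 ^ length W * V)    ≡⟨ *-assoc (2 ^ (length W * d)) (2 ^ length W) V ⟨
    2 ^ (length W * d) * 2 ^ length W * V      ≡⟨ cong (_* V) (^-distribˡ-+-* 2 (length W * d) (length W)) ⟨
    2 ^ (length W * d + length W) * V          ≡⟨ cong (λ e → 2 ^ e * V) (arith (length W) d) ⟩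
    2 ^ (suc d * length W) * V                 ≤⟨ *-monoˡ-≤ V (^-monoʳ-≤ 2 (*-monoʳ-≤ (suc d) (proj₁ (proj₂ closure)))) ⟩
    2 ^ (suc d * (m * k)) * V                  ∎
    where
    open ≤-Reasoning
    P? = _⊨? (pinned ++ untouched)
    V = N (violated? (_⊨? Φ) c)
    arith : ∀ w d → w * d + w ≡ suc d * w
    arith = solve-∀
    |pinned|≤ : length pinned ≤ length W * d
    |pinned|≤ = begin
      length pinned ≡⟨ List.length-map free (filter (¬? ∘ satisfiedOn? W) touched) ⟩
      length (filter (¬? ∘ satisfiedOn? W) touched) ≤⟨ List.length-filter (¬? ∘ satisfiedOn? W) touched ⟩
      length touched ≤⟨ count-touches Φ (IsKDS.degree≤ kds) W ⟩
      length W * d   ∎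

module _ {r k d s n} {Φ : CNF n} (kds : IsKDS k d s Φ)
  (1≤d : 1 ≤ d) (4kd≤2^r : 4 * (suc k * d) ≤ 2 ^ r) (r≤k : r ≤ k) where

  open LocalLemma {r} {k} {d} 1≤d 4kd≤2^r
  open IsKDS kds hiding (degree≤)

  -- `N-++` over the empty formula, which every assignment satisfies. Without a solution `μ Φ` would
  -- be the zero function instead of a distribution.
  satisfiable : 1 ≤ N (_⊨? Φ)
  satisfiable = n≢0⇒n>0 λ N≡0 → <⇒≱ (N-[] n) (≤-trans (N-++ Φ [] good-Φ)
    (≤-reflexive (trans (cong (2 ^ length Φ *_) (trans (cong (λ Ψ → N (_⊨? Ψ)) (List.++-identityʳ Φ)) N≡0)) (*-zeroʳ (2 ^ length Φ)))))
    where
    good-Φ : GoodCNF r k d (Φ ++ [])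
    good-Φ = subst (GoodCNF r k d) (sym (List.++-identityʳ Φ)) (good (All.tabulate λ C∈Φ →
      good (Linked-<⇒Unique (All.lookup ordered C∈Φ))
        (≤-trans r≤k (≤-reflexive (sym (All.lookup width C∈Φ)))) (≤-reflexive (All.lookup width C∈Φ))) (IsKDS.degree≤ kds))
    N-[] : ∀ n → 0 < N {n} (_⊨? [])
    N-[] n = ∈-length (∈-filter⁺ (_⊨? []) (∈-assignments (Vec.replicate n true)) [])

-- Valiant's algorithm

^-distribʳ-* : ∀ k m n → (m * n) ^ k ≡ m ^ k * n ^ k
^-distribʳ-* zero    m n = refl
^-distribʳ-* (suc k) m n = trans (cong (m * n *_) (^-distribʳ-* k m n)) (interchange m n (m ^ k) (n ^ k))
  where
  interchange : ∀ a b c d → a * b * (c * d) ≡ a * c * (b * d)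
  interchange = solve-∀

variables-steps : ∀ {n} j .(j≤n : j ≤ n) → steps (variables j j≤n) ≡ suc j
variables-steps zero    j≤n = refl
variables-steps (suc j) j≤n = cong suc (trans (+-identityʳ _) (variables-steps j _))

length-variables : ∀ {n} j .(j≤n : j ≤ n) → length (result (variables j j≤n)) ≡ j
length-variables zero    j≤n = refl
length-variables (suc j) j≤n = cong suc (length-variables j _)

variables-< : ∀ {n} j .(j≤n : j ≤ n) → All (λ v → toℕ v < j) (result (variables j j≤n))
variables-< zero    j≤n = []
variables-< (suc j) j≤n = s≤s (≤-reflexive (Fin.toℕ-fromℕ< j≤n)) ∷ All.map m≤n⇒m≤1+n (variables-< j _)

variables-decreasing : ∀ {n} j .(j≤n : j ≤ n) → AllPairs Fin._>_ (result (variables j j≤n))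
variables-decreasing zero    j≤n = []
variables-decreasing (suc j) j≤n =
  All.map (λ w<j → ≤-trans w<j (≤-reflexive (sym (Fin.toℕ-fromℕ< j≤n)))) (variables-< j _) ∷ variables-decreasing j _

∈-variables : ∀ {n} j .(j≤n : j ≤ n) v → toℕ v < j → v ∈ result (variables j j≤n)
∈-variables (suc j) j≤n v (s≤s v≤j) with m≤n⇒m<n∨m≡n v≤j
... | inj₁ v<j = there (∈-variables j _ v v<j)
... | inj₂ v≡j = here (Fin.toℕ-injective (trans v≡j (sym (Fin.toℕ-fromℕ< j≤n))))

-- With a = 3 l + 1 the recursion costs 1 + a ^ (j + 1) + 2 a ^ j, which is at most (a + 3) a ^ j:
-- of the increment 3, two parts pay for the calls that choose a literal and one for the step
-- itself.
candidates-steps : ∀ {n} j vs (c : Clause n) acc →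
                   steps (candidates j vs c acc) ≤ (3 * length vs + 1) ^ j
candidates-steps zero    vs       c acc = ≤-refl
candidates-steps (suc j) []       c acc = ≤-reflexive (sym (^-zeroˡ (suc j)))
candidates-steps (suc j) (v ∷ vs) c acc = begin
  suc (steps c₁ + (steps c₂ + steps c₃))
    ≤⟨ s≤s (+-mono-≤ (candidates-steps (suc j) vs c acc) (+-mono-≤ (candidates-steps j vs _ (result c₁)) (candidates-steps j vs _ (result c₂)))) ⟩
  suc (a * a ^ j + (a ^ j + a ^ j))               ≤⟨ +-monoˡ-≤ _ (m^n>0 a j) ⟩
  a ^ j + (a * a ^ j + (a ^ j + a ^ j))           ≡⟨ arith a (a ^ j) ⟩
  (3 + a) * a ^ j                                 ≤⟨ *-monoʳ-≤ (3 + a) (^-monoˡ-≤ j (m≤n+m a 3)) ⟩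
  (3 + a) ^ suc j                                 ≡⟨ cong (_^ suc j) (arith′ (length vs)) ⟩
  (3 * suc (length vs) + 1) ^ suc j               ∎
  where
  open ≤-Reasoning
  a = 3 * length vs + 1
  c₁ = candidates (suc j) vs c acc
  c₂ = candidates j vs ((v , false) ∷ c) (result c₁)
  c₃ = candidates j vs ((v , true) ∷ c) (result c₂)
  instance
    a≢0 : NonZero a
    a≢0 = subst NonZero (+-comm 1 (3 * length vs)) _
  arith : ∀ a b → b + (a * b + (b + b)) ≡ (3 + a) * b
  arith = solve-∀
  arith′ : ∀ l → 3 + (3 * l + 1) ≡ 3 * suc l + 1
  arith′ = solve-∀

-- A step adds at most one clause, so the time bound also bounds the number of candidates.
length-candidates : ∀ {n} j vs (c : Clause n) acc →
                    length (result (candidates j vs c acc)) ≤ length acc + steps (candidates j vs c acc)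
length-candidates zero    vs       c acc = ≤-reflexive (+-comm 1 _)
length-candidates (suc j) []       c acc = m≤m+n _ 1
length-candidates (suc j) (v ∷ vs) c acc = begin
  length (result c₃)                                     ≤⟨ length-candidates j vs _ (result c₂) ⟩
  length (result c₂) + steps c₃                          ≤⟨ +-monoˡ-≤ (steps c₃) (length-candidates j vs _ (result c₁)) ⟩
  length (result c₁) + steps c₂ + steps c₃               ≤⟨ +-monoˡ-≤ (steps c₃) (+-monoˡ-≤ (steps c₂) (length-candidates (suc j) vs c acc)) ⟩
  length acc + steps c₁ + steps c₂ + steps c₃            ≡⟨ arith (length acc) _ _ _ ⟩
  length acc + (steps c₁ + (steps c₂ + steps c₃))        ≤⟨ +-monoʳ-≤ (length acc) (n≤1+n _) ⟩
  length acc + suc (steps c₁ + (steps c₂ + steps c₃))    ∎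
  where
  open ≤-Reasoning
  c₁ = candidates (suc j) vs c acc
  c₂ = candidates j vs ((v , false) ∷ c) (result c₁)
  c₃ = candidates j vs ((v , true) ∷ c) (result c₂)
  arith : ∀ a b c d → a + b + c + d ≡ a + (b + (c + d))
  arith = solve-∀

candidates-width : ∀ {n k} j vs (c : Clause n) acc → length c + j ≡ k → All (λ c → length c ≡ k) acc →
                   All (λ c → length c ≡ k) (result (candidates j vs c acc))
candidates-width zero    vs       c acc eq ws = trans (sym (+-identityʳ _)) eq ∷ ws
candidates-width (suc j) []       c acc eq ws = ws
candidates-width (suc j) (v ∷ vs) c acc eq ws =
  candidates-width j vs _ _ (trans (sym (+-suc _ j)) eq)
    (candidates-width j vs _ _ (trans (sym (+-suc _ j)) eq)
      (candidates-width (suc j) vs c acc eq ws))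

candidates-⊇acc : ∀ {n} j vs (c : Clause n) acc {c′} → c′ ∈ acc → c′ ∈ result (candidates j vs c acc)
candidates-⊇acc zero    vs       c acc c′∈ = there c′∈
candidates-⊇acc (suc j) []       c acc c′∈ = c′∈
candidates-⊇acc (suc j) (v ∷ vs) c acc c′∈ =
  candidates-⊇acc j vs _ _ (candidates-⊇acc j vs _ _ (candidates-⊇acc (suc j) vs c acc c′∈))

-- The variables come in decreasing order and literals are prepended, so the chosen literals end up
-- reversed, that is, sorted by increasing variable as `IsKDS` demands.
∈-candidates : ∀ {n} vs (ls : Clause n) c acc → AllPairs Fin._>_ vs → AllPairs Fin._>_ (vars ls) →
               All (_∈ vs) (vars ls) → (ls ʳ++ c) ∈ result (candidates (length ls) vs c acc)
∈-candidates vs       []             c acc _ _ _ = here refl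
∈-candidates (v ∷ vs) ((w , b) ∷ ls) c acc (v>vs ∷ dec) (w>ls ∷ dec′) (here refl ∷ ls⊆) = pick b
  where
  ls⊆vs : All (_∈ vs) (vars ls)
  ls⊆vs = All.zipWith (λ { (w>l , here refl) → contradiction w>l (<-irrefl refl) ; (_ , there l∈) → l∈ }) (w>ls , ls⊆)
  pick : ∀ b → (ls ʳ++ ((w , b) ∷ c)) ∈ result (candidates (suc (length ls)) (v ∷ vs) c acc)
  pick true  = ∈-candidates vs ls _ _ dec dec′ ls⊆vs
  pick false = candidates-⊇acc (length ls) vs _ _ (∈-candidates vs ls _ _ dec dec′ ls⊆vs)
∈-candidates (v ∷ vs) ((w , b) ∷ ls) c acc (v>vs ∷ dec) (w>ls ∷ dec′) (there w∈vs ∷ ls⊆) =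
  candidates-⊇acc (length ls) vs _ _ (candidates-⊇acc (length ls) vs _ _
    (∈-candidates vs ((w , b) ∷ ls) c acc dec (w>ls ∷ dec′) (w∈vs ∷ ls⊆vs)))
  where
  ls⊆vs : All (_∈ vs) (vars ls)
  ls⊆vs = All.zipWith (λ { (w>l , here refl) → contradiction (<-trans w>l (All.lookup v>vs w∈vs)) (<-irrefl refl) ; (_ , there l∈) → l∈ }) (w>ls , ls⊆)

allClauses : ∀ n → ℕ → CNF n
allClauses n k = result (candidates k (result (variables n ≤-refl)) [] [])

allClauses-width : ∀ n k → All (λ c → length c ≡ k) (allClauses n k)
allClauses-width n k = candidates-width k _ [] [] refl []

AllPairs-ʳ++ : ∀ {A : Set} {R : A → A → Set} {xs ys : List A} → AllPairs R xs → AllPairs (λ x y → R y x) ys →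
              All (λ y → All (R y) xs) ys → AllPairs (λ x y → R y x) (xs ʳ++ ys)
AllPairs-ʳ++ []         ys! ys<xs = ys!
AllPairs-ʳ++ (x< ∷ xs!) ys! ys<xs = AllPairs-ʳ++ xs! (All.map All.head ys<xs ∷ ys!) (x< ∷ All.map All.tail ys<xs)

∈-allClauses : ∀ {n} (c : Clause n) → Linked Fin._<_ (vars c) → c ∈ allClauses n (length c)
∈-allClauses {n} c sorted = subst₂ (λ c′ k → c′ ∈ allClauses n k) (List.reverse-involutive c) (List.length-reverse c)
  (∈-candidates (result (variables n ≤-refl)) (reverse c) [] [] (variables-decreasing n ≤-refl)
    (subst (AllPairs Fin._>_) (sym (List.reverse-map proj₁ c)) (AllPairs-ʳ++ (Linked⇒AllPairs Fin.<-trans sorted) [] []))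
    (All.universal (λ v → ∈-variables n ≤-refl v (Fin.toℕ<n v)) _))

length-allClauses : ∀ n k → length (allClauses n k) ≤ (3 * n + 1) ^ k
length-allClauses n k = begin
  length (allClauses n k)           ≤⟨ length-candidates k vs [] [] ⟩
  steps (candidates k vs [] [])     ≤⟨ candidates-steps k vs [] [] ⟩
  (3 * length vs + 1) ^ k           ≡⟨ cong (λ l → (3 * l + 1) ^ k) (length-variables n ≤-refl) ⟩
  (3 * n + 1) ^ k                   ∎
  where
  open ≤-Reasoning
  vs = result (variables n ≤-refl)

-- Pruning and the total running time

satisfied-steps : ∀ {n} σ (c : Clause n) → steps (satisfied σ c) ≤ suc (length c)
satisfied-steps σ [] = ≤-refl
satisfied-steps σ ((v , b) ∷ c) with does (lookup σ v Bool.≟ b)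
... | true  = s≤s z≤n
... | false = s≤s (satisfied-steps σ c)

result-satisfied : ∀ {n} σ (c : Clause n) → result (satisfied σ c) ≡ does (σ ⊨ᶜ? c)
result-satisfied σ [] = refl
result-satisfied σ ((v , b) ∷ c) with does (lookup σ v Bool.≟ b)
... | true  = refl
... | false = result-satisfied σ c

survives-steps : ∀ {n T} (X : Samples n T) c → steps (survives X c) ≤ 1 + T * (2 + length c)
survives-steps [] c = ≤-refl
survives-steps {T = suc T} (σ ∷ X) c with result (satisfied σ c)
... | true = s≤s (begin
  steps (satisfied σ c) + steps (survives X c) ≤⟨ +-mono-≤ (satisfied-steps σ c) (survives-steps X c) ⟩
  suc (length c) + (1 + T * (2 + length c))    ≡⟨ +-suc (suc (length c)) _ ⟩
  2 + length c + T * (2 + length c)            ∎)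
  where open ≤-Reasoning
... | false = s≤s (begin
  steps (satisfied σ c) + 0                    ≤⟨ +-mono-≤ (satisfied-steps σ c) z≤n ⟩
  suc (length c) + T * (2 + length c)          ≤⟨ n≤1+n _ ⟩
  2 + length c + T * (2 + length c)            ∎)
  where open ≤-Reasoning

survives? : ∀ {n T} (X : Samples n T) → Decidable (λ c → VecAll.All (_⊨ᶜ c) X)
survives? X c = VecAll.all? (_⊨ᶜ? c) X

result-survives : ∀ {n T} (X : Samples n T) c → result (survives X c) ≡ does (survives? X c)
result-survives []      c = refl
result-survives (σ ∷ X) c rewrite result-satisfied σ c with does (σ ⊨ᶜ? c)
... | true  = result-survives X c
... | false = refl

result-prune : ∀ {n T} (X : Samples n T) Φ → result (prune X Φ) ≡ filter (survives? X) Φ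
result-prune X [] = refl
result-prune X (c ∷ Φ) rewrite result-survives X c | result-prune X Φ with does (survives? X c)
... | true  = refl
... | false = refl

prune-steps : ∀ {n T k} (X : Samples n T) {Φ} → All (λ c → length c ≡ k) Φ →
              steps (prune X Φ) ≤ 1 + length Φ * (2 + T * (2 + k))
prune-steps X [] = ≤-refl
prune-steps {T = T} {k} X {c ∷ Φ} (refl ∷ ws) = begin
  suc (steps (prune X Φ) + (steps (survives X c) + 0)) ≤⟨ s≤s (+-mono-≤ (prune-steps X ws) (+-monoˡ-≤ 0 (survives-steps X c))) ⟩
  suc (1 + length Φ * a + (1 + T * (2 + k) + 0))       ≡⟨ arith (length Φ * a) (T * (2 + k)) ⟩
  1 + (a + length Φ * a)                               ∎
  where
  open ≤-Reasoning
  a = 2 + T * (2 + k)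
  arith : ∀ x y → suc (1 + x + (1 + y + 0)) ≡ 1 + (2 + y + x)
  arith = solve-∀

valiant-steps : ∀ n k {T} (X : Samples n T) → 1 ≤ n → 1 ≤ k →
                steps (valiant n k X) ≤ 4 ^ k * (7 + T * (2 + k)) * n ^ k
valiant-steps n k {T} X 1≤n 1≤k = begin
  suc (steps vars′ + (steps cands + steps (prune X (allClauses n k))))
    ≤⟨ s≤s (+-mono-≤ (≤-reflexive (variables-steps n ≤-refl)) (+-mono-≤ cands≤ (≤-trans (prune-steps X (allClauses-width n k)) (s≤s (*-monoˡ-≤ (2 + T * (2 + k)) (length-allClauses n k)))))) ⟩
  suc (suc n + (m + (1 + m * (2 + T * (2 + k)))))   ≡⟨ arith n m (T * (2 + k)) ⟩
  3 + n + m * (3 + T * (2 + k))                     ≤⟨ +-mono-≤ {x = 3 + n} (+-mono-≤ {x = 3} (*-monoʳ-≤ 3 n^k>0) (n≤m)) ≤-refl ⟩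
  3 * m + m + m * (3 + T * (2 + k))                 ≡⟨ arith₂ m (T * (2 + k)) ⟩
  m * (7 + T * (2 + k))                             ≤⟨ *-monoˡ-≤ (7 + T * (2 + k)) m≤ ⟩
  4 ^ k * n ^ k * (7 + T * (2 + k))                 ≡⟨ arith₃ (4 ^ k) (n ^ k) _ ⟩
  4 ^ k * (7 + T * (2 + k)) * n ^ k                 ∎
  where
  open ≤-Reasoning
  vars′ = variables n ≤-refl
  cands = candidates k (result vars′) [] []
  m = (3 * n + 1) ^ k
  instance
    a≢0 : NonZero (3 * n + 1)
    a≢0 = subst NonZero (+-comm 1 (3 * n)) _
  n^k>0 : 1 ≤ m
  n^k>0 = m^n>0 (3 * n + 1) k
  n≤m : n ≤ m
  n≤m = begin
    n               ≤⟨ m≤n+m n (2 * n + 1) ⟩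
    2 * n + 1 + n   ≡⟨ arith₄ n ⟩
    3 * n + 1       ≡⟨ ^-identityʳ (3 * n + 1) ⟨
    (3 * n + 1) ^ 1 ≤⟨ ^-monoʳ-≤ (3 * n + 1) 1≤k ⟩
    m               ∎
    where
    arith₄ : ∀ n → 2 * n + 1 + n ≡ 3 * n + 1
    arith₄ = solve-∀
  m≤ : m ≤ 4 ^ k * n ^ k
  m≤ = begin
    (3 * n + 1) ^ k ≤⟨ ^-monoˡ-≤ k (+-monoʳ-≤ (3 * n) 1≤n) ⟩
    (3 * n + n) ^ k ≡⟨ cong (_^ k) (+-comm (3 * n) n) ⟩
    (4 * n) ^ k     ≡⟨ ^-distribʳ-* k 4 n ⟩
    4 ^ k * n ^ k   ∎
  cands≤ : steps cands ≤ m
  cands≤ = ≤-trans (candidates-steps k _ [] []) (≤-reflexive (cong (λ l → (3 * l + 1) ^ k) (length-variables n ≤-refl)))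
  arith : ∀ n m t → suc (suc n + (m + (1 + m * (2 + t)))) ≡ 3 + n + m * (3 + t)
  arith = solve-∀
  arith₂ : ∀ m t → 3 * m + m + m * (3 + t) ≡ m * (7 + t)
  arith₂ = solve-∀
  arith₃ : ∀ a b t → a * b * t ≡ a * t * b
  arith₃ = solve-∀

result-valiant : ∀ n k {T} (X : Samples n T) → result (valiant n k X) ≡ filter (survives? X) (allClauses n k)
result-valiant n k X = result-prune X (allClauses n k)

-- Correctness of the output

does-⇔ : ∀ {P Q : Set} → (P → Q) → (Q → P) → (P? : Dec P) (Q? : Dec Q) → does P? ≡ does Q?
does-⇔ p⇒q q⇒p (yes p) (yes q) = refl
does-⇔ p⇒q q⇒p (yes p) (no ¬q) = contradiction (p⇒q p) ¬q
does-⇔ p⇒q q⇒p (no ¬p) (yes q) = contradiction (q⇒p q) ¬p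
does-⇔ p⇒q q⇒p (no ¬p) (no ¬q) = refl

μ-cong : ∀ {n} {Φ Ψ : CNF n} → (∀ σ → σ ⊨ Φ → σ ⊨ Ψ) → (∀ σ → σ ⊨ Ψ → σ ⊨ Φ) → μ Φ ≗ μ Ψ
μ-cong {n} {Φ} {Ψ} Φ⇒Ψ Ψ⇒Φ σ =
  cong₂ (λ b m → if b then reciprocal m else _)
    (does-⇔ (Φ⇒Ψ σ) (Ψ⇒Φ σ) (σ ⊨? Φ) (σ ⊨? Ψ))
    (≤-antisym (count-mono (_⊨? Φ) (_⊨? Ψ) (assignments n) λ {σ} → Φ⇒Ψ σ)
               (count-mono (_⊨? Ψ) (_⊨? Φ) (assignments n) λ {σ} → Ψ⇒Φ σ))

Implied : ∀ {n} → CNF n → Clause n → Set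
Implied {n} Φ c = ∀ σ → σ ⊨ Φ → σ ⊨ᶜ c

-- The clauses of Φ are candidates and survive all samples, as these are solutions; so the output
-- implies Φ. Conversely Φ implies the output if every surviving candidate is implied. The output
-- may well have more clauses than Φ.
valiant-correct : ∀ {k d s n T} {Φ : CNF n} → IsKDS k d s Φ → (X : Samples n T) → VecAll.All (_⊨ Φ) X →
                  (∀ {c} → c ∈ allClauses n k → VecAll.All (_⊨ᶜ c) X → Implied Φ c) →
                  μ (result (valiant n k X)) ≗ μ Φ
valiant-correct {k = k} {n = n} {Φ = Φ} kds X X⊨Φ implied rewrite result-valiant n k X = μ-cong ⇒Φ Φ⇒
  where
  open IsKDS kds
  ⇒Φ : ∀ σ → σ ⊨ filter (survives? X) (allClauses n k) → σ ⊨ Φ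
  ⇒Φ σ sat = All.tabulate λ {c} c∈Φ → All.lookup sat (∈-filter⁺ (survives? X)
    (subst (λ k → c ∈ allClauses n k) (All.lookup width c∈Φ) (∈-allClauses c (All.lookup ordered c∈Φ)))
    (VecAll.map (λ σ⊨Φ → All.lookup σ⊨Φ c∈Φ) X⊨Φ))
  Φ⇒ : ∀ σ → σ ⊨ Φ → σ ⊨ filter (survives? X) (allClauses n k)
  Φ⇒ σ sat = All.tabulate λ c∈ → let c∈all , surv = ∈-filter⁻ (survives? X) c∈ in implied c∈all surv σ sat

-- Exact learning from samples

-- `fromℕ` divides by a gcd and is stuck on a variable; this is its normal form, on which numerator
-- and denominator compute.
integral : ℕ → ℚ
integral n = mkℚ (ℤ.+ n) 0 (coprime-sym (1-coprimeTo n))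

fromℕ≡integral : ∀ n → fromℕ n ≡ integral n
fromℕ≡integral n = ℚ.↥p/↧p≡p (integral n)

fromℕ-+ : ∀ m n → fromℕ (m + n) ≡ fromℕ m ℚ.+ fromℕ n
fromℕ-+ m n rewrite fromℕ≡integral m | fromℕ≡integral n =
  cong (_/ 1) (sym (cong₂ ℤ._+_ (ℤ.*-identityʳ (ℤ.+ m)) (ℤ.*-identityʳ (ℤ.+ n))))

fromℕ-* : ∀ m n → fromℕ (m * n) ≡ fromℕ m ℚ.* fromℕ n
fromℕ-* m n rewrite fromℕ≡integral m | fromℕ≡integral n = cong (_/ 1) (ℤ.pos-* m n)

fromℕ-^ : ∀ m n → fromℕ (m ^ n) ≡ fromℕ m ^ℚ n
fromℕ-^ m zero    = refl
fromℕ-^ m (suc n) = trans (fromℕ-* m (m ^ n)) (cong (fromℕ m ℚ.*_) (fromℕ-^ m n))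

fromℕ-mono-≤ : ∀ {m n} → m ≤ n → fromℕ m ℚ.≤ fromℕ n
fromℕ-mono-≤ {m} {n} m≤n rewrite fromℕ≡integral m | fromℕ≡integral n =
  ℚ.*≤* (ℤ.*-monoʳ-≤-nonNeg (ℤ.+ 1) (ℤ.+≤+ m≤n))

fromℕ-mono-< : ∀ {m n} → m < n → fromℕ m ℚ.< fromℕ n
fromℕ-mono-< {m} {n} m<n rewrite fromℕ≡integral m | fromℕ≡integral n =
  ℚ.*<* (ℤ.*-monoʳ-<-pos (ℤ.+ 1) (ℤ.+<+ m<n))

fromℕ-cancel-< : ∀ {m n} → fromℕ m ℚ.< fromℕ n → m < n
fromℕ-cancel-< m<n = ≰⇒> λ n≤m → ℚ.<-irrefl refl (ℚ.<-≤-trans m<n (fromℕ-mono-≤ n≤m))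

^ℚ-distribʳ-* : ∀ n p q → (p ℚ.* q) ^ℚ n ≡ p ^ℚ n ℚ.* q ^ℚ n
^ℚ-distribʳ-* zero    p q = refl
^ℚ-distribʳ-* (suc n) p q = trans (cong (p ℚ.* q ℚ.*_) (^ℚ-distribʳ-* n p q)) (arith p q (p ^ℚ n) (q ^ℚ n))
  where
  arith : ∀ a b c d → (a ℚ.* b) ℚ.* (c ℚ.* d) ≡ (a ℚ.* c) ℚ.* (b ℚ.* d)
  arith = solve 4 (λ a b c d → (a :* b) :* (c :* d) := (a :* c) :* (b :* d)) refl

1ℚ^ : ∀ n → 1ℚ ^ℚ n ≡ 1ℚ
1ℚ^ zero    = refl
1ℚ^ (suc n) = trans (ℚ.*-identityˡ _) (1ℚ^ n)

^ℚ-inverse : ∀ n {p q} → p ℚ.* q ≡ 1ℚ → p ^ℚ n ℚ.* q ^ℚ n ≡ 1ℚ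
^ℚ-inverse n {p} {q} pq≡1 = trans (sym (^ℚ-distribʳ-* n p q)) (trans (cong (_^ℚ n) pq≡1) (1ℚ^ n))

2^n½^n≡1 : ∀ n → fromℕ (2 ^ n) ℚ.* ½ ^ℚ n ≡ 1ℚ
2^n½^n≡1 n = trans (cong (ℚ._* ½ ^ℚ n) (fromℕ-^ 2 n)) (^ℚ-inverse n {fromℕ 2} {½} refl)

reciprocal-inverse : ∀ n → 1 ≤ n → fromℕ n ℚ.* reciprocal n ≡ 1ℚ
reciprocal-inverse (suc n) _ rewrite fromℕ≡integral (suc n) | ℚ.normalize-coprime {1} {n} (1-coprimeTo (suc n)) =
  ℚ.*-inverseʳ (integral (suc n))

0≤reciprocal : ∀ n → 0ℚ ℚ.≤ reciprocal n
0≤reciprocal zero    = ℚ.≤-refl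
0≤reciprocal (suc n) = ℚ.nonNegative⁻¹ (reciprocal (suc n)) {{ℚ.normalize-nonNeg 1 (suc n)}}

0≤p^n : ∀ {p} n → 0ℚ ℚ.≤ p → 0ℚ ℚ.≤ p ^ℚ n
0≤p^n zero    0≤p = ℚ.<⇒≤ (ℚ.positive⁻¹ 1ℚ)
0≤p^n {p} (suc n) 0≤p =
  ℚ.nonNegative⁻¹ _ {{ℚ.nonNeg*nonNeg⇒nonNeg p {{ℚ.nonNegative 0≤p}} (p ^ℚ n) {{ℚ.nonNegative (0≤p^n n 0≤p)}}}}

count-tuples : ∀ {A : Set} {P : A → Set} (P? : Decidable P) xs T →
               count (VecAll.all? P?) (tuples xs T) ≡ count P? xs ^ T
count-tuples P? xs zero    = refl
count-tuples {P = P} P? xs (suc T) = trans (product xs) (cong (count P? xs *_) (count-tuples P? xs T))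
  where
  open ≡-Reasoning
  Xs = tuples xs T
  product : ∀ ys → count (VecAll.all? P?) (cartesianProductWith _∷_ ys Xs) ≡ count P? ys * count (VecAll.all? P?) Xs
  product [] = refl
  product (y ∷ ys) = begin
    count (VecAll.all? P?) (map (y ∷_) Xs ++ cartesianProductWith _∷_ ys Xs)
      ≡⟨ count-++ (VecAll.all? P?) (map (y ∷_) Xs) _ ⟩
    count (VecAll.all? P?) (map (y ∷_) Xs) + count (VecAll.all? P?) (cartesianProductWith _∷_ ys Xs)
      ≡⟨ cong₂ _+_ (count-map (VecAll.all? P?) (y ∷_) Xs) (product ys) ⟩
    count (VecAll.all? P? ∘ (y ∷_)) Xs + count P? ys * count (VecAll.all? P?) Xs
      ≡⟨ first ⟩
    count P? (y ∷ ys) * count (VecAll.all? P?) Xs ∎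
    where
    first : count (VecAll.all? P? ∘ (y ∷_)) Xs + count P? ys * count (VecAll.all? P?) Xs ≡ count P? (y ∷ ys) * count (VecAll.all? P?) Xs
    first with P? y
    ... | yes p = cong (_+ count P? ys * count (VecAll.all? P?) Xs) (≤-antisym
      (count-mono _ (VecAll.all? P?) Xs VecAll.tail)
      (count-mono (VecAll.all? P?) _ Xs (p VecAll.∷_)))
    ... | no ¬p = cong (_+ count P? ys * count (VecAll.all? P?) Xs) (count-∅ _ Xs (¬p ∘ VecAll.head))

filter-∷ : ∀ {A : Set} {P : A → Set} (P? : Decidable P) x xs →
           filter P? (x ∷ xs) ≡ (if does (P? x) then x ∷ filter P? xs else filter P? xs)
filter-∷ P? x xs with does (P? x)
... | true  = refl
... | false = refl

count-∷ : ∀ {A : Set} {P : A → Set} (P? : Decidable P) x xs →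
          count P? (x ∷ xs) ≡ (if does (P? x) then suc (count P? xs) else count P? xs)
count-∷ P? x xs with does (P? x)
... | true  = refl
... | false = refl

-- A sample tuple has weight ρ ^ T if it consists of solutions and 0 otherwise. Two-valued weights
-- of this kind reduce a probability to a count.
sum-filter : ∀ {A : Set} {P Q : A → Set} (P? : Decidable P) (Q? : Decidable Q) (w : A → ℚ) c →
             (∀ x → P x → w x ≡ c) → (∀ x → ¬ P x → w x ≡ 0ℚ) → ∀ xs →
             sumℚ (map w (filter Q? xs)) ≡ fromℕ (count (λ x → P? x ×-dec Q? x) xs) ℚ.* c
sum-filter P? Q? w c w≡c w≡0 [] = sym (ℚ.*-zeroˡ c)
sum-filter {P = P} {Q} P? Q? w c w≡c w≡0 (x ∷ xs) = trans (cong (sumℚ ∘ map w) (filter-∷ Q? x xs))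
  (trans (step (P? x) (Q? x) (sum-filter P? Q? w c w≡c w≡0 xs))
         (cong (λ m → fromℕ m ℚ.* c) (sym (count-∷ (λ x → P? x ×-dec Q? x) x xs))))
  where
  distrib : ∀ a b → a ℚ.+ b ℚ.* a ≡ (1ℚ ℚ.+ b) ℚ.* a
  distrib = solve 2 (λ a b → a :+ b :* a := (con 1ℚ :+ b) :* a) refl
  step : ∀ {m ys} (p? : Dec (P x)) (q? : Dec (Q x)) → sumℚ (map w ys) ≡ fromℕ m ℚ.* c →
         sumℚ (map w (if does q? then x ∷ ys else ys)) ≡ fromℕ (if does (p? ×-dec q?) then suc m else m) ℚ.* c
  step (no _)   (no _)  eq = eq
  step (yes _)  (no _)  eq = eq
  step (no ¬p)  (yes _) eq = trans (cong₂ ℚ._+_ (w≡0 x ¬p) eq) (ℚ.+-identityˡ _)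
  step {m} (yes p) (yes _) eq =
    trans (cong₂ ℚ._+_ (w≡c x p) eq) (trans (distrib c (fromℕ m)) (cong (ℚ._* c) (sym (fromℕ-+ 1 m))))

module _ {n} (Φ : CNF n) where

  weight : ∀ {T} → Samples n T → ℚ
  weight = Vec.foldr′ (λ σ p → μ Φ σ ℚ.* p) 1ℚ

  ρ : ℚ
  ρ = reciprocal (N (_⊨? Φ))

  weight-solutions : ∀ {T} (X : Samples n T) → VecAll.All (_⊨ Φ) X → weight X ≡ ρ ^ℚ T
  weight-solutions []      VecAll.[]            = refl
  weight-solutions (σ ∷ X) (σ⊨Φ VecAll.∷ X⊨Φ) with σ ⊨? Φ
  ... | yes _   = cong (ρ ℚ.*_) (weight-solutions X X⊨Φ)
  ... | no σ⊭Φ = contradiction σ⊨Φ σ⊭Φ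

  weight-nonsolutions : ∀ {T} (X : Samples n T) → ¬ VecAll.All (_⊨ Φ) X → weight X ≡ 0ℚ
  weight-nonsolutions []      ¬all = contradiction VecAll.[] ¬all
  weight-nonsolutions (σ ∷ X) ¬all with σ ⊨? Φ
  ... | yes σ⊨Φ = trans (cong (ρ ℚ.*_) (weight-nonsolutions X (¬all ∘ (σ⊨Φ VecAll.∷_)))) (ℚ.*-zeroʳ ρ)
  ... | no _     = ℚ.*-zeroˡ (weight X)

  Pr-count : ∀ T {E : Samples n T → Set} (E? : Decidable E) →
             Pr Φ T E? ≡ fromℕ (count (λ X → VecAll.all? (_⊨? Φ) X ×-dec E? X) (tuples (assignments n) T)) ℚ.* ρ ^ℚ T
  Pr-count T E? = sum-filter (VecAll.all? (_⊨? Φ)) E? weight (ρ ^ℚ T) weight-solutions weight-nonsolutions (tuples (assignments n) T)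

-- Decay of the survival probability with the number of samples

bernoulli : ∀ a b → a ^ suc b + suc b * a ^ b ≤ suc a ^ suc b
bernoulli a zero    = ≤-reflexive (arith a)
  where
  arith : ∀ a → a * 1 + 1 ≡ suc a * 1
  arith = solve-∀
bernoulli a (suc b) = begin
  a * (a * x) + suc (suc b) * (a * x)              ≤⟨ m≤m+n _ (suc b * x) ⟩
  a * (a * x) + suc (suc b) * (a * x) + suc b * x  ≡⟨ arith a b x ⟩
  suc a * (a * x + suc b * x)                      ≤⟨ *-monoʳ-≤ (suc a) (bernoulli a b) ⟩
  suc a * suc a ^ suc b                            ∎
  where
  open ≤-Reasoning
  x = a ^ b
  arith : ∀ a b x → a * (a * x) + suc (suc b) * (a * x) + suc b * x ≡ suc a * (a * x + suc b * x)
  arith = solve-∀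

-- That is, (1 - 1/(a + 1)) ^ (a + 1) ≤ 1/2, from the first two terms of the binomial expansion.
2a^[1+a]≤ : ∀ a → 2 * a ^ suc a ≤ suc a ^ suc a
2a^[1+a]≤ a = begin
  a ^ suc a + (a ^ suc a + 0)   ≡⟨ cong (a ^ suc a +_) (+-identityʳ (a ^ suc a)) ⟩
  a ^ suc a + a * a ^ a         ≤⟨ +-monoʳ-≤ (a ^ suc a) (*-monoˡ-≤ (a ^ a) (n≤1+n a)) ⟩
  a ^ suc a + suc a * a ^ a     ≤⟨ bernoulli a a ⟩
  suc a ^ suc a                 ∎
  where open ≤-Reasoning

-- The ratio x / y is at most a / (a + 1), so every batch of a + 1 factors halves its power, and
-- there are j batches.
power-decay : ∀ a {x y} j → suc a * x ≤ a * y → 2 ^ j * x ^ (j * suc a) ≤ y ^ (j * suc a)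
power-decay a {x} {y} j ax≤ = begin
  2 ^ j * x ^ (j * suc a)       ≡⟨ cong (λ e → 2 ^ j * x ^ e) (*-comm j (suc a)) ⟩
  2 ^ j * x ^ (suc a * j)       ≡⟨ cong (2 ^ j *_) (^-*-assoc x (suc a) j) ⟨
  2 ^ j * (x ^ suc a) ^ j       ≡⟨ ^-distribʳ-* j 2 (x ^ suc a) ⟨
  (2 * x ^ suc a) ^ j           ≤⟨ ^-monoˡ-≤ j halved ⟩
  (y ^ suc a) ^ j               ≡⟨ ^-*-assoc y (suc a) j ⟩
  y ^ (suc a * j)               ≡⟨ cong (y ^_) (*-comm (suc a) j) ⟩
  y ^ (j * suc a)               ∎
  where
  open ≤-Reasoning
  instance
    nz : NonZero (suc a ^ suc a)
    nz = m^n≢0 (suc a) (suc a)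
  halved : 2 * x ^ suc a ≤ y ^ suc a
  halved = *-cancelˡ-≤ (suc a ^ suc a) (begin
    suc a ^ suc a * (2 * x ^ suc a)   ≡⟨ arith (suc a ^ suc a) (x ^ suc a) ⟩
    2 * (suc a ^ suc a * x ^ suc a)   ≡⟨ cong (2 *_) (^-distribʳ-* (suc a) (suc a) x) ⟨
    2 * (suc a * x) ^ suc a           ≤⟨ *-monoʳ-≤ 2 (^-monoˡ-≤ (suc a) ax≤) ⟩
    2 * (a * y) ^ suc a               ≡⟨ cong (2 *_) (^-distribʳ-* (suc a) a y) ⟩
    2 * (a ^ suc a * y ^ suc a)       ≡⟨ *-assoc 2 (a ^ suc a) (y ^ suc a) ⟨
    2 * a ^ suc a * y ^ suc a         ≤⟨ *-monoˡ-≤ (y ^ suc a) (2a^[1+a]≤ a) ⟩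
    suc a ^ suc a * y ^ suc a         ∎)
    where
    arith : ∀ a b → a * (2 * b) ≡ 2 * (a * b)
    arith = solve-∀

module Learning {r k d s n t m} {Φ : CNF n} (kds : IsKDS k d s Φ)
  (1≤d : 1 ≤ d) (4kd≤2^r : 4 * (suc k * d) ≤ 2 ^ r) (t+r≡1+k : t + r ≡ suc k) (1≤t : 1 ≤ t)
  (k<mt : k + triangle m * s < m * t)
  (a : ℕ) (a-large : 2 ^ (suc d * (m * k)) ≤ suc a)
  (i j : ℕ) (j-large : 2 ^ i * length (allClauses n k) ≤ 2 ^ j) where

  -- Each batch of a + 1 samples halves the probability that a given refuted clause survives; j
  -- batches bring it down to 2 ^ -j.
  T : ℕ
  T = j * suc a

  learns? : Decidable (λ (X : Samples n T) → μ (result (valiant n k X)) ≗ μ Φ)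
  learns? X = result (valiant n k X) ≗μ? Φ

  Refuted : Clause n → Set
  Refuted c = Any (λ σ → σ ⊨ Φ × ¬ σ ⊨ᶜ c) (assignments n)

  refuted? : Decidable Refuted
  refuted? c = any? (violated? (_⊨? Φ) c) (assignments n)

  refuted : CNF n
  refuted = filter refuted? (allClauses n k)

  Xs = tuples (assignments n) T
  M  = N (_⊨? Φ)
  solutions? = VecAll.all? {n = T} (_⊨? Φ)

  -- At least a fraction 1/(a + 1) of the solutions violates such a clause, so at most a/(a + 1) of
  -- them satisfies it. The double negation is the form that `count-union` asks for when the desired
  -- event is non-survival.
  refuted-rarely-survive : ∀ {c} → c ∈ refuted →
    2 ^ j * count (λ X → solutions? X ×-dec ¬? (¬? (survives? X c))) Xs ≤ M ^ T
  refuted-rarely-survive {c} c∈ = begin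
    2 ^ j * count (λ X → solutions? X ×-dec ¬? (¬? (survives? X c))) Xs
      ≤⟨ *-monoʳ-≤ (2 ^ j) (count-mono (λ X → solutions? X ×-dec ¬? (¬? (survives? X c))) (VecAll.all? both?) Xs
           λ {X} (sat , ¬¬surv) → VecAll.zip (sat , decidable-stable (survives? X c) ¬¬surv)) ⟩
    2 ^ j * count (VecAll.all? both?) Xs  ≡⟨ cong (2 ^ j *_) (count-tuples both? (assignments n) T) ⟩
    2 ^ j * N both? ^ T                ≤⟨ power-decay a j decay ⟩
    M ^ T                              ∎
    where
    open ≤-Reasoning
    both? : Decidable (λ σ → σ ⊨ Φ × σ ⊨ᶜ c)
    both? σ = σ ⊨? Φ ×-dec σ ⊨ᶜ? c
    V = N (violated? (_⊨? Φ) c)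
    lower : M ≤ suc a * V
    lower with find (proj₂ (∈-filter⁻ refuted? {xs = allClauses n k} c∈))
    ... | τ , _ , τ⊨Φ , τ⊭c = ≤-trans
      (Pinned.N-violated-lower {t = t} {m = m} kds 1≤d 4kd≤2^r t+r≡1+k 1≤t k<mt {τ} τ⊨Φ c
        (All.lookup (allClauses-width n k) (proj₁ (∈-filter⁻ refuted? c∈))) τ⊭c)
      (*-monoˡ-≤ V a-large)
    decay : suc a * N both? ≤ a * M
    decay = +-cancelˡ-≤ M _ _ (begin
      M + suc a * N both?           ≤⟨ +-monoˡ-≤ (suc a * N both?) lower ⟩
      suc a * V + suc a * N both?   ≡⟨ *-distribˡ-+ (suc a) V (N both?) ⟨
      suc a * (V + N both?)         ≤⟨ *-monoʳ-≤ (suc a) (count-disjoint (violated? (_⊨? Φ) c) both? (_⊨? Φ) (assignments n)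
                                         proj₁ proj₁ λ (_ , ¬c) (_ , sat) → ¬c sat) ⟩
      suc a * M                     ∎)

  success? : Decidable (λ X → VecAll.All (_⊨ Φ) X × μ (result (valiant n k X)) ≗ μ Φ)
  success? X = solutions? X ×-dec learns? X

  -- Each refuted candidate survives with probability at most 2 ^ -j, and by `j-large` the union
  -- over all of them has probability at most 2 ^ -i.
  success-count : 2 ^ i * M ^ T ≤ 2 ^ i * count success? Xs + M ^ T
  success-count = *-cancelˡ-≤ (2 ^ j) (begin
    2 ^ j * (2 ^ i * M ^ T)                          ≡⟨ swap (2 ^ j) (2 ^ i) (M ^ T) ⟩
    2 ^ i * (2 ^ j * M ^ T)                          ≤⟨ *-monoʳ-≤ (2 ^ i) bound ⟩
    2 ^ i * (2 ^ j * count success? Xs + ℓ * M ^ T)  ≡⟨ arith (2 ^ i) (2 ^ j) (count success? Xs) ℓ (M ^ T) ⟩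
    2 ^ j * (2 ^ i * count success? Xs) + 2 ^ i * ℓ * M ^ T  ≤⟨ +-monoʳ-≤ _ (*-monoˡ-≤ (M ^ T) j-large) ⟩
    2 ^ j * (2 ^ i * count success? Xs) + 2 ^ j * M ^ T      ≡⟨ *-distribˡ-+ (2 ^ j) _ _ ⟨
    2 ^ j * (2 ^ i * count success? Xs + M ^ T)      ∎)
    where
    open ≤-Reasoning
    ℓ = length (allClauses n k)
    instance
      nz : NonZero (2 ^ j)
      nz = m^n≢0 2 j
    swap : ∀ a b c → a * (b * c) ≡ b * (a * c)
    swap = solve-∀
    arith : ∀ a b c l z → a * (b * c + l * z) ≡ b * (a * c) + a * l * z
    arith = solve-∀
    succeed : ∀ {X} → VecAll.All (_⊨ Φ) X × All (λ c → ¬ VecAll.All (_⊨ᶜ c) X) refuted →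
              VecAll.All (_⊨ Φ) X × μ (result (valiant n k X)) ≗ μ Φ
    succeed {X} (sat , none) = sat , valiant-correct kds X sat λ {c} c∈ surv σ σ⊨Φ →
      decidable-stable (σ ⊨ᶜ? c) λ σ⊭c →
        All.lookup none (∈-filter⁺ refuted? c∈ (lose (∈-assignments σ) (σ⊨Φ , σ⊭c))) surv
    bound : 2 ^ j * M ^ T ≤ 2 ^ j * count success? Xs + ℓ * M ^ T
    bound = begin
      2 ^ j * M ^ T                   ≡⟨ cong (2 ^ j *_) (count-tuples (_⊨? Φ) (assignments n) T) ⟨
      2 ^ j * count solutions? Xs     ≤⟨ count-union solutions? (λ X c → ¬? (survives? X c)) Xs (2 ^ j) refuted refuted-rarely-survive ⟩
      2 ^ j * count (λ X → solutions? X ×-dec all? (λ c → ¬? (survives? X c)) refuted) Xs + length refuted * M ^ T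
        ≤⟨ +-mono-≤ (*-monoʳ-≤ (2 ^ j) (count-mono _ success? Xs succeed)) (*-monoˡ-≤ (M ^ T) (List.length-filter refuted? (allClauses n k))) ⟩
      2 ^ j * count success? Xs + ℓ * M ^ T ∎

  1≤Pr+½^i : 1ℚ ℚ.≤ Pr Φ T learns? ℚ.+ ½ ^ℚ i
  1≤Pr+½^i = begin
    1ℚ                                      ≡⟨ sym (trans (cong₂ ℚ._*_ M^Tρ^T (2^n½^n≡1 i)) (ℚ.*-identityˡ 1ℚ)) ⟩
    (fromℕ (M ^ T) ℚ.* x) ℚ.* (fromℕ (2 ^ i) ℚ.* y)  ≡⟨ arith₁ (fromℕ (M ^ T)) x (fromℕ (2 ^ i)) y ⟩
    (fromℕ (2 ^ i) ℚ.* fromℕ (M ^ T)) ℚ.* (x ℚ.* y)  ≡⟨ cong (ℚ._* (x ℚ.* y)) (fromℕ-* (2 ^ i) (M ^ T)) ⟨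
    fromℕ (2 ^ i * M ^ T) ℚ.* (x ℚ.* y)              ≤⟨ ℚ.*-monoʳ-≤-nonNeg (x ℚ.* y) (fromℕ-mono-≤ success-count) ⟩
    fromℕ (2 ^ i * G + M ^ T) ℚ.* (x ℚ.* y)          ≡⟨ cong (ℚ._* (x ℚ.* y)) (trans (fromℕ-+ (2 ^ i * G) (M ^ T)) (cong (ℚ._+ fromℕ (M ^ T)) (fromℕ-* (2 ^ i) G))) ⟩
    (fromℕ (2 ^ i) ℚ.* fromℕ G ℚ.+ fromℕ (M ^ T)) ℚ.* (x ℚ.* y) ≡⟨ arith₂ (fromℕ (2 ^ i)) (fromℕ G) (fromℕ (M ^ T)) x y ⟩
    (fromℕ (2 ^ i) ℚ.* y) ℚ.* (fromℕ G ℚ.* x) ℚ.+ (fromℕ (M ^ T) ℚ.* x) ℚ.* y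
      ≡⟨ cong₂ ℚ._+_ (trans (cong (ℚ._* (fromℕ G ℚ.* x)) (2^n½^n≡1 i)) (ℚ.*-identityˡ (fromℕ G ℚ.* x))) (trans (cong (ℚ._* y) M^Tρ^T) (ℚ.*-identityˡ y)) ⟩
    fromℕ G ℚ.* x ℚ.+ y                              ≡⟨ cong (ℚ._+ y) (Pr-count Φ T learns?) ⟨
    Pr Φ T learns? ℚ.+ y                             ∎
    where
    open ℚ.≤-Reasoning
    G = count success? Xs
    x = ρ Φ ^ℚ T
    y = ½ ^ℚ i
    r≤k : r ≤ k
    r≤k = +-cancelˡ-≤ 1 _ _ (≤-trans (+-monoˡ-≤ r 1≤t) (≤-reflexive t+r≡1+k))
    instance
      xy≥0 : ℚ.NonNegative (x ℚ.* y)
      xy≥0 = ℚ.nonNeg*nonNeg⇒nonNeg x {{ℚ.nonNegative (0≤p^n T (0≤reciprocal M))}}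
                                    y {{ℚ.nonNegative (0≤p^n i (ℚ.<⇒≤ (ℚ.positive⁻¹ ½)))}}
    M^Tρ^T : fromℕ (M ^ T) ℚ.* x ≡ 1ℚ
    M^Tρ^T = trans (cong (ℚ._* x) (fromℕ-^ M T))
      (^ℚ-inverse T {fromℕ M} {ρ Φ} (reciprocal-inverse M (satisfiable kds 1≤d 4kd≤2^r r≤k)))
    arith₁ : ∀ m x p y → (m ℚ.* x) ℚ.* (p ℚ.* y) ≡ (p ℚ.* m) ℚ.* (x ℚ.* y)
    arith₁ = solve 4 (λ m x p y → (m :* x) :* (p :* y) := (p :* m) :* (x :* y)) refl
    arith₂ : ∀ p g m x y → (p ℚ.* g ℚ.+ m) ℚ.* (x ℚ.* y) ≡ (p ℚ.* y) ℚ.* (g ℚ.* x) ℚ.+ (m ℚ.* x) ℚ.* y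
    arith₂ = solve 5 (λ p g m x y → (p :* g :+ m) :* (x :* y) := (p :* y) :* (g :* x) :+ (m :* x) :* y) refl

-- Rational arithmetic

0≤p*q : ∀ {p q} → 0ℚ ℚ.≤ p → 0ℚ ℚ.≤ q → 0ℚ ℚ.≤ p ℚ.* q
0≤p*q {p} {q} 0≤p 0≤q = ℚ.nonNegative⁻¹ _ {{ℚ.nonNeg*nonNeg⇒nonNeg p {{ℚ.nonNegative 0≤p}} q {{ℚ.nonNegative 0≤q}}}}

0<p*q : ∀ {p q} → 0ℚ ℚ.< p → 0ℚ ℚ.< q → 0ℚ ℚ.< p ℚ.* q
0<p*q {p} {q} 0<p 0<q = ℚ.positive⁻¹ _ {{ℚ.pos*pos⇒pos p {{ℚ.positive 0<p}} q {{ℚ.positive 0<q}}}}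

0≤p+q : ∀ {p q} → 0ℚ ℚ.≤ p → 0ℚ ℚ.≤ q → 0ℚ ℚ.≤ p ℚ.+ q
0≤p+q = ℚ.+-mono-≤

0<p+q : ∀ {p q} → 0ℚ ℚ.< p → 0ℚ ℚ.≤ q → 0ℚ ℚ.< p ℚ.+ q
0<p+q = ℚ.+-mono-<-≤

-- The pattern for the inequalities below: exhibit the difference as an expression that is visibly
-- nonnegative, and leave the identity to the ring solver.
p≤p+q : ∀ {p q r} → 0ℚ ℚ.≤ q → r ≡ p ℚ.+ q → p ℚ.≤ r
p≤p+q {p} 0≤q refl = ℚ.≤-trans (ℚ.≤-reflexive (sym (ℚ.+-identityʳ p))) (ℚ.+-monoʳ-≤ p 0≤q)

p<p+q : ∀ {p q r} → 0ℚ ℚ.< q → r ≡ p ℚ.+ q → p ℚ.< r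
p<p+q {p} 0<q refl = ℚ.≤-<-trans (ℚ.≤-reflexive (sym (ℚ.+-identityʳ p))) (ℚ.+-monoʳ-< p 0<q)

0≤q-p : ∀ {p q} → p ℚ.≤ q → 0ℚ ℚ.≤ q ℚ.- p
0≤q-p {p} p≤q = ℚ.≤-trans (ℚ.≤-reflexive (sym (ℚ.+-inverseʳ p))) (ℚ.+-monoˡ-≤ (ℚ.- p) p≤q)

0<q-p : ∀ {p q} → p ℚ.< q → 0ℚ ℚ.< q ℚ.- p
0<q-p {p} p<q = ℚ.≤-<-trans (ℚ.≤-reflexive (sym (ℚ.+-inverseʳ p))) (ℚ.+-monoˡ-< (ℚ.- p) p<q)

0≤fromℕ : ∀ n → 0ℚ ℚ.≤ fromℕ n
0≤fromℕ n = fromℕ-mono-≤ {0} {n} z≤n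

inverse : ∀ {p} → 0ℚ ℚ.< p → ∃[ q ] 0ℚ ℚ.< q × p ℚ.* q ≡ 1ℚ
inverse {p} 0<p = ℚ.1/ p , ℚ.positive⁻¹ _ {{ℚ.1/pos⇒pos p}} , ℚ.*-inverseʳ p
  where
  instance
    p>0 : ℚ.Positive p
    p>0 = ℚ.positive 0<p
    p≢0 : ℚ.NonZero p
    p≢0 = ℚ.pos⇒nonZero p

archimedean : ∀ {q} → 0ℚ ℚ.< q → ∃[ M ] 1ℚ ℚ.≤ fromℕ M ℚ.* q
archimedean {q} 0<q = M , (begin
  1ℚ                               ≡⟨ reciprocal-inverse M (s≤s z≤n) ⟨
  fromℕ M ℚ.* reciprocal M         ≤⟨ ℚ.*-monoˡ-≤-nonNeg (fromℕ M) {{ℚ.nonNegative (0≤fromℕ M)}} 1/M≤q ⟩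
  fromℕ M ℚ.* q                    ∎)
  where
  open ℚ.≤-Reasoning
  -- A positive fraction has numerator at least 1, so it is at least the reciprocal of its
  -- denominator.
  M = ↧ₙ q
  1/M≤ : ∀ q → 0ℚ ℚ.< q → reciprocal (↧ₙ q) ℚ.≤ q
  1/M≤ (mkℚ (ℤ.+ suc a) b-1 cop) _ =
    ℚ.≤-trans (ℚ.≤-reflexive (ℚ.normalize-coprime (1-coprimeTo (suc b-1))))
      (ℚ.*≤* (ℤ.*-monoʳ-≤-nonNeg (ℤ.+ suc b-1) (ℤ.+≤+ (s≤s (z≤n {a})))))
  1/M≤ (mkℚ (ℤ.+ zero) b-1 cop) (ℚ.*<* (ℤ.+<+ ()))
  1/M≤ (mkℚ ℤ.-[1+ a ] b-1 cop) (ℚ.*<* ())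
  1/M≤q : reciprocal M ℚ.≤ q
  1/M≤q = 1/M≤ q 0<q

-- The o(k) term

isqrt : ℕ → ℕ
isqrt zero    = 0
isqrt (suc k) with suc (isqrt k) * suc (isqrt k) ≤? suc k
... | yes _ = suc (isqrt k)
... | no _  = isqrt k

isqrt²≤ : ∀ k → isqrt k * isqrt k ≤ k
isqrt²≤ zero    = z≤n
isqrt²≤ (suc k) with suc (isqrt k) * suc (isqrt k) ≤? suc k
... | yes ≤k = ≤k
... | no _   = m≤n⇒m≤1+n (isqrt²≤ k)

<1+isqrt² : ∀ k → k < suc (isqrt k) * suc (isqrt k)
<1+isqrt² zero    = s≤s z≤n
<1+isqrt² (suc k) with suc (isqrt k) * suc (isqrt k) ≤? suc k
... | yes _  = ≤-<-trans (<1+isqrt² k) (*-mono-< {suc (isqrt k)} ≤-refl ≤-refl)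
... | no ≰k  = ≰⇒> ≰k

isqrt-littleO : LittleO isqrt
isqrt-littleO m = m * m , λ k m²≤k → small k m²≤k
  where
  small : ∀ k → m * m ≤ k → m * isqrt k ≤ k
  small k m²≤k with m ≤? isqrt k
  ... | yes m≤f = ≤-trans (*-monoˡ-≤ (isqrt k) m≤f) (isqrt²≤ k)
  ... | no m≰f  = ≤-trans (*-monoʳ-≤ m (<⇒≤ (≰⇒> m≰f))) m²≤k

n≤2^n : ∀ n → n ≤ 2 ^ n
n≤2^n zero    = z≤n
n≤2^n (suc n) = begin
  1 + n               ≤⟨ +-mono-≤ (m^n>0 2 n) (n≤2^n n) ⟩
  2 ^ n + 2 ^ n       ≡⟨ cong (λ z → 2 ^ n + z) (+-identityʳ (2 ^ n)) ⟨
  2 ^ n + (2 ^ n + 0) ∎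
  where open ≤-Reasoning

-- The part of `M * x + 3` in `log-slack` that does not involve q.
slack : ℕ → ℕ
slack M = 2 * M + 8 * (M * M) + 3

-- x bounds log (4 (k + 1)), and M ≥ 1/(1 - θ) is the factor by which its cost grows in C log d.
-- With f = `isqrt k` and q = ⌊f / 4M⌋, f + 1 ≤ (q + 1) 4M ≤ 2 ^ (q + 4M), so log (f + 1) grows with
-- slope only 1/(4M) in f. The 3 pays for three roundings by 1: two in the strict lower cuts of the
-- error terms and one in `L-C-log`.
log-slack : ∀ M → 1 ≤ M → ∀ k → ∃[ x ] 4 * suc k ≤ 2 ^ x × M * x + 3 ≤ isqrt k + slack M
log-slack M@(suc _) _ k = x , 4k≤2^x , Mx≤
  where
  open ≤-Reasoning
  f = isqrt k
  q = f ℕ./ (4 * M)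
  y = 4 * M + q
  x = 2 + (y + y)
  f<2^y : suc f ≤ 2 ^ y
  f<2^y = begin
    suc f                             ≡⟨ cong suc (ℕ.m≡m%n+[m/n]*n f (4 * M)) ⟩
    suc (f ℕ.% (4 * M)) + q * (4 * M) ≤⟨ +-monoˡ-≤ (q * (4 * M)) (ℕ.m%n<n f (4 * M)) ⟩
    suc q * (4 * M)                   ≤⟨ *-mono-≤ (1+q≤2^q q) (n≤2^n (4 * M)) ⟩
    2 ^ q * 2 ^ (4 * M)               ≡⟨ *-comm (2 ^ q) (2 ^ (4 * M)) ⟩
    2 ^ (4 * M) * 2 ^ q               ≡⟨ ^-distribˡ-+-* 2 (4 * M) q ⟨
    2 ^ y                             ∎
    where
    1+q≤2^q : ∀ q → suc q ≤ 2 ^ q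
    1+q≤2^q zero    = ≤-refl
    1+q≤2^q (suc q) = ≤-trans (s≤s (1+q≤2^q q)) (≤-trans (+-monoˡ-≤ (2 ^ q) (m^n>0 2 q)) (≤-reflexive (cong (λ z → 2 ^ q + z) (sym (+-identityʳ (2 ^ q))))))
  4k≤2^x : 4 * suc k ≤ 2 ^ x
  4k≤2^x = begin
    4 * suc k             ≤⟨ *-monoʳ-≤ 4 (<1+isqrt² k) ⟩
    4 * (suc f * suc f)   ≤⟨ *-monoʳ-≤ 4 (*-mono-≤ f<2^y f<2^y) ⟩
    4 * (2 ^ y * 2 ^ y)   ≡⟨ cong (4 *_) (^-distribˡ-+-* 2 y y) ⟨
    4 * 2 ^ (y + y)       ≡⟨ ^-distribˡ-+-* 2 2 (y + y) ⟨
    2 ^ x                 ∎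
  Mx≤ : M * x + 3 ≤ f + slack M
  Mx≤ = begin
    M * x + 3                                ≡⟨ arith M q ⟩
    2 * (q * M) + slack M                    ≤⟨ +-monoˡ-≤ (slack M) (*-monoˡ-≤ (q * M) {2} {4} (s≤s (s≤s z≤n))) ⟩
    4 * (q * M) + slack M                    ≡⟨ cong (_+ slack M) (arith₂ M q) ⟩
    q * (4 * M) + slack M                    ≤⟨ +-monoˡ-≤ (slack M) (ℕ.m/n*n≤m f (4 * M)) ⟩
    f + slack M                              ∎
    where
    arith : ∀ M q → M * (2 + (4 * M + q + (4 * M + q))) + 3 ≡ 2 * (q * M) + (2 * M + 8 * (M * M) + 3)
    arith = solve-∀
    arith₂ : ∀ M q → 4 * (q * M) ≡ q * (4 * M)
    arith₂ = solve-∀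

-- The constant C

-- Move x up by gap / (1 + c); dividing by 1 + c instead of c covers c = 0.
widen : ∀ {c x y} → 0ℚ ℚ.≤ c → c ℚ.* x ℚ.< y → ∃[ b ] x ℚ.< b × c ℚ.* b ℚ.< y
widen {c} {x} {y} 0≤c cx<y = x ℚ.+ gap ℚ.* e , p<p+q 0<gap*e refl , p<p+q 0<gap*e (begin
  y                                          ≡⟨ arith₁ y (c ℚ.* x) ⟩
  c ℚ.* x ℚ.+ gap ℚ.* 1ℚ                     ≡⟨ cong (λ u → c ℚ.* x ℚ.+ gap ℚ.* u) 1+c*e≡1 ⟨
  c ℚ.* x ℚ.+ gap ℚ.* ((1ℚ ℚ.+ c) ℚ.* e)     ≡⟨ arith₂ c x gap e ⟩
  c ℚ.* (x ℚ.+ gap ℚ.* e) ℚ.+ gap ℚ.* e      ∎)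
  where
  open ≡-Reasoning
  gap = y ℚ.- c ℚ.* x
  inv : ∃[ e ] 0ℚ ℚ.< e × (1ℚ ℚ.+ c) ℚ.* e ≡ 1ℚ
  inv = inverse (0<p+q (ℚ.positive⁻¹ 1ℚ) 0≤c)
  e = proj₁ inv
  1+c*e≡1 = proj₂ (proj₂ inv)
  0<gap*e : 0ℚ ℚ.< gap ℚ.* e
  0<gap*e = 0<p*q (0<q-p cx<y) (proj₁ (proj₂ inv))
  arith₁ : ∀ y z → y ≡ z ℚ.+ (y ℚ.- z) ℚ.* 1ℚ
  arith₁ = solve 2 (λ y z → y := z :+ (y :- z) :* con 1ℚ) refl
  arith₂ : ∀ c x g e → c ℚ.* x ℚ.+ g ℚ.* ((1ℚ ℚ.+ c) ℚ.* e) ≡ c ℚ.* (x ℚ.+ g ℚ.* e) ℚ.+ g ℚ.* e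
  arith₂ = solve 4 (λ c x g e → c :* x :+ g :* ((con 1ℚ :+ c) :* e) := c :* (x :+ g :* e) :+ g :* e) refl

L-quotient : ∀ n {y c x} → 0ℚ ℚ.≤ c → c ℚ.* x ℚ.< fromℕ n → (∀ {b} → x ℚ.< b → U y b) → L (⟦ n ⟧ ÷ᴿ y) c
L-quotient n {y} {c} {x} 0≤c cx<n U-y = c ℚ.* proj₁ w , proj₁ w , proj₂ (proj₂ w) , U-y (proj₁ (proj₂ w)) , ℚ.≤-refl
  where
  w : ∃[ b ] x ℚ.< b × c ℚ.* b ℚ.< fromℕ n
  w = widen 0≤c cx<n

U-1- : ∀ {y θ} → L y θ → ∀ {b} → 1ℚ ℚ.- θ ℚ.< b → U (⟦ 1 ⟧ -ᴿ y) b
U-1- {y} {θ} L-θ {b} 1-θ<b = b ℚ.+ θ , θ , p<p+q (0<q-p 1-θ<b) (arith b θ) , L-θ , ℚ.≤-reflexive (arith₂ b θ)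
  where
  arith : ∀ b t → b ℚ.+ t ≡ 1ℚ ℚ.+ (b ℚ.- (1ℚ ℚ.- t))
  arith = solve 2 (λ b t → b :+ t := con 1ℚ :+ (b :- (con 1ℚ :- t))) refl
  arith₂ : ∀ b t → b ℚ.+ t ℚ.- t ≡ b
  arith₂ = solve 2 (λ b t → b :+ t :- t := b) refl

0≤p² : ∀ p → 0ℚ ℚ.≤ p ℚ.* p
0≤p² p = [ (λ 0≤p → 0≤p*q 0≤p 0≤p) , (λ p≤0 → ℚ.nonNegative⁻¹ _ {{ℚ.nonPos*nonPos⇒nonPos p {{ℚ.nonPositive p≤0}} p {{ℚ.nonPositive p≤0}}}}) ]′
         (ℚ.≤-total 0ℚ p)

-- A lower bound of a product needs factors strictly below 2 and ζ. For z strictly between θ² and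
-- 2ζ, take 2 θ² / z and z / 2, whose product is θ².
L-√2ζ : ∀ {ζ θ} → θ ℚ.* θ ℚ.< fromℕ 2 ℚ.* ζ → L (√ (⟦ 2 ⟧ *ᴿ fromℚ ζ)) θ
L-√2ζ {ζ} {θ} θ²<2ζ = inj₂ (inj₂
  (fromℕ 2 ℚ.* (θ ℚ.* θ ℚ.* e) , ½ ℚ.* z ,
   0≤p*q (0≤fromℕ 2) (0≤p*q (0≤p² θ) (ℚ.<⇒≤ 0<e)) ,
   0≤p*q (ℚ.<⇒≤ (ℚ.positive⁻¹ ½)) (ℚ.<⇒≤ 0<z) ,
   ℚ.<-≤-trans (ℚ.*-monoʳ-<-pos (fromℕ 2) (ℚ.*-monoˡ-<-pos e {{ℚ.positive 0<e}} θ²<z)) (ℚ.≤-reflexive (cong (fromℕ 2 ℚ.*_) ze≡1)) ,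
   ℚ.<-≤-trans (ℚ.*-monoʳ-<-pos ½ z<2ζ) (ℚ.≤-reflexive (arith₁ ζ)) ,
   ℚ.≤-reflexive (begin
     θ ℚ.* θ                                       ≡⟨ ℚ.*-identityʳ (θ ℚ.* θ) ⟨
     θ ℚ.* θ ℚ.* 1ℚ                                ≡⟨ cong (θ ℚ.* θ ℚ.*_) ze≡1 ⟨
     θ ℚ.* θ ℚ.* (z ℚ.* e)                         ≡⟨ arith₂ (θ ℚ.* θ) z e ⟩
     fromℕ 2 ℚ.* (θ ℚ.* θ ℚ.* e) ℚ.* (½ ℚ.* z)     ∎)))
  where
  open ≡-Reasoning
  between : ∃[ z ] θ ℚ.* θ ℚ.< z × z ℚ.< fromℕ 2 ℚ.* ζ
  between = ℚ.<-dense θ²<2ζ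
  z = proj₁ between
  θ²<z : θ ℚ.* θ ℚ.< z
  θ²<z = proj₁ (proj₂ between)
  z<2ζ : z ℚ.< fromℕ 2 ℚ.* ζ
  z<2ζ = proj₂ (proj₂ between)
  0<z : 0ℚ ℚ.< z
  0<z = ℚ.≤-<-trans (0≤p² θ) θ²<z
  inv : ∃[ e ] 0ℚ ℚ.< e × z ℚ.* e ≡ 1ℚ
  inv = inverse 0<z
  e = proj₁ inv
  0<e : 0ℚ ℚ.< e
  0<e = proj₁ (proj₂ inv)
  ze≡1 : z ℚ.* e ≡ 1ℚ
  ze≡1 = proj₂ (proj₂ inv)
  arith₁ : ∀ z → ½ ℚ.* (fromℕ 2 ℚ.* z) ≡ z
  arith₁ = solve 1 (λ z → con ½ :* (con (fromℕ 2) :* z) := z) refl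
  arith₂ : ∀ t z e → t ℚ.* (z ℚ.* e) ≡ fromℕ 2 ℚ.* (t ℚ.* e) ℚ.* (½ ℚ.* z)
  arith₂ = solve 3 (λ t z e → t :* (z :* e) := con (fromℕ 2) :* (t :* e) :* (con ½ :* z)) refl

-- θ lies below both √(2ζ) and (1 + ζ)/2, hence C ζ ≥ 1/(1 - θ) in either case.
L-C : ∀ {ζ θ c} → θ ℚ.* θ ℚ.< fromℕ 2 ℚ.* ζ → fromℕ 2 ℚ.* θ ℚ.≤ 1ℚ ℚ.+ ζ →
      0ℚ ℚ.≤ c → c ℚ.* (1ℚ ℚ.- θ) ℚ.< 1ℚ → let P = fromℚ ζ <ᴿ ⟦ 3 ⟧ -ᴿ ⟦ 2 ⟧ *ᴿ √ ⟦ 2 ⟧ in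
      P ⊎ ¬ P → L (C ζ) c
L-C {ζ} {θ} {c} θ²<2ζ 2θ≤1+ζ 0≤c cα<1 (inj₁ p) =
  inj₁ (p , L-quotient 1 {⟦ 1 ⟧ -ᴿ √ (⟦ 2 ⟧ *ᴿ fromℚ ζ)} 0≤c cα<1 (U-1- {√ (⟦ 2 ⟧ *ᴿ fromℚ ζ)} {θ} (L-√2ζ {ζ} {θ} θ²<2ζ)))
L-C {ζ} {θ} {c} θ²<2ζ 2θ≤1+ζ 0≤c cα<1 (inj₂ ¬p) = inj₂ (¬p , L-quotient 2 {⟦ 1 ⟧ -ᴿ fromℚ ζ} 0≤c c[1-ζ]<2 U-1-ζ)
  where
  1-ζ≤2α : 1ℚ ℚ.- ζ ℚ.≤ fromℕ 2 ℚ.* (1ℚ ℚ.- θ)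
  1-ζ≤2α = p≤p+q (0≤q-p 2θ≤1+ζ) (arith ζ θ)
    where
    arith : ∀ z t → fromℕ 2 ℚ.* (1ℚ ℚ.- t) ≡ 1ℚ ℚ.- z ℚ.+ (1ℚ ℚ.+ z ℚ.- fromℕ 2 ℚ.* t)
    arith = solve 2 (λ z t → con (fromℕ 2) :* (con 1ℚ :- t) := con 1ℚ :- z :+ (con 1ℚ :+ z :- con (fromℕ 2) :* t)) refl
  c[1-ζ]<2 : c ℚ.* (1ℚ ℚ.- ζ) ℚ.< fromℕ 2
  c[1-ζ]<2 = begin-strict
    c ℚ.* (1ℚ ℚ.- ζ)                    ≤⟨ ℚ.*-monoˡ-≤-nonNeg c {{ℚ.nonNegative 0≤c}} 1-ζ≤2α ⟩
    c ℚ.* (fromℕ 2 ℚ.* (1ℚ ℚ.- θ))      ≡⟨ arith c (1ℚ ℚ.- θ) ⟩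
    fromℕ 2 ℚ.* (c ℚ.* (1ℚ ℚ.- θ))      <⟨ ℚ.*-monoʳ-<-pos (fromℕ 2) cα<1 ⟩
    fromℕ 2                             ∎
    where
    open ℚ.≤-Reasoning
    arith : ∀ c a → c ℚ.* (fromℕ 2 ℚ.* a) ≡ fromℕ 2 ℚ.* (c ℚ.* a)
    arith = solve 2 (λ c a → c :* (con (fromℕ 2) :* a) := con (fromℕ 2) :* (c :* a)) refl
  U-1-ζ : ∀ {b} → 1ℚ ℚ.- ζ ℚ.< b → U (⟦ 1 ⟧ -ᴿ fromℚ ζ) b
  U-1-ζ {b} 1-ζ<b = b ℚ.+ 1ℚ ℚ.- w , 1ℚ ℚ.- w ,
    p<p+q (0<q-p (proj₂ (proj₂ between))) (arith₁ b w) , p<p+q (0<q-p (proj₁ (proj₂ between))) (arith₂ w ζ) , ℚ.≤-reflexive (arith₃ b w)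
    where
    between : ∃[ w ] 1ℚ ℚ.- ζ ℚ.< w × w ℚ.< b
    between = ℚ.<-dense 1-ζ<b
    w = proj₁ between
    arith₁ : ∀ b w → b ℚ.+ 1ℚ ℚ.- w ≡ 1ℚ ℚ.+ (b ℚ.- w)
    arith₁ = solve 2 (λ b w → b :+ con 1ℚ :- w := con 1ℚ :+ (b :- w)) refl
    arith₂ : ∀ w z → z ≡ 1ℚ ℚ.- w ℚ.+ (w ℚ.- (1ℚ ℚ.- z))
    arith₂ = solve 2 (λ w z → z := con 1ℚ :- w :+ (w :- (con 1ℚ :- z))) refl
    arith₃ : ∀ b w → (b ℚ.+ 1ℚ ℚ.- w) ℚ.- (1ℚ ℚ.- w) ≡ b
    arith₃ = solve 2 (λ b w → (b :+ con 1ℚ :- w) :- (con 1ℚ :- w) := b) refl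

L-log₂ : ∀ {x} e → L x (fromℕ (2 ^ e)) → L (log₂ x) (fromℕ e)
L-log₂ {x} e L-2^e = subst (L (log₂ x)) (sym (fromℕ≡integral e))
  (fromℕ (2 ^ e) , fromℕ-mono-< {0} {2 ^ e} (m^n>0 2 e) , L-2^e ,
   ℚ.≤-reflexive (trans (sym (fromℕ-^ 2 e)) (sym (ℚ.*-identityʳ (fromℕ (2 ^ e))))))

-- A lower cut is strict, so the multiplier must exceed the a that is really used. Hence the
-- successors in the constants of the conclusion.
≤ᴿ-product : ∀ {T A a e y} → L y (fromℕ e) → T ≤ a * e → a < A → ⟦ T ⟧ ≤ᴿ ⟦ A ⟧ *ᴿ y
≤ᴿ-product {T} {A} {a} {e} L-e T≤ae a<A q q<T = inj₂
  (fromℕ a , fromℕ e , 0≤fromℕ a , 0≤fromℕ e , fromℕ-mono-< {a} {A} a<A , L-e ,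
   ℚ.≤-trans (ℚ.<⇒≤ q<T) (ℚ.≤-trans (fromℕ-mono-≤ {T} {a * e} T≤ae) (ℚ.≤-reflexive (fromℕ-* a e))))

≤-<-connexℚ : ∀ p q → p ℚ.≤ q ⊎ q ℚ.< p
≤-<-connexℚ p q with p ℚ.≤? q
... | yes p≤q = inj₁ p≤q
... | no p≰q  = inj₂ (ℚ.≰⇒> p≰q)

ceiling : ∀ k q → 0ℚ ℚ.≤ q → q ℚ.≤ fromℕ k → ∃[ r ] r ≤ k × q ℚ.≤ fromℕ r × fromℕ r ℚ.< q ℚ.+ 1ℚ
ceiling zero    q 0≤q q≤0 = 0 , z≤n , q≤0 ,
  p<p+q (0<p+q (ℚ.positive⁻¹ 1ℚ) 0≤q) (trans (ℚ.+-comm q 1ℚ) (sym (ℚ.+-identityˡ (1ℚ ℚ.+ q))))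
ceiling (suc k) q 0≤q q≤1+k = [ round-down , round-up ]′ (≤-<-connexℚ q (fromℕ k))
  where
  round-down : q ℚ.≤ fromℕ k → ∃[ r ] r ≤ suc k × q ℚ.≤ fromℕ r × fromℕ r ℚ.< q ℚ.+ 1ℚ
  round-down q≤k = let r , r≤k , q≤r , r<q+1 = ceiling k q 0≤q q≤k in r , m≤n⇒m≤1+n r≤k , q≤r , r<q+1
  round-up : fromℕ k ℚ.< q → ∃[ r ] r ≤ suc k × q ℚ.≤ fromℕ r × fromℕ r ℚ.< q ℚ.+ 1ℚ
  round-up k<q = suc k , ≤-refl , q≤1+k ,
    ℚ.≤-<-trans (ℚ.≤-reflexive (trans (cong fromℕ (+-comm 1 k)) (fromℕ-+ k 1))) (ℚ.+-monoˡ-< 1ℚ k<q)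

least-square : ∀ {ζ} M → fromℕ 2 ℚ.≤ fromℕ (M * M) ℚ.* ζ →
               ∃[ p ] fromℕ (p * p) ℚ.* ζ ℚ.< fromℕ 2 × fromℕ 2 ℚ.≤ fromℕ (suc p * suc p) ℚ.* ζ
least-square {ζ} zero 2≤0 =
  contradiction (ℚ.≤-<-trans (ℚ.≤-trans 2≤0 (ℚ.≤-reflexive (ℚ.*-zeroˡ ζ))) (fromℕ-mono-< {0} {2} (s≤s z≤n))) (ℚ.<-irrefl refl)
least-square {ζ} (suc M) 2≤ = [ least-square M , (λ M²ζ<2 → M , M²ζ<2 , 2≤) ]′ (≤-<-connexℚ (fromℕ 2) (fromℕ (M * M) ℚ.* ζ))

2*triangle : ∀ p → triangle (suc p) + triangle (suc p) ≡ suc p * p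
2*triangle zero    = refl
2*triangle (suc p) = begin
  suc p + t + (suc p + t)  ≡⟨ arith p t ⟩
  suc p + suc p + (t + t)  ≡⟨ cong (suc p + suc p +_) (2*triangle p) ⟩
  suc p + suc p + suc p * p ≡⟨ arith₂ p ⟩
  suc (suc p) * suc p      ∎
  where
  open ≡-Reasoning
  t = triangle (suc p)
  arith : ∀ p t → suc p + t + (suc p + t) ≡ suc p + suc p + (t + t)
  arith = solve-∀
  arith₂ : ∀ p → suc p + suc p + suc p * p ≡ suc (suc p) * suc p
  arith₂ = solve-∀

-- The parameters of the closure argument

-- If C₁, …, C_m are added successively, each sharing θ k variables with the
-- earlier ones and S, then m θ k ≤ k + triangle m · ζ k; the last field excludes this.
record Parameters (ζ : ℚ) : Set where
  field
    m       : ℕ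
    θ       : ℚ
    1≤m     : 1 ≤ m
    0≤θ     : 0ℚ ℚ.≤ θ
    θ<1     : θ ℚ.< 1ℚ
    θ²<2ζ   : θ ℚ.* θ ℚ.< fromℕ 2 ℚ.* ζ
    2θ≤1+ζ  : fromℕ 2 ℚ.* θ ℚ.≤ 1ℚ ℚ.+ ζ
    mθ-large : 1ℚ ℚ.+ fromℕ (triangle m) ℚ.* ζ ℚ.≤ fromℕ m ℚ.* θ

-- With m = p + 1 the least integer ≥ √(2/ζ), the bound follows from
-- 0 ≤ (m² ζ - 2) (2 - p² ζ).
θ₁²-gap : ∀ {ζ} p → 0ℚ ℚ.< ζ → fromℕ (p * p) ℚ.* ζ ℚ.< fromℕ 2 → fromℕ 2 ℚ.≤ fromℕ (suc p * suc p) ℚ.* ζ →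
          let X = 1ℚ ℚ.+ fromℕ (triangle (suc p)) ℚ.* ζ in
          X ℚ.* X ℚ.< fromℕ 2 ℚ.* ζ ℚ.* (fromℕ (suc p) ℚ.* fromℕ (suc p))
θ₁²-gap {ζ} p 0<ζ p²ζ<2 2≤m²ζ = p<p+q 0<gap (begin
  fromℕ 2 ℚ.* ζ ℚ.* (M ℚ.* M)                                         ≡⟨ cong (λ M → fromℕ 2 ℚ.* ζ ℚ.* (M ℚ.* M)) (fromℕ-+ 1 p) ⟩
  fromℕ 2 ℚ.* ζ ℚ.* ((1ℚ ℚ.+ P) ℚ.* (1ℚ ℚ.+ P))                       ≡⟨ arith P ζ ⟩
  X (½ ℚ.* ((1ℚ ℚ.+ P) ℚ.* P)) ℚ.* X (½ ℚ.* ((1ℚ ℚ.+ P) ℚ.* P)) ℚ.+ gap ((1ℚ ℚ.+ P) ℚ.* (1ℚ ℚ.+ P)) (P ℚ.* P)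
    ≡⟨ cong₂ ℚ._+_ (cong (λ t → X t ℚ.* X t) (sym triangle≡)) (cong₂ gap (sym m²≡) (sym (fromℕ-* p p))) ⟩
  X τ ℚ.* X τ ℚ.+ gap (fromℕ (suc p * suc p)) (fromℕ (p * p))         ∎)
  where
  open ≡-Reasoning
  M = fromℕ (suc p)
  P = fromℕ p
  τ = fromℕ (triangle (suc p))
  X : ℚ → ℚ
  X t = 1ℚ ℚ.+ t ℚ.* ζ
  gap : ℚ → ℚ → ℚ
  gap mm pp = ½ ℚ.* ½ ℚ.* ((fromℕ 8 ℚ.* P ℚ.+ fromℕ 6) ℚ.* ζ ℚ.+ (mm ℚ.* ζ ℚ.- fromℕ 2) ℚ.* (fromℕ 2 ℚ.- pp ℚ.* ζ))
  0<gap : 0ℚ ℚ.< gap (fromℕ (suc p * suc p)) (fromℕ (p * p))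
  0<gap = 0<p*q (ℚ.positive⁻¹ (½ ℚ.* ½)) (0<p+q
    (0<p*q (ℚ.+-mono-≤-< (0≤p*q (0≤fromℕ 8) (0≤fromℕ p)) (ℚ.positive⁻¹ (fromℕ 6))) 0<ζ)
    (0≤p*q (0≤q-p 2≤m²ζ) (ℚ.<⇒≤ (0<q-p p²ζ<2))))
  m²≡ : fromℕ (suc p * suc p) ≡ (1ℚ ℚ.+ P) ℚ.* (1ℚ ℚ.+ P)
  m²≡ = trans (fromℕ-* (suc p) (suc p)) (cong₂ ℚ._*_ (fromℕ-+ 1 p) (fromℕ-+ 1 p))
  triangle≡ : τ ≡ ½ ℚ.* ((1ℚ ℚ.+ P) ℚ.* P)
  triangle≡ = begin
    τ                                    ≡⟨ halve τ ⟩
    ½ ℚ.* (τ ℚ.+ τ)                      ≡⟨ cong (½ ℚ.*_) (fromℕ-+ (triangle (suc p)) (triangle (suc p))) ⟨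
    ½ ℚ.* fromℕ (triangle (suc p) + triangle (suc p)) ≡⟨ cong (λ t → ½ ℚ.* fromℕ t) (2*triangle p) ⟩
    ½ ℚ.* fromℕ (suc p * p)              ≡⟨ cong (½ ℚ.*_) (fromℕ-* (suc p) p) ⟩
    ½ ℚ.* (M ℚ.* P)                      ≡⟨ cong (λ M → ½ ℚ.* (M ℚ.* P)) (fromℕ-+ 1 p) ⟩
    ½ ℚ.* ((1ℚ ℚ.+ P) ℚ.* P)             ∎
    where
    halve : ∀ t → t ≡ ½ ℚ.* (t ℚ.+ t)
    halve = solve 1 (λ t → t := con ½ :* (t :+ t)) refl
  arith : ∀ P z → fromℕ 2 ℚ.* z ℚ.* ((1ℚ ℚ.+ P) ℚ.* (1ℚ ℚ.+ P)) ≡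
    (1ℚ ℚ.+ ½ ℚ.* ((1ℚ ℚ.+ P) ℚ.* P) ℚ.* z) ℚ.* (1ℚ ℚ.+ ½ ℚ.* ((1ℚ ℚ.+ P) ℚ.* P) ℚ.* z) ℚ.+
    ½ ℚ.* ½ ℚ.* ((fromℕ 8 ℚ.* P ℚ.+ fromℕ 6) ℚ.* z ℚ.+ ((1ℚ ℚ.+ P) ℚ.* (1ℚ ℚ.+ P) ℚ.* z ℚ.- fromℕ 2) ℚ.* (fromℕ 2 ℚ.- P ℚ.* P ℚ.* z))
  arith = solve 2 (λ P z →
    let X = con 1ℚ :+ con ½ :* ((con 1ℚ :+ P) :* P) :* z
    in con (fromℕ 2) :* z :* ((con 1ℚ :+ P) :* (con 1ℚ :+ P)) :=
       X :* X :+ con ½ :* con ½ :* ((con (fromℕ 8) :* P :+ con (fromℕ 6)) :* z :+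
         ((con 1ℚ :+ P) :* (con 1ℚ :+ P) :* z :- con (fromℕ 2)) :* (con (fromℕ 2) :- P :* P :* z))) refl

-- θ₁ is the least θ that `mθ-large` admits for m = p + 1, and θ₂ = (1 + ζ)/2 the least for m = 2.
-- The smaller of the two lies below both √(2ζ) and (1 + ζ)/2, since θ₁ < √(2ζ) always holds; thus
-- two rationals are compared, and never ζ with 3 - 2√2.
parameters : ∀ ζ → 0ℚ ℚ.< ζ → ζ ℚ.< 1ℚ → Parameters ζ
parameters ζ 0<ζ ζ<1 = [ first , second ]′ (≤-<-connexℚ θ₁ θ₂)
  where
  arch : ∃[ M ] 1ℚ ℚ.≤ fromℕ M ℚ.* ζ
  arch = archimedean 0<ζ
  M = proj₁ arch
  search : ∃[ p ] fromℕ (p * p) ℚ.* ζ ℚ.< fromℕ 2 × fromℕ 2 ℚ.≤ fromℕ (suc p * suc p) ℚ.* ζ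
  search = least-square (2 * M) (begin
    fromℕ 2                          ≤⟨ ℚ.*-monoˡ-≤-nonNeg (fromℕ 2) (proj₂ arch) ⟩
    fromℕ 2 ℚ.* (fromℕ M ℚ.* ζ)      ≡⟨ ℚ.*-assoc (fromℕ 2) (fromℕ M) ζ ⟨
    fromℕ 2 ℚ.* fromℕ M ℚ.* ζ        ≡⟨ cong (ℚ._* ζ) (fromℕ-* 2 M) ⟨
    fromℕ (2 * M) ℚ.* ζ              ≤⟨ ℚ.*-monoʳ-≤-nonNeg ζ {{ℚ.nonNegative (ℚ.<⇒≤ 0<ζ)}} (fromℕ-mono-≤ {2 * M} {2 * M * (2 * M)} (n≤n² (2 * M))) ⟩
    fromℕ (2 * M * (2 * M)) ℚ.* ζ    ∎)
    where
    open ℚ.≤-Reasoning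
    n≤n² : ∀ n → n ≤ n * n
    n≤n² zero    = z≤n
    n≤n² (suc n) = m≤m+n (suc n) (n * suc n)
  p = proj₁ search
  m = suc p
  inv : ∃[ e ] 0ℚ ℚ.< e × fromℕ m ℚ.* e ≡ 1ℚ
  inv = inverse (fromℕ-mono-< {0} {m} (s≤s z≤n))
  e = proj₁ inv
  0<e : 0ℚ ℚ.< e
  0<e = proj₁ (proj₂ inv)
  me≡1 : fromℕ m ℚ.* e ≡ 1ℚ
  me≡1 = proj₂ (proj₂ inv)
  X = 1ℚ ℚ.+ fromℕ (triangle m) ℚ.* ζ
  θ₁ = X ℚ.* e
  θ₂ = (1ℚ ℚ.+ ζ) ℚ.* ½
  0≤X : 0ℚ ℚ.≤ X
  0≤X = ℚ.<⇒≤ (0<p+q (ℚ.positive⁻¹ 1ℚ) (0≤p*q (0≤fromℕ (triangle m)) (ℚ.<⇒≤ 0<ζ)))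
  0≤θ₁ : 0ℚ ℚ.≤ θ₁
  0≤θ₁ = 0≤p*q 0≤X (ℚ.<⇒≤ 0<e)
  0≤θ₂ : 0ℚ ℚ.≤ θ₂
  0≤θ₂ = 0≤p*q (ℚ.<⇒≤ (0<p+q (ℚ.positive⁻¹ 1ℚ) (ℚ.<⇒≤ 0<ζ))) (ℚ.<⇒≤ (ℚ.positive⁻¹ ½))
  2θ₂≡ : fromℕ 2 ℚ.* θ₂ ≡ 1ℚ ℚ.+ ζ
  2θ₂≡ = arith ζ
    where
    arith : ∀ z → fromℕ 2 ℚ.* ((1ℚ ℚ.+ z) ℚ.* ½) ≡ 1ℚ ℚ.+ z
    arith = solve 1 (λ z → con (fromℕ 2) :* ((con 1ℚ :+ z) :* con ½) := con 1ℚ :+ z) refl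
  θ₂<1 : θ₂ ℚ.< 1ℚ
  θ₂<1 = p<p+q (0<p*q (0<q-p ζ<1) (ℚ.positive⁻¹ ½)) (arith ζ)
    where
    arith : ∀ z → 1ℚ ≡ (1ℚ ℚ.+ z) ℚ.* ½ ℚ.+ (1ℚ ℚ.- z) ℚ.* ½
    arith = solve 1 (λ z → con 1ℚ := (con 1ℚ :+ z) :* con ½ :+ (con 1ℚ :- z) :* con ½) refl
  θ₁²<2ζ : θ₁ ℚ.* θ₁ ℚ.< fromℕ 2 ℚ.* ζ
  θ₁²<2ζ = begin-strict
    (X ℚ.* e) ℚ.* (X ℚ.* e)                              ≡⟨ arith₁ X e ⟩
    (X ℚ.* X) ℚ.* (e ℚ.* e)                              <⟨ ℚ.*-monoˡ-<-pos (e ℚ.* e) {{ℚ.positive (0<p*q 0<e 0<e)}}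
                                                              (θ₁²-gap p 0<ζ (proj₁ (proj₂ search)) (proj₂ (proj₂ search))) ⟩
    fromℕ 2 ℚ.* ζ ℚ.* (fromℕ m ℚ.* fromℕ m) ℚ.* (e ℚ.* e)  ≡⟨ arith₂ (fromℕ 2 ℚ.* ζ) (fromℕ m) e ⟩
    fromℕ 2 ℚ.* ζ ℚ.* ((fromℕ m ℚ.* e) ℚ.* (fromℕ m ℚ.* e)) ≡⟨ cong (λ u → fromℕ 2 ℚ.* ζ ℚ.* (u ℚ.* u)) me≡1 ⟩
    fromℕ 2 ℚ.* ζ ℚ.* (1ℚ ℚ.* 1ℚ)                        ≡⟨ ℚ.*-identityʳ (fromℕ 2 ℚ.* ζ) ⟩
    fromℕ 2 ℚ.* ζ                                        ∎
    where
    open ℚ.≤-Reasoning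
    arith₁ : ∀ x e → (x ℚ.* e) ℚ.* (x ℚ.* e) ≡ (x ℚ.* x) ℚ.* (e ℚ.* e)
    arith₁ = solve 2 (λ x e → (x :* e) :* (x :* e) := (x :* x) :* (e :* e)) refl
    arith₂ : ∀ z m e → z ℚ.* (m ℚ.* m) ℚ.* (e ℚ.* e) ≡ z ℚ.* ((m ℚ.* e) ℚ.* (m ℚ.* e))
    arith₂ = solve 3 (λ z m e → z :* (m :* m) :* (e :* e) := z :* ((m :* e) :* (m :* e))) refl

  first : θ₁ ℚ.≤ θ₂ → Parameters ζ
  first θ₁≤θ₂ = record
    { m = m ; θ = θ₁ ; 1≤m = s≤s z≤n ; 0≤θ = 0≤θ₁ ; θ<1 = ℚ.≤-<-trans θ₁≤θ₂ θ₂<1 ; θ²<2ζ = θ₁²<2ζ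
    ; 2θ≤1+ζ = ℚ.≤-trans (ℚ.*-monoˡ-≤-nonNeg (fromℕ 2) θ₁≤θ₂) (ℚ.≤-reflexive 2θ₂≡)
    ; mθ-large = ℚ.≤-reflexive (trans (sym (trans (cong (X ℚ.*_) me≡1) (ℚ.*-identityʳ X))) (arith X (fromℕ m) e))
    }
    where
    arith : ∀ x m e → x ℚ.* (m ℚ.* e) ≡ m ℚ.* (x ℚ.* e)
    arith = solve 3 (λ x m e → x :* (m :* e) := m :* (x :* e)) refl

  second : θ₂ ℚ.< θ₁ → Parameters ζ
  second θ₂<θ₁ = record
    { m = 2 ; θ = θ₂ ; 1≤m = s≤s z≤n ; 0≤θ = 0≤θ₂ ; θ<1 = θ₂<1
    ; θ²<2ζ = ℚ.≤-<-trans (p≤p+q (0≤p*q (ℚ.<⇒≤ (0<q-p θ₂<θ₁)) (0≤p+q 0≤θ₁ 0≤θ₂)) (arith θ₁ θ₂)) θ₁²<2ζ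
    ; 2θ≤1+ζ = ℚ.≤-reflexive 2θ₂≡
    ; mθ-large = ℚ.≤-reflexive (trans (cong (1ℚ ℚ.+_) (ℚ.*-identityˡ ζ)) (sym 2θ₂≡))
    }
    where
    arith : ∀ x y → x ℚ.* x ≡ y ℚ.* y ℚ.+ (x ℚ.- y) ℚ.* (x ℚ.+ y)
    arith = solve 2 (λ x y → x :* x := y :* y :+ (x :- y) :* (x :+ y)) refl

-- From t = k + 1 - r and r < (1 - θ) k + 1 follows t > θ k, and `mθ-large` times k gives the rest.
closure-bound : ∀ {ζ} (ps : Parameters ζ) → let module P = Parameters ps in
                ∀ {k s t r} → fromℕ s ≡ ζ ℚ.* fromℕ k → t + r ≡ suc k →
                fromℕ r ℚ.< (1ℚ ℚ.- P.θ) ℚ.* fromℕ k ℚ.+ 1ℚ → k + triangle P.m * s < P.m * t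
closure-bound {ζ} ps {k} {s} {t} {r} s≡ζk t+r≡1+k r<αk+1 = fromℕ-cancel-< {k + triangle m * s} {m * t} (begin-strict
  fromℕ (k + triangle m * s)                        ≡⟨ trans (fromℕ-+ k (triangle m * s)) (cong (fromℕ k ℚ.+_) (trans (fromℕ-* (triangle m) s) (cong (fromℕ (triangle m) ℚ.*_) s≡ζk))) ⟩
  fromℕ k ℚ.+ fromℕ (triangle m) ℚ.* (ζ ℚ.* fromℕ k) ≡⟨ arith₁ (fromℕ k) (fromℕ (triangle m)) ζ ⟩
  (1ℚ ℚ.+ fromℕ (triangle m) ℚ.* ζ) ℚ.* fromℕ k     ≤⟨ ℚ.*-monoʳ-≤-nonNeg (fromℕ k) {{ℚ.nonNegative (0≤fromℕ k)}} mθ-large ⟩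
  fromℕ m ℚ.* θ ℚ.* fromℕ k                         ≡⟨ ℚ.*-assoc (fromℕ m) θ (fromℕ k) ⟩
  fromℕ m ℚ.* (θ ℚ.* fromℕ k)                       <⟨ ℚ.*-monoʳ-<-pos (fromℕ m) {{ℚ.positive (fromℕ-mono-< {0} {m} 1≤m)}} θk<t ⟩
  fromℕ m ℚ.* fromℕ t                               ≡⟨ fromℕ-* m t ⟨
  fromℕ (m * t)                                     ∎)
  where
  open Parameters ps
  open ℚ.≤-Reasoning
  arith₁ : ∀ k t z → k ℚ.+ t ℚ.* (z ℚ.* k) ≡ (1ℚ ℚ.+ t ℚ.* z) ℚ.* k
  arith₁ = solve 3 (λ k t z → k :+ t :* (z :* k) := (con 1ℚ :+ t :* z) :* k) refl
  t+r≡k+1 : fromℕ t ℚ.+ fromℕ r ≡ 1ℚ ℚ.+ fromℕ k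
  t+r≡k+1 = trans (sym (fromℕ-+ t r)) (trans (cong fromℕ t+r≡1+k) (fromℕ-+ 1 k))
  θk<t : θ ℚ.* fromℕ k ℚ.< fromℕ t
  θk<t = p<p+q (0<q-p r<αk+1) (begin-equality
    fromℕ t                                         ≡⟨ arith₂ (fromℕ t) (fromℕ r) ⟩
    fromℕ t ℚ.+ fromℕ r ℚ.- fromℕ r                 ≡⟨ cong (ℚ._- fromℕ r) t+r≡k+1 ⟩
    1ℚ ℚ.+ fromℕ k ℚ.- fromℕ r                      ≡⟨ arith₃ (fromℕ k) (fromℕ r) θ ⟩
    θ ℚ.* fromℕ k ℚ.+ ((1ℚ ℚ.- θ) ℚ.* fromℕ k ℚ.+ 1ℚ ℚ.- fromℕ r) ∎)
    where
    arith₂ : ∀ t r → t ≡ t ℚ.+ r ℚ.- r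
    arith₂ = solve 2 (λ t r → t := t :+ r :- r) refl
    arith₃ : ∀ k r h → 1ℚ ℚ.+ k ℚ.- r ≡ h ℚ.* k ℚ.+ ((1ℚ ℚ.- h) ℚ.* k ℚ.+ 1ℚ ℚ.- r)
    arith₃ = solve 3 (λ k r h → con 1ℚ :+ k :- r := h :* k :+ ((con 1ℚ :- h) :* k :+ con 1ℚ :- r)) refl

module _ {ζ} (ps : Parameters ζ) where

  open Parameters ps

  -- If the local lemma condition fails, then d > 2 ^ (r - x), so log d exceeds r - x ≥ (1 - θ) k -
  -- x. Multiplying by about 1/(1 - θ), which is at most M, yields nearly k - M x.
  L-C-log : ∀ {k d r x M} → 1ℚ ℚ.≤ fromℕ M ℚ.* (1ℚ ℚ.- θ) → (1ℚ ℚ.- θ) ℚ.* fromℕ k ℚ.≤ fromℕ r →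
            4 * suc k ≤ 2 ^ x → 2 ^ r < 4 * (suc k * d) →
            let P = fromℚ ζ <ᴿ ⟦ 3 ⟧ -ᴿ ⟦ 2 ⟧ *ᴿ √ ⟦ 2 ⟧ in P ⊎ ¬ P →
            ∃[ y ] L (C ζ *ᴿ log₂ ⟦ d ⟧) y × fromℕ k ℚ.- fromℕ (M * x) ℚ.- 1ℚ ℚ.≤ y
  L-C-log {k} {d} {r} {x} {M} 1≤Mα αk≤r 4k≤2^x 2^r< P⊎¬P = [ small , large ]′ (≤-<-connex x r)
    where
    α = 1ℚ ℚ.- θ
    K = fromℕ k
    R = fromℕ r
    Y = fromℕ x
    0<α : 0ℚ ℚ.< α
    0<α = 0<q-p θ<1

    large : r < x → ∃[ y ] L (C ζ *ᴿ log₂ ⟦ d ⟧) y × K ℚ.- fromℕ (M * x) ℚ.- 1ℚ ℚ.≤ y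
    -- Now k ≤ M r ≤ M x, so the target is at most -1, and the lower cut of a product contains every
    -- negative rational.
    large r<x = ℚ.- 1ℚ , inj₁ (ℚ.negative⁻¹ (ℚ.- 1ℚ)) , p≤p+q (0≤q-p K≤Mx) (arith K (fromℕ (M * x)))
      where
      open ℚ.≤-Reasoning
      K≤Mx : K ℚ.≤ fromℕ (M * x)
      K≤Mx = begin
        K                            ≡⟨ ℚ.*-identityˡ K ⟨
        1ℚ ℚ.* K                     ≤⟨ ℚ.*-monoʳ-≤-nonNeg K {{ℚ.nonNegative (0≤fromℕ k)}} 1≤Mα ⟩
        fromℕ M ℚ.* α ℚ.* K          ≡⟨ ℚ.*-assoc (fromℕ M) α K ⟩
        fromℕ M ℚ.* (α ℚ.* K)        ≤⟨ ℚ.*-monoˡ-≤-nonNeg (fromℕ M) {{ℚ.nonNegative (0≤fromℕ M)}} αk≤r ⟩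
        fromℕ M ℚ.* R                ≤⟨ ℚ.*-monoˡ-≤-nonNeg (fromℕ M) {{ℚ.nonNegative (0≤fromℕ M)}} (fromℕ-mono-≤ {r} {x} (<⇒≤ r<x)) ⟩
        fromℕ M ℚ.* Y                ≡⟨ fromℕ-* M x ⟨
        fromℕ (M * x)                ∎
      arith : ∀ k m → ℚ.- 1ℚ ≡ k ℚ.- m ℚ.- 1ℚ ℚ.+ (m ℚ.- k)
      arith = solve 2 (λ k m → con (ℚ.- 1ℚ) := k :- m :- con 1ℚ :+ (m :- k)) refl

    small : x ≤ r → ∃[ y ] L (C ζ *ᴿ log₂ ⟦ d ⟧) y × K ℚ.- fromℕ (M * x) ℚ.- 1ℚ ℚ.≤ y
    small x≤r = c ℚ.* fromℕ e , inj₂ (c , fromℕ e , 0≤c , 0≤fromℕ e , L-C {ζ} {θ} {c} θ²<2ζ 2θ≤1+ζ 0≤c cα<1 P⊎¬P ,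
                  L-log₂ {⟦ d ⟧} e (fromℕ-mono-< {2 ^ e} {d} 2^e<d) , ℚ.≤-refl) , p≤p+q 0≤rest ce≡
      where
      e = r ∸ x
      2^e<d : 2 ^ e < d
      2^e<d = *-cancelˡ-< (2 ^ x) _ _ (begin-strict
        2 ^ x * 2 ^ e     ≡⟨ ^-distribˡ-+-* 2 x e ⟨
        2 ^ (x + e)       ≡⟨ cong (2 ^_) (m+[n∸m]≡n x≤r) ⟩
        2 ^ r             <⟨ 2^r< ⟩
        4 * (suc k * d)   ≡⟨ *-assoc 4 (suc k) d ⟨
        4 * suc k * d     ≤⟨ *-monoˡ-≤ d 4k≤2^x ⟩
        2 ^ x * d         ∎)
        where open ≤-Reasoning
      inv : ∃[ i ] 0ℚ ℚ.< i × α ℚ.* (K ℚ.+ 1ℚ) ℚ.* i ≡ 1ℚ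
      inv = inverse (0<p*q 0<α (ℚ.+-mono-≤-< (0≤fromℕ k) (ℚ.positive⁻¹ 1ℚ)))
      i = proj₁ inv
      0<i : 0ℚ ℚ.< i
      0<i = proj₁ (proj₂ inv)
      unit : α ℚ.* (K ℚ.+ 1ℚ) ℚ.* i ≡ 1ℚ
      unit = proj₂ (proj₂ inv)
      -- This is k / ((1 - θ) (k + 1)): strictly below 1/(1 - θ), as the lower cut of `C ζ`
      -- requires, yet so close that the product loses at most 1.
      c = K ℚ.* i
      0≤c : 0ℚ ℚ.≤ c
      0≤c = 0≤p*q (0≤fromℕ k) (ℚ.<⇒≤ 0<i)
      cα<1 : c ℚ.* α ℚ.< 1ℚ
      cα<1 = p<p+q (0<p*q 0<i 0<α) (trans (sym unit) (arith α K i))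
        where
        arith : ∀ a k i → a ℚ.* (k ℚ.+ 1ℚ) ℚ.* i ≡ k ℚ.* i ℚ.* a ℚ.+ i ℚ.* a
        arith = solve 3 (λ a k i → a :* (k :+ con 1ℚ) :* i := k :* i :* a :+ i :* a) refl
      rest = i ℚ.* (K ℚ.* (R ℚ.- α ℚ.* K) ℚ.+ K ℚ.* Y ℚ.* (fromℕ M ℚ.* α ℚ.- 1ℚ) ℚ.+ α ℚ.* (fromℕ M ℚ.* Y) ℚ.+ α)
      0≤rest : 0ℚ ℚ.≤ rest
      0≤rest = 0≤p*q (ℚ.<⇒≤ 0<i) (0≤p+q (0≤p+q (0≤p+q
        (0≤p*q (0≤fromℕ k) (0≤q-p αk≤r))
        (0≤p*q (0≤p*q (0≤fromℕ k) (0≤fromℕ x)) (0≤q-p 1≤Mα)))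
        (0≤p*q (ℚ.<⇒≤ 0<α) (0≤p*q (0≤fromℕ M) (0≤fromℕ x))))
        (ℚ.<⇒≤ 0<α))
      E≡ : fromℕ e ≡ R ℚ.- Y
      E≡ = trans (cancel (fromℕ e) Y) (cong (ℚ._- Y) (trans (sym (fromℕ-+ e x)) (cong fromℕ (m∸n+n≡m x≤r))))
        where
        cancel : ∀ a b → a ≡ a ℚ.+ b ℚ.- b
        cancel = solve 2 (λ a b → a := a :+ b :- b) refl
      ce≡ : c ℚ.* fromℕ e ≡ K ℚ.- fromℕ (M * x) ℚ.- 1ℚ ℚ.+ rest
      ce≡ = begin
        c ℚ.* fromℕ e                                     ≡⟨ cong (c ℚ.*_) E≡ ⟩
        c ℚ.* (R ℚ.- Y)                                   ≡⟨ arith K i R Y α (fromℕ M) ⟩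
        (K ℚ.- fromℕ M ℚ.* Y ℚ.- 1ℚ) ℚ.* (α ℚ.* (K ℚ.+ 1ℚ) ℚ.* i) ℚ.+ rest
          ≡⟨ cong (ℚ._+ rest) (trans (cong ((K ℚ.- fromℕ M ℚ.* Y ℚ.- 1ℚ) ℚ.*_) unit) (ℚ.*-identityʳ (K ℚ.- fromℕ M ℚ.* Y ℚ.- 1ℚ))) ⟩
        K ℚ.- fromℕ M ℚ.* Y ℚ.- 1ℚ ℚ.+ rest                ≡⟨ cong (λ z → K ℚ.- z ℚ.- 1ℚ ℚ.+ rest) (fromℕ-* M x) ⟨
        K ℚ.- fromℕ (M * x) ℚ.- 1ℚ ℚ.+ rest                ∎
        where
        open ≡-Reasoning
        arith : ∀ k i r y a m → k ℚ.* i ℚ.* (r ℚ.- y) ≡ (k ℚ.- m ℚ.* y ℚ.- 1ℚ) ℚ.* (a ℚ.* (k ℚ.+ 1ℚ) ℚ.* i) ℚ.+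
                i ℚ.* (k ℚ.* (r ℚ.- a ℚ.* k) ℚ.+ k ℚ.* y ℚ.* (m ℚ.* a ℚ.- 1ℚ) ℚ.+ a ℚ.* (m ℚ.* y) ℚ.+ a)
        arith = solve 6 (λ k i r y a m → k :* i :* (r :- y) := (k :- m :* y :- con 1ℚ) :* (a :* (k :+ con 1ℚ) :* i) :+
                i :* (k :* (r :- a :* k) :+ k :* y :* (m :* a :- con 1ℚ) :+ a :* (m :* y) :+ a)) refl

  width-large : ∀ {k d r M} → 1 ≤ M → 1ℚ ℚ.≤ fromℕ M ℚ.* (1ℚ ℚ.- θ) → (1ℚ ℚ.- θ) ℚ.* fromℕ k ℚ.≤ fromℕ r →
                C ζ *ᴿ log₂ ⟦ d ⟧ +ᴿ ⟦ isqrt k ⟧ +ᴿ ⟦ slack M ⟧ ≤ᴿ ⟦ k ⟧ → 4 * (suc k * d) ≤ 2 ^ r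
  width-large {k} {d} {r} {M} 1≤M 1≤Mα αk≤r hyp =
    -- The goal is decidable, hence stable, so it suffices to refute its negation; there, refuting
    -- both P and ¬ P is contradictory, which settles the case distinction in `C` without deciding
    -- it.
    decidable-stable (4 * (suc k * d) ≤? 2 ^ r) λ ≰2^r →
      let refute = contradict (≰⇒> ≰2^r) in refute (inj₂ λ p → refute (inj₁ p))
    where
    F = fromℕ (isqrt k)
    S = fromℕ (slack M)
    contradict : 2 ^ r < 4 * (suc k * d) → let P = fromℚ ζ <ᴿ ⟦ 3 ⟧ -ᴿ ⟦ 2 ⟧ *ᴿ √ ⟦ 2 ⟧ in ¬ (P ⊎ ¬ P)
    contradict 2^r< P⊎¬P = ℚ.<-irrefl refl (ℚ.<-≤-trans sum<k k≤sum)
      where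
      xs : ∃[ x ] 4 * suc k ≤ 2 ^ x × M * x + 3 ≤ isqrt k + slack M
      xs = log-slack M 1≤M k
      x = proj₁ xs
      lower : ∃[ y ] L (C ζ *ᴿ log₂ ⟦ d ⟧) y × fromℕ k ℚ.- fromℕ (M * x) ℚ.- 1ℚ ℚ.≤ y
      lower = L-C-log {k} {d} {r} {x} {M} 1≤Mα αk≤r (proj₁ (proj₂ xs)) 2^r< P⊎¬P
      y = proj₁ lower
      p-1<p : ∀ p → p ℚ.- 1ℚ ℚ.< p
      p-1<p p = p<p+q (ℚ.positive⁻¹ 1ℚ) (arith p)
        where
        arith : ∀ p → p ≡ p ℚ.- 1ℚ ℚ.+ 1ℚ
        arith = solve 1 (λ p → p := p :- con 1ℚ :+ con 1ℚ) refl
      sum<k : y ℚ.+ (F ℚ.- 1ℚ) ℚ.+ (S ℚ.- 1ℚ) ℚ.< fromℕ k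
      sum<k = hyp (y ℚ.+ (F ℚ.- 1ℚ) ℚ.+ (S ℚ.- 1ℚ))
        (y ℚ.+ (F ℚ.- 1ℚ) , S ℚ.- 1ℚ ,
         (y , F ℚ.- 1ℚ , proj₁ (proj₂ lower) , p-1<p F , ℚ.≤-refl) , p-1<p S , ℚ.≤-refl)
      Mx+3≤ : fromℕ (M * x) ℚ.+ fromℕ 3 ℚ.≤ F ℚ.+ S
      Mx+3≤ = ℚ.≤-trans (ℚ.≤-reflexive (sym (fromℕ-+ (M * x) 3)))
        (ℚ.≤-trans (fromℕ-mono-≤ {M * x + 3} {isqrt k + slack M} (proj₂ (proj₂ xs))) (ℚ.≤-reflexive (fromℕ-+ (isqrt k) (slack M))))
      k≤sum : fromℕ k ℚ.≤ y ℚ.+ (F ℚ.- 1ℚ) ℚ.+ (S ℚ.- 1ℚ)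
      k≤sum = p≤p+q (0≤p+q (0≤q-p (proj₂ (proj₂ lower))) (0≤q-p Mx+3≤)) (arith y F S (fromℕ k) (fromℕ (M * x)))
        where
        arith : ∀ y f s k m → y ℚ.+ (f ℚ.- 1ℚ) ℚ.+ (s ℚ.- 1ℚ) ≡
                k ℚ.+ (y ℚ.- (k ℚ.- m ℚ.- 1ℚ) ℚ.+ (f ℚ.+ s ℚ.- (m ℚ.+ fromℕ 3)))
        arith = solve 5 (λ y f s k m → y :+ (f :- con 1ℚ) :+ (s :- con 1ℚ) :=
                k :+ (y :- (k :- m :- con 1ℚ) :+ (f :+ s :- (m :+ con (fromℕ 3))))) refl

-- The confidence parameter

½^-decreasing : ∀ i → ½ ^ℚ suc i ℚ.< ½ ^ℚ i
½^-decreasing i = p<p+q (0<½^ (suc i)) (arith (½ ^ℚ i))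
  where
  0<½^ : ∀ i → 0ℚ ℚ.< ½ ^ℚ i
  0<½^ zero    = ℚ.positive⁻¹ 1ℚ
  0<½^ (suc i) = 0<p*q (ℚ.positive⁻¹ ½) (0<½^ i)
  arith : ∀ p → p ≡ ½ ℚ.* p ℚ.+ ½ ℚ.* p
  arith = solve 1 (λ p → p := con ½ :* p :+ con ½ :* p) refl

½^≤ : ∀ {q} M → 0ℚ ℚ.≤ q → 1ℚ ℚ.≤ fromℕ M ℚ.* q → ½ ^ℚ M ℚ.≤ q
½^≤ {q} M 0≤q 1≤Mq = begin
  ½ ^ℚ M                               ≡⟨ ℚ.*-identityʳ (½ ^ℚ M) ⟨
  ½ ^ℚ M ℚ.* 1ℚ                        ≤⟨ ℚ.*-monoˡ-≤-nonNeg (½ ^ℚ M) {{½^M≥0}} (ℚ.≤-trans 1≤Mq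
                                            (ℚ.*-monoʳ-≤-nonNeg q {{ℚ.nonNegative 0≤q}} (fromℕ-mono-≤ {M} {2 ^ M} (n≤2^n M)))) ⟩
  ½ ^ℚ M ℚ.* (fromℕ (2 ^ M) ℚ.* q)     ≡⟨ arith (½ ^ℚ M) (fromℕ (2 ^ M)) q ⟩
  fromℕ (2 ^ M) ℚ.* ½ ^ℚ M ℚ.* q       ≡⟨ cong (ℚ._* q) (2^n½^n≡1 M) ⟩
  1ℚ ℚ.* q                             ≡⟨ ℚ.*-identityˡ q ⟩
  q                                    ∎
  where
  open ℚ.≤-Reasoning
  ½^M≥0 : ℚ.NonNegative (½ ^ℚ M)
  ½^M≥0 = ℚ.nonNegative (0≤p^n M (ℚ.<⇒≤ (ℚ.positive⁻¹ ½)))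
  arith : ∀ h p q → h ℚ.* (p ℚ.* q) ≡ p ℚ.* h ℚ.* q
  arith = solve 3 (λ h p q → h :* (p :* q) := p :* h :* q) refl

module _ {δ : Cut} (real : IsReal δ) (0<δ : ⟦ 0 ⟧ <ᴿ δ) (δ<1 : δ <ᴿ ⟦ 1 ⟧) where

  open IsReal real

  -- Locatedness only separates two distinct rationals, so the search stops with 2 ^ -(i + 1) < δ <
  -- 2 ^ -(i - 1). For i = 0 truncated subtraction turns the upper bound into δ < 1. The search ends
  -- because a power of 1/2 below δ is known in advance.
  dyadic-scale : ∃[ i ] L δ (½ ^ℚ suc i) × U δ (½ ^ℚ (i ∸ 1))
  dyadic-scale = search I 0 (+-identityʳ I) (U-upper (proj₂ (proj₂ δ<1)) (proj₁ (proj₂ δ<1)))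
    where
    q = proj₁ 0<δ
    arch : ∃[ M ] 1ℚ ℚ.≤ fromℕ M ℚ.* q
    arch = archimedean (proj₁ (proj₂ 0<δ))
    I = suc (proj₁ arch)
    L-½^I : L δ (½ ^ℚ I)
    L-½^I = L-lower (ℚ.<-≤-trans (½^-decreasing (proj₁ arch)) (½^≤ (proj₁ arch) (ℚ.<⇒≤ (proj₁ (proj₂ 0<δ))) (proj₂ arch)))
                    (proj₂ (proj₂ 0<δ))
    search : ∀ fuel i → fuel + i ≡ I → U δ (½ ^ℚ (i ∸ 1)) → ∃[ i ] L δ (½ ^ℚ suc i) × U δ (½ ^ℚ (i ∸ 1))
    search fuel i fuel+i≡I U-½^ = [ (λ L-½^ → i , L-½^ , U-½^) , continue fuel fuel+i≡I ]′ (located (½^-decreasing i))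
      where
      continue : ∀ fuel → fuel + i ≡ I → U δ (½ ^ℚ i) → ∃[ i ] L δ (½ ^ℚ suc i) × U δ (½ ^ℚ (i ∸ 1))
      continue zero       i≡I U-½^i = contradiction (subst (λ j → U δ (½ ^ℚ j)) i≡I U-½^i) (disjoint L-½^I)
      continue (suc fuel) eq  U-½^i = search fuel (suc i) (trans (+-suc fuel i) eq) U-½^i

  1-δ≤ : ∀ {i p} → L δ (½ ^ℚ i) → 1ℚ ℚ.≤ p ℚ.+ ½ ^ℚ i → ⟦ 1 ⟧ -ᴿ δ ≤ᴿ fromℚ p
  1-δ≤ {i} {p} L-½^i 1≤p+½^i q (a , b , a<1 , U-b , q≤a-b) =
    ℚ.≤-<-trans q≤a-b (p<p+q (0<p+q (0<p+q (0<q-p a<1) (ℚ.<⇒≤ (0<q-p ½^i<b))) (0≤q-p 1≤p+½^i)) (arith a b p (½ ^ℚ i)))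
    where
    ½^i<b : ½ ^ℚ i ℚ.< b
    ½^i<b = [ (λ b≤½^i → contradiction U-b (disjoint (L-below b≤½^i))) , (λ lt → lt) ]′ (≤-<-connexℚ b (½ ^ℚ i))
      where
      L-below : b ℚ.≤ ½ ^ℚ i → L δ b
      L-below b≤½^i with L-rounded L-½^i
      ... | _ , ½^i<c , L-c = L-lower (ℚ.≤-<-trans b≤½^i ½^i<c) L-c
    arith : ∀ a b p h → p ≡ a ℚ.- b ℚ.+ (1ℚ ℚ.- a ℚ.+ (b ℚ.- h) ℚ.+ (p ℚ.+ h ℚ.- 1ℚ))
    arith = solve 4 (λ a b p h → p := a :- b :+ (con 1ℚ :- a :+ (b :- h) :+ (p :+ h :- con 1ℚ))) refl

  L-log₂-quotient : ∀ {n} g i → 2 ^ g ≤ n → U δ (½ ^ℚ i) → L (log₂ (⟦ n ⟧ ÷ᴿ δ)) (fromℕ (g + i))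
  L-log₂-quotient {n} g i 2^g≤n U-½^i = L-log₂ {⟦ n ⟧ ÷ᴿ δ} (g + i)
    (fromℕ (2 ^ (g + i)) ℚ.* b , b , ab<n , proj₂ (proj₂ rounded) , ℚ.≤-refl)
    where
    rounded : ∃[ b ] b ℚ.< ½ ^ℚ i × U δ b
    rounded = U-rounded U-½^i
    b = proj₁ rounded
    ab<n : fromℕ (2 ^ (g + i)) ℚ.* b ℚ.< fromℕ n
    ab<n = begin-strict
      fromℕ (2 ^ (g + i)) ℚ.* b                    <⟨ ℚ.*-monoʳ-<-pos (fromℕ (2 ^ (g + i))) {{ℚ.positive (fromℕ-mono-< {0} {2 ^ (g + i)} (m^n>0 2 (g + i)))}} (proj₁ (proj₂ rounded)) ⟩
      fromℕ (2 ^ (g + i)) ℚ.* ½ ^ℚ i               ≡⟨ cong (ℚ._* ½ ^ℚ i) (trans (cong fromℕ (^-distribˡ-+-* 2 g i)) (fromℕ-* (2 ^ g) (2 ^ i))) ⟩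
      fromℕ (2 ^ g) ℚ.* fromℕ (2 ^ i) ℚ.* ½ ^ℚ i   ≡⟨ ℚ.*-assoc (fromℕ (2 ^ g)) (fromℕ (2 ^ i)) (½ ^ℚ i) ⟩
      fromℕ (2 ^ g) ℚ.* (fromℕ (2 ^ i) ℚ.* ½ ^ℚ i) ≡⟨ trans (cong (fromℕ (2 ^ g) ℚ.*_) (2^n½^n≡1 i)) (ℚ.*-identityʳ (fromℕ (2 ^ g))) ⟩
      fromℕ (2 ^ g)                                ≤⟨ fromℕ-mono-≤ {2 ^ g} {n} 2^g≤n ⟩
      fromℕ n                                      ∎
      where open ℚ.≤-Reasoning

-- Choice of the constants and conclusion

binary-logarithm : ∀ n → 1 ≤ n → ∃[ g ] 2 ^ g ≤ n × n < 2 ^ suc g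
binary-logarithm (suc zero)      _ = 0 , ≤-refl , ≤-refl
binary-logarithm (suc n@(suc _)) _ with binary-logarithm n (s≤s z≤n)
... | g , 2^g≤n , n<2^1+g with suc n <? 2 ^ suc g
...   | yes 1+n< = g , m≤n⇒m≤1+n 2^g≤n , 1+n<
...   | no 1+n≮  = suc g , ≮⇒≥ 1+n≮ , ≤-<-trans n<2^1+g (^-monoʳ-< 2 ≤-refl {suc g} ≤-refl)

-- For n = 1 the bound on T tends to 0 as δ tends to 1, so T = 0 has to work. It does because there
-- is no candidate clause to refute.
allClauses-one-variable : ∀ {k} → 2 ≤ k → allClauses 1 k ≡ []
allClauses-one-variable (s≤s (s≤s z≤n)) = refl

module Main {ζ} (ps : Parameters ζ) where

  open Parameters ps

  M : ℕ
  M = suc (proj₁ (archimedean (0<q-p θ<1)))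

  1≤Mα : 1ℚ ℚ.≤ fromℕ M ℚ.* (1ℚ ℚ.- θ)
  1≤Mα = ℚ.≤-trans (proj₂ (archimedean (0<q-p θ<1)))
    (ℚ.*-monoʳ-≤-nonNeg (1ℚ ℚ.- θ) {{ℚ.nonNegative (ℚ.<⇒≤ (0<q-p θ<1))}} (fromℕ-mono-≤ {proj₁ (archimedean (0<q-p θ<1))} {M} (n≤1+n (proj₁ (archimedean (0<q-p θ<1))))))

  -- A clause refuted by some solution is violated with probability at least
  -- 1/(1 + a k); a′ and b are the constants in the sample size and the running time.
  a a′ b : ℕ → ℕ
  a k  = 2 ^ (suc (2 ^ k) * (m * k))
  a′ k = (4 * k + 3) * suc (a k)
  b k  = 4 ^ k * (7 + a′ k * (2 + k))

  module _ {k d s : ℕ} (1≤d : 1 ≤ d) (s≡ζk : fromℕ s ≡ ζ ℚ.* fromℕ k)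
    (hyp : C ζ *ᴿ log₂ ⟦ d ⟧ +ᴿ ⟦ isqrt k ⟧ +ᴿ ⟦ slack M ⟧ ≤ᴿ ⟦ k ⟧) where

    α : ℚ
    α = 1ℚ ℚ.- θ

    rounded : ∃[ r ] r ≤ k × α ℚ.* fromℕ k ℚ.≤ fromℕ r × fromℕ r ℚ.< α ℚ.* fromℕ k ℚ.+ 1ℚ
    rounded = ceiling k (α ℚ.* fromℕ k) (0≤p*q (ℚ.<⇒≤ (0<q-p θ<1)) (0≤fromℕ k)) (p≤p+q (0≤p*q 0≤θ (0≤fromℕ k)) (arith θ (fromℕ k)))
      where
      arith : ∀ t k → k ≡ (1ℚ ℚ.- t) ℚ.* k ℚ.+ t ℚ.* k
      arith = solve 2 (λ t k → k := (con 1ℚ :- t) :* k :+ t :* k) refl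

    r t : ℕ
    r = proj₁ rounded
    -- This is ⌊θ k⌋ + 1, the least integer above θ k, because `r` is (1 - θ) k rounded up.
    t = suc (k ∸ r)

    r≤k : r ≤ k
    r≤k = proj₁ (proj₂ rounded)

    t+r≡1+k : t + r ≡ suc k
    t+r≡1+k = cong suc (m∸n+n≡m r≤k)

    4kd≤2^r : 4 * (suc k * d) ≤ 2 ^ r
    4kd≤2^r = width-large ps {k} {d} {r} {M} (s≤s z≤n) 1≤Mα (proj₁ (proj₂ (proj₂ rounded))) hyp

    4kd≤2^k : 4 * (suc k * d) ≤ 2 ^ k
    4kd≤2^k = ≤-trans 4kd≤2^r (^-monoʳ-≤ 2 r≤k)

    k<mt : k + triangle m * s < m * t
    k<mt = closure-bound ps {k} {s} {t} {r} s≡ζk t+r≡1+k (proj₂ (proj₂ (proj₂ rounded)))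

    2≤k : 2 ≤ k
    2≤k = ≮⇒≥ λ k<2 → <⇒≱ (≤-trans (≤-trans (s≤s (^-monoʳ-≤ 2 (≤-pred k<2))) (n≤1+n 3)) (*-monoʳ-≤ 4 (*-mono-≤ (s≤s (z≤n {k})) 1≤d))) 4kd≤2^k

    -- Lets `a k` depend on k and ζ only, although the exponent in `N-violated-lower` contains d.
    d≤2^k : d ≤ 2 ^ k
    d≤2^k = ≤-trans (≤-trans (m≤m+n d (k * d)) (m≤m+n (suc k * d) (3 * (suc k * d)))) 4kd≤2^k

    a-large : 2 ^ (suc d * (m * k)) ≤ suc (a k)
    a-large = m≤n⇒m≤1+n (^-monoʳ-≤ 2 (*-monoˡ-≤ (m * k) (s≤s d≤2^k)))

    module _ {n} {Φ : CNF n} (kds : IsKDS k d s Φ) where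
      open Learning {t = t} {m = m} kds 1≤d 4kd≤2^r t+r≡1+k (s≤s z≤n) k<mt (a k) a-large public using (1≤Pr+½^i)

    module _ {δ : Cut} (real : IsReal δ) (0<δ : ⟦ 0 ⟧ <ᴿ δ) (δ<1 : δ <ᴿ ⟦ 1 ⟧) where

      i : ℕ
      i = proj₁ (dyadic-scale real 0<δ δ<1)

      L-½^1+i : L δ (½ ^ℚ suc i)
      L-½^1+i = proj₁ (proj₂ (dyadic-scale real 0<δ δ<1))

      Conclusion : ℕ → Set
      Conclusion n = ∃[ T ] (⟦ T ⟧ ≤ᴿ ⟦ suc (a′ k) ⟧ *ᴿ log₂ (⟦ n ⟧ ÷ᴿ δ) ×
        (∀ (Φ : CNF n) → IsKDS k d s Φ →
          ⟦ 1 ⟧ -ᴿ δ ≤ᴿ fromℚ (Pr Φ T (λ X → result (valiant n k X) ≗μ? Φ)) ×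
          (2 ≤ n → ∀ (X : Samples n T) →
            ⟦ steps (valiant n k X) ⟧ ≤ᴿ ⟦ suc (b k) * n ^ k ⟧ *ᴿ log₂ (⟦ n ⟧ ÷ᴿ δ))))

      one-variable : Conclusion 1
      one-variable = 0 , (λ q q<0 → inj₁ q<0) , λ Φ kds →
        1-δ≤ real 0<δ δ<1 {suc i} {Pr Φ 0 (λ X → result (valiant 1 k X) ≗μ? Φ)} L-½^1+i (1≤Pr+½^i kds (suc i) 0
          (≤-trans (≤-reflexive (trans (cong (λ Ψ → 2 ^ suc i * length Ψ) (allClauses-one-variable 2≤k)) (*-zeroʳ (2 ^ suc i)))) z≤n)) ,
        λ { (s≤s ()) }

      many-variables : ∀ n → 2 ≤ n → Conclusion n
      many-variables n 2≤n = j * suc (a k) , ≤ᴿ-product {j * suc (a k)} {suc (a′ k)} {a′ k} {e} {log₂ (⟦ n ⟧ ÷ᴿ δ)} L-e T≤ ≤-refl , λ Φ kds →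
        1-δ≤ real 0<δ δ<1 {suc i} {Pr Φ (j * suc (a k)) (λ X → result (valiant n k X) ≗μ? Φ)} L-½^1+i (1≤Pr+½^i kds (suc i) j j-large) ,
        λ _ X → ≤ᴿ-product {steps (valiant n k X)} {suc (b k) * n ^ k} {b k * n ^ k} {e} {log₂ (⟦ n ⟧ ÷ᴿ δ)} L-e (steps≤ X) (m<n+m (b k * n ^ k) (m^n>0 n k))
        where
        open ≤-Reasoning
        instance
          n≢0 : NonZero n
          n≢0 = >-nonZero (≤-trans (s≤s z≤n) 2≤n)
        log : ∃[ g ] 2 ^ g ≤ n × n < 2 ^ suc g
        log = binary-logarithm n (≤-trans (s≤s z≤n) 2≤n)
        g h e j : ℕ
        g = proj₁ log
        h = i ∸ 1
        e = g + h
        -- There are at most (3n + 1) ^ k ≤ 2 ^ ((g + 3) k) candidates, and the remaining exponent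
        -- makes the failure probability at most 2 ^ -(i + 1), which is below δ. In turn `e` is a
        -- lower bound for log (n/δ).
        j = (g + 3) * k + suc i
        -- With n ≥ 2 also `e` is at least 1, so the additive constants in the sample size and the
        -- running time can be absorbed into multiples of `e`.
        1≤g : 1 ≤ g
        1≤g = n≢0⇒n>0 λ g≡0 → <⇒≱ (≤-trans (proj₂ (proj₂ log)) (≤-reflexive (cong (λ g → 2 ^ suc g) g≡0))) 2≤n
        L-e : L (log₂ (⟦ n ⟧ ÷ᴿ δ)) (fromℕ e)
        L-e = L-log₂-quotient real 0<δ δ<1 {n} g h (proj₁ (proj₂ log)) (proj₂ (proj₂ (dyadic-scale real 0<δ δ<1)))
        j-large : 2 ^ suc i * length (allClauses n k) ≤ 2 ^ j
        j-large = begin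
          2 ^ suc i * length (allClauses n k)   ≤⟨ *-monoʳ-≤ (2 ^ suc i) (length-allClauses n k) ⟩
          2 ^ suc i * (3 * n + 1) ^ k           ≤⟨ *-monoʳ-≤ (2 ^ suc i) (^-monoˡ-≤ k 3n+1≤) ⟩
          2 ^ suc i * (2 ^ (g + 3)) ^ k         ≡⟨ cong (2 ^ suc i *_) (^-*-assoc 2 (g + 3) k) ⟩
          2 ^ suc i * 2 ^ ((g + 3) * k)         ≡⟨ *-comm (2 ^ suc i) (2 ^ ((g + 3) * k)) ⟩
          2 ^ ((g + 3) * k) * 2 ^ suc i         ≡⟨ ^-distribˡ-+-* 2 ((g + 3) * k) (suc i) ⟨
          2 ^ j                                 ∎
          where
          3n+1≤ : 3 * n + 1 ≤ 2 ^ (g + 3)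
          3n+1≤ = begin
            3 * n + 1          ≤⟨ +-monoʳ-≤ (3 * n) (≤-trans (s≤s z≤n) 2≤n) ⟩
            3 * n + n          ≡⟨ +-comm (3 * n) n ⟩
            4 * n              ≤⟨ *-monoʳ-≤ 4 (<⇒≤ (proj₂ (proj₂ log))) ⟩
            4 * 2 ^ suc g      ≡⟨ ^-distribˡ-+-* 2 2 (suc g) ⟨
            2 ^ (3 + g)        ≡⟨ cong (2 ^_) (+-comm 3 g) ⟩
            2 ^ (g + 3)        ∎
        1+i≤ : ∀ i → suc i ≤ 2 + (i ∸ 1)
        1+i≤ zero    = s≤s z≤n
        1+i≤ (suc i) = ≤-refl
        T≤ : j * suc (a k) ≤ a′ k * e
        T≤ = begin
          j * suc (a k)                           ≤⟨ *-monoˡ-≤ (suc (a k)) j≤ ⟩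
          (4 * k + 3) * e * suc (a k)             ≡⟨ arith (4 * k + 3) e (suc (a k)) ⟩
          a′ k * e                                ∎
          where
          arith : ∀ x y z → x * y * z ≡ x * z * y
          arith = solve-∀
          arith₁ : ∀ g k h → (g + 3) * k + (2 + h) ≡ g * k + h + (3 * k + 2) * 1
          arith₁ = solve-∀
          arith₂ : ∀ g k h → g * k + h + (3 * k + 2) * g + (g + 4 * k * h + 2 * h) ≡ (4 * k + 3) * (g + h)
          arith₂ = solve-∀
          j≤ : j ≤ (4 * k + 3) * e
          j≤ = begin
            (g + 3) * k + suc i                   ≤⟨ +-monoʳ-≤ ((g + 3) * k) (1+i≤ i) ⟩
            (g + 3) * k + (2 + h)                 ≡⟨ arith₁ g k h ⟩
            g * k + h + (3 * k + 2) * 1           ≤⟨ +-monoʳ-≤ (g * k + h) (*-monoʳ-≤ (3 * k + 2) 1≤g) ⟩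
            g * k + h + (3 * k + 2) * g           ≤⟨ m≤m+n _ (g + 4 * k * h + 2 * h) ⟩
            g * k + h + (3 * k + 2) * g + (g + 4 * k * h + 2 * h) ≡⟨ arith₂ g k h ⟩
            (4 * k + 3) * e                       ∎
        steps≤ : ∀ (X : Samples n (j * suc (a k))) → steps (valiant n k X) ≤ b k * n ^ k * e
        steps≤ X = begin
          steps (valiant n k X)                                ≤⟨ valiant-steps n k X (≤-trans (s≤s z≤n) 2≤n) (≤-trans (s≤s z≤n) 2≤k) ⟩
          4 ^ k * (7 + j * suc (a k) * (2 + k)) * n ^ k        ≤⟨ *-monoˡ-≤ (n ^ k) (*-monoʳ-≤ (4 ^ k) inner) ⟩
          4 ^ k * ((7 + a′ k * (2 + k)) * e) * n ^ k           ≡⟨ arith (4 ^ k) (7 + a′ k * (2 + k)) e (n ^ k) ⟩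
          b k * n ^ k * e                                      ∎
          where
          arith : ∀ x y z w → x * (y * z) * w ≡ x * y * w * z
          arith = solve-∀
          arith₁ : ∀ x y z → 7 * z + x * z * y ≡ (7 + x * y) * z
          arith₁ = solve-∀
          inner : 7 + j * suc (a k) * (2 + k) ≤ (7 + a′ k * (2 + k)) * e
          inner = begin
            7 * 1 + j * suc (a k) * (2 + k)     ≤⟨ +-mono-≤ (*-monoʳ-≤ 7 (≤-trans 1≤g (m≤m+n g h))) (*-monoˡ-≤ (2 + k) T≤) ⟩
            7 * e + a′ k * e * (2 + k)          ≡⟨ arith₁ (a′ k) (2 + k) e ⟩
            (7 + a′ k * (2 + k)) * e            ∎

      conclusion : ∀ n → 1 ≤ n → Conclusion n
      conclusion (suc zero)        _ = one-variable
      conclusion n@(suc (suc _)) _ = many-variables n (s≤s (s≤s z≤n))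

Learnable : ℚ → Set₁
Learnable ζ =
    ∃[ K ]
    (∀ (k : ℕ) → ∃[ A ] ∃[ B ]
    (∀ (d s : ℕ) → 1 ≤ d → fromℕ s ≡ ζ *ℚ fromℕ k →
    C ζ *ᴿ log₂ ⟦ d ⟧ +ᴿ ⟦ isqrt k ⟧ +ᴿ ⟦ K ⟧ ≤ᴿ ⟦ k ⟧ →
    ∀ (n : ℕ) → 1 ≤ n →
    ∀ (δ : Cut) → IsReal δ → ⟦ 0 ⟧ <ᴿ δ → δ <ᴿ ⟦ 1 ⟧ →
    ∃[ T ] (⟦ T ⟧ ≤ᴿ ⟦ A ⟧ *ᴿ log₂ (⟦ n ⟧ ÷ᴿ δ) ×
    (∀ (Φ : CNF n) → IsKDS k d s Φ →
    ⟦ 1 ⟧ -ᴿ δ ≤ᴿ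
    fromℚ (Pr Φ T (λ X → result (valiant n k X) ≗μ? Φ)) ×
    (2 ≤ n → ∀ (X : Samples n T) →
    ⟦ steps (valiant n k X) ⟧ ≤ᴿ ⟦ B * n ^ k ⟧ *ᴿ log₂ (⟦ n ⟧ ÷ᴿ δ))))))

learnable : ∀ {ζ} → Parameters ζ → Learnable ζ
learnable ps = slack M , λ k → suc (a′ k) , suc (b k) , λ d s 1≤d s≡ζk hyp n 1≤n δ real 0<δ δ<1 →
  conclusion 1≤d s≡ζk hyp real 0<δ δ<1 n 1≤n
  where open Main ps

theorem1p7 : ∃[ f ] LittleO f ×
    (∀ (ζ : ℚ) → 0ℚ <ℚ ζ → ζ <ℚ 1ℚ →
    ∃[ K ]
    (∀ (k : ℕ) → ∃[ A ] ∃[ B ]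
    (∀ (d s : ℕ) → 1 ≤ d → fromℕ s ≡ ζ *ℚ fromℕ k →
    C ζ *ᴿ log₂ ⟦ d ⟧ +ᴿ ⟦ f k ⟧ +ᴿ ⟦ K ⟧ ≤ᴿ ⟦ k ⟧ →
    ∀ (n : ℕ) → 1 ≤ n →
    ∀ (δ : Cut) → IsReal δ → ⟦ 0 ⟧ <ᴿ δ → δ <ᴿ ⟦ 1 ⟧ →
    ∃[ T ] (⟦ T ⟧ ≤ᴿ ⟦ A ⟧ *ᴿ log₂ (⟦ n ⟧ ÷ᴿ δ) ×
    (∀ (Φ : CNF n) → IsKDS k d s Φ →
    ⟦ 1 ⟧ -ᴿ δ ≤ᴿ
    fromℚ (Pr Φ T (λ X → result (valiant n k X) ≗μ? Φ)) ×
    (2 ≤ n → ∀ (X : Samples n T) →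
    ⟦ steps (valiant n k X) ⟧ ≤ᴿ ⟦ B * n ^ k ⟧ *ᴿ log₂ (⟦ n ⟧ ÷ᴿ δ)))))))
theorem1p7 = isqrt , isqrt-littleO , λ ζ 0<ζ ζ<1 → learnable (parameters ζ 0<ζ ζ<1)
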